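{- Let $r, m \ge 1$ be fixed integers and let $n$ be sufficiently large. If $G$ is a graph on $n$ vertices with at least $n^{2-\frac{1}{r}} (\log n)^{\frac{60}{r}}$ edges, then $G$ contains an $r$-blow-up of a subdivision of $K_m$, where each edge of $K_m$ is subdivided at most $(\log n)^{6}$ times.
   Context: Logarithms are in base 2. For an integer $r \ge 1$ and a graph $F$, the $r$-blow-up $F[r]$ is the graph obtained by replacing each vertex of $F$ by an independent set of size $r$ (these sets pairwise disjoint) and each edge of $F$ by a complete bipartite graph $K_{r,r}$ between the corresponding sets. A subdivision of $K_m$ is obtained from $K_m$ by replacing each edge by a path between its endpoints, these paths internally vertex-disjoint; an edge is subdivided at most $t$ times if its path has at most $t$ internal vertices. -}

module Defs where

open import Data.Nat using (ℕ; zero; suc; _+_; _*_; _∸_; _^_; _≤_; _<_; _<ᵇ_)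
open import Data.Bool using (Bool; true; false; _∧_; if_then_else_; T)
open import Data.Fin using (Fin; toℕ)
open import Data.List using (List; map; allFin)
open import Data.Nat.ListAction using (sum)
open import Data.Product using (Σ; _×_; _,_; ∃)
open import Data.Sum using (_⊎_)
open import Relation.Binary.PropositionalEquality using (_≡_)

record Graph (n : ℕ) : Set where
  field
    adj    : Fin n → Fin n → Bool
    sym    : ∀ i j → adj i j ≡ adj j i
    irrefl : ∀ i → adj i i ≡ false
open Graph public

edgeCount : ∀ {n} → Graph n → ℕ
edgeCount {n} G =
  sum (map (λ i → sum (map (λ j → if (toℕ i <ᵇ toℕ j) ∧ adj G i j then 1 else 0)
                           (allFin n)))
           (allFin n))

record Pattern : Set₁ where
  field
    V : Set
    E : V → V → Set
open Pattern public

Contains : ∀ {n} → Graph n → Pattern → Set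
Contains {n} G H =
  Σ (V H → Fin n) λ φ →
    (∀ x y → φ x ≡ φ y → x ≡ y) ×
    (∀ x y → E H x y → T (adj G (φ x) (φ y)))

blowUp : ℕ → Pattern → Pattern
blowUp r F = record
  { V = V F × Fin r
  ; E = λ { (u , _) (v , _) → E F u v } }

-- Subdivision of K_m in which the edge {i,j} (i < j) is replaced by a
-- path i - w(i,j,0) - ... - w(i,j,ℓ i j - 1) - j with ℓ i j internal vertices.

module _ (m : ℕ) (ℓ : Fin m → Fin m → ℕ) where

  data SubV : Set where
    branch : Fin m → SubV
    inner  : (i j : Fin m) → toℕ i < toℕ j → Fin (ℓ i j) → SubV

  data SubE : SubV → SubV → Set where
    direct : ∀ i j → toℕ i < toℕ j → ℓ i j ≡ 0 → SubE (branch i) (branch j)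
    start  : ∀ i j (p : toℕ i < toℕ j) (k : Fin (ℓ i j)) → toℕ k ≡ 0 →
             SubE (branch i) (inner i j p k)
    mid    : ∀ i j (p : toℕ i < toℕ j) (k k′ : Fin (ℓ i j)) → toℕ k′ ≡ suc (toℕ k) →
             SubE (inner i j p k) (inner i j p k′)
    end    : ∀ i j (p : toℕ i < toℕ j) (k : Fin (ℓ i j)) → suc (toℕ k) ≡ ℓ i j →
             SubE (inner i j p k) (branch j)

  subdivK : Pattern
  subdivK = record { V = SubV ; E = λ x y → SubE x y ⊎ SubE y x }

-- Real-valued conditions on log₂ n, expressed via rationals p/q
-- (L = log₂ n real; L ≤ p/q ⇔ n^q ≤ 2^p, L ≥ p/q ⇔ 2^p ≤ n^q).

-- e ≥ n^(2-1/r) (log₂ n)^(60/r)   ⇔   (log₂ n)^60 ≤ e^r / n^(2r-1)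
--   ⇔ for every rational p/q > (e^r / n^(2r-1))^(1/60) : log₂ n ≤ p/q
ManyEdges : (r n e : ℕ) → Set
ManyEdges r n e =
  ∀ p q → 1 ≤ q → e ^ r * q ^ 60 < p ^ 60 * n ^ (2 * r ∸ 1) → n ^ q ≤ 2 ^ p

-- t ≤ (log₂ n)^6   ⇔   for every rational p/q < t^(1/6) : p/q ≤ log₂ n
AtMostLog6 : (n t : ℕ) → Set
AtMostLog6 n t = ∀ p q → 1 ≤ q → p ^ 6 < t * q ^ 6 → 2 ^ p ≤ n ^ q

{-# OPTIONS --safe #-}
-- Call two r-tuples of vertices of G adjacent when all r² pairs are edges of G. An r-blow-up of a
-- subdivision of K_m in G is a subdivision of K_m in this tuple graph whose tuples are injective and
-- pairwise disjoint. By convexity the average codegree of a tuple is at least (log n)^60; tuples of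
-- smaller order codegree are discarded. Repeatedly passing to the denser side of a sparse cut, with
-- volumes measured by the degrees in the whole tuple graph, reaches a set v of tuples all of whose
-- cuts have conductance at least of order 1 / log n. By Cheeger's inequality the lazy random walk on
-- v (with a loop for every edge leaving v) mixes in O((log n)³) steps.
--
-- A step of this walk lands on a tuple through a prescribed vertex of G with probability at most
-- r / codegree. Consider walks of three mixing times from S to T. Two visited tuples split such a
-- walk into three gaps, one of which is long enough to be replaced by the stationary measure; on the
-- other two an intersection of the two tuples is a rare event. Hence most walks consist of pairwise
-- equal or disjoint tuples avoiding any given polylogarithmic set of vertices, and erasing loops
-- gives a path. The m branch tuples and the paths between them are then chosen greedily.
--
-- Weights are cleared of denominators throughout, so all inequalities are between natural numbers.
module Submission where

open import Defs hiding (sym; V; E)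
open import Data.Nat using (ℕ; zero; suc; pred; _+_; _*_; _∸_; _^_; _≤_; _<_; z≤n; s≤s; ∣_-_∣; _≤?_; _<?_; _<ᵇ_; >-nonZero; NonZero; _!)
open import Data.Nat.Properties
open import Data.Nat.Divisibility using (_∣?_; divides; m≤n⇒m!∣n!; ∣-trans; m∣m*n)
import Data.Nat.ListAction as ListAction
open import Data.Nat.Tactic.RingSolver using (solve-∀)
import Data.Bool as Bool
open import Data.Bool using (Bool; true; false; _∧_; not; if_then_else_)
open import Data.Bool.Properties using (T-≡; ∧-zeroʳ)
open import Data.Fin using (Fin; zero; suc; toℕ; combine; remQuot; finToFun; _↑ˡ_; _↑ʳ_)
import Data.Fin.Properties as Finₚ
open import Data.Fin.Subset using (Subset)
open import Data.Fin.Subset.Properties using (anySubset?)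
import Data.Vec as Vec
open import Data.Vec.Properties using (lookup∘tabulate)
open import Data.List using (List; []; _∷_; _++_; length; lookup; tabulate; concat; filter; map; allFin)
open import Data.List.Properties using (length-++; length-tabulate; length-filter)
open import Data.List.Relation.Unary.Any using (here; there)
open import Data.List.Membership.Propositional using (_∈_; _∉_)
open import Data.List.Membership.Propositional.Properties using (∈-lookup; ∈-++⁺ˡ; ∈-++⁺ʳ; ∈-++⁻; ∈-tabulate⁺; ∈-tabulate⁻; ∈-filter⁺; ∈-filter⁻; ∈-concat⁺′; ∈-map⁺)
open import Data.List.Membership.DecPropositional using () renaming (_∈?_ to ∈?)
open import Data.Product using (Σ; ∃; ∃-syntax; _×_; _,_; proj₁; proj₂)
open import Data.Sum using (_⊎_; inj₁; inj₂)
open import Data.Unit using (tt)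
open import Data.Empty using (⊥; ⊥-elim)
open import Function using (_∘_; id)
open import Function.Bundles using (Equivalence)
open import Relation.Nullary using (Dec; yes; no; does; ¬_)
open import Relation.Nullary.Decidable using (¬?; _×-dec_; dec-true)
open import Relation.Binary.Definitions using (tri<; tri≈; tri>)
open import Relation.Binary.PropositionalEquality
import Algebra.Properties.Semiring.Sum +-*-semiring as Sum
import Algebra.Properties.CommutativeMonoid.Sum *-1-commutativeMonoid as Product

-- The conflict is between expansion and randomness. An expanding set v is found by discarding
-- tuples, but the neighbours of a tuple inside v are no longer all r-tuples of a common
-- neighbourhood, so a uniform step inside v might concentrate on few vertices of G. Keeping the
-- full degree `d` as the weight of a tuple, with loops in place of the lost edges, settles this:
-- every transition inside v keeps the denominator of the full tuple graph, so landing probabilities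
-- are bounded there, where a neighbour of x consists of r independent common neighbours. The loops
-- do no harm, since a tuple does not conflict with itself. The price is that edges inside v must
-- stay a fixed share of its volume. This share starts at 1/2 and never falls below 1/4, because
-- each cut is charged to its smaller side only.
--
-- With L about log n and mixing time of order L³, constants are absorbed by further factors L:
-- walks have length K ≤ L⁴, an error term b built from the used vertices is at most L⁵, and the
-- first moment bound compares about K³ b with the codegree.

-- Indicators and finite sums

⟦_⟧ : Bool → ℕ
⟦ true ⟧  = 1
⟦ false ⟧ = 0

δ : ∀ {n} → Fin n → Fin n → ℕ
δ x y = ⟦ does (x Finₚ.≟ y) ⟧

-- Opaque so that unification can recover the summand f from ∑ f.
opaque
  ∑ : ∀ {n} → (Fin n → ℕ) → ℕ
  ∑ = Sum.sum

  ∑-cong : ∀ {n} {f g : Fin n → ℕ} → (∀ i → f i ≡ g i) → ∑ f ≡ ∑ g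
  ∑-cong = Sum.sum-cong-≗

  ∑-+ : ∀ {n} (f g : Fin n → ℕ) → ∑ (λ i → f i + g i) ≡ ∑ f + ∑ g
  ∑-+ = Sum.∑-distrib-+

  ∑-swap : ∀ {n} {N} (F : Fin n → Fin N → ℕ) → ∑ (λ i → ∑ (F i)) ≡ ∑ (λ j → ∑ λ i → F i j)
  ∑-swap = Sum.∑-comm

  ∑-*ˡ : ∀ {n} c (f : Fin n → ℕ) → ∑ (λ i → c * f i) ≡ c * ∑ f
  ∑-*ˡ c f = sym (Sum.*-distribˡ-sum c f)

  ∑-*ʳ : ∀ {n} c (f : Fin n → ℕ) → ∑ (λ i → f i * c) ≡ ∑ f * c
  ∑-*ʳ c f = sym (Sum.*-distribʳ-sum c f)

  ∑-zero : (f : Fin 0 → ℕ) → ∑ f ≡ 0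
  ∑-zero f = refl

  ∑-suc : ∀ {n} (f : Fin (suc n) → ℕ) → ∑ f ≡ f zero + ∑ (f ∘ suc)
  ∑-suc f = refl

  ∑-mono : ∀ {n} {f g : Fin n → ℕ} → (∀ i → f i ≤ g i) → ∑ f ≤ ∑ g
  ∑-mono {n = zero}  f≤g = z≤n
  ∑-mono {n = suc n} f≤g = +-mono-≤ (f≤g zero) (∑-mono (f≤g ∘ suc))

  ∑-≡0 : ∀ {n} {f : Fin n → ℕ} → (∀ i → f i ≡ 0) → ∑ f ≡ 0
  ∑-≡0 {n = zero}  f≡0 = refl
  ∑-≡0 {n = suc n} f≡0 = cong₂ _+_ (f≡0 zero) (∑-≡0 (f≡0 ∘ suc))

  ∑-const : ∀ n c → ∑ {n} (λ _ → c) ≡ n * c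
  ∑-const zero    c = refl
  ∑-const (suc n) c = cong (c +_) (∑-const n c)

  term≤∑ : ∀ {n} (f : Fin n → ℕ) (i : Fin n) → f i ≤ ∑ f
  term≤∑ f zero    = m≤m+n _ _
  term≤∑ f (suc i) = ≤-trans (term≤∑ (f ∘ suc) i) (m≤n+m _ _)

  ∑-witness-< : ∀ {n} (f g : Fin n → ℕ) → ∑ f < ∑ g → ∃[ i ] f i < g i
  ∑-witness-< {n = suc n} f g lt with f zero <? g zero
  ... | yes p = zero , p
  ... | no ¬p with ∑-witness-< (f ∘ suc) (g ∘ suc)
                   (+-cancelˡ-< (f zero) _ _ (<-≤-trans lt (+-monoˡ-≤ _ (≮⇒≥ ¬p))))
  ...   | i , q = suc i , q

δ-refl : ∀ {n} (x : Fin n) → δ x x ≡ 1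
δ-refl x with x Finₚ.≟ x
... | yes _ = refl
... | no x≢x = ⊥-elim (x≢x refl)

δ-≢ : ∀ {n} {x y : Fin n} → x ≢ y → δ x y ≡ 0
δ-≢ {x = x} {y} x≢y with x Finₚ.≟ y
... | yes x≡y = ⊥-elim (x≢y x≡y)
... | no _ = refl

δ-sym : ∀ {n} (x y : Fin n) → δ x y ≡ δ y x
δ-sym x y with x Finₚ.≟ y
... | yes refl = sym (δ-refl x)
... | no x≢y = sym (δ-≢ (x≢y ∘ sym))

δ-subst : ∀ {n} (x y : Fin n) (f : Fin n → ℕ) → δ x y * f y ≡ δ x y * f x
δ-subst x y f with x Finₚ.≟ y
... | yes refl = refl
... | no _ = refl

∑-δ : ∀ {n} (x : Fin n) (f : Fin n → ℕ) → ∑ (λ y → δ x y * f y) ≡ f x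
∑-δ {suc n} zero f = trans (∑-suc _)
  (trans (cong₂ _+_ (+-identityʳ (f zero)) (∑-≡0 λ _ → refl)) (+-identityʳ _))
∑-δ {suc n} (suc x) f = trans (∑-suc _) (∑-δ x (f ∘ suc))

⟦∧⟧ : ∀ a b → ⟦ a ∧ b ⟧ ≡ ⟦ a ⟧ * ⟦ b ⟧
⟦∧⟧ true  b = sym (+-identityʳ _)
⟦∧⟧ false b = refl

⟦⟧≤1 : ∀ b → ⟦ b ⟧ ≤ 1
⟦⟧≤1 true  = ≤-refl
⟦⟧≤1 false = z≤n

⟦⟧-split : ∀ b → ⟦ b ⟧ + ⟦ not b ⟧ ≡ 1
⟦⟧-split true  = refl
⟦⟧-split false = refl

-- Inequalities for natural numbers and truncated subtraction

m*m≥m : ∀ m → m ≤ m * m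
m*m≥m zero    = z≤n
m*m≥m (suc m) = m≤m*n (suc m) (suc m)

swap* : ∀ a b c → a * (b * c) ≡ b * (a * c)
swap* = solve-∀

^-distribʳ-* : ∀ j a b → (a * b) ^ j ≡ a ^ j * b ^ j
^-distribʳ-* zero a b = refl
^-distribʳ-* (suc j) a b = trans (cong (a * b *_) (^-distribʳ-* j a b)) (lem a b (a ^ j) (b ^ j))
  where
  lem : ∀ a b x y → a * b * (x * y) ≡ a * x * (b * y)
  lem = solve-∀

pos : ℕ → Bool
pos zero    = false
pos (suc _) = true

2ab≤a²+b² : ∀ a b → 2 * (a * b) ≤ a * a + b * b
2ab≤a²+b² a b with ≤-total a b
... | inj₁ a≤b with m≤n⇒∃[o]m+o≡n a≤b
...   | k , refl = ≤-trans (m≤m+n _ (k * k)) (≤-reflexive (lem a k))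
  where
  lem : ∀ a k → 2 * (a * (a + k)) + k * k ≡ a * a + (a + k) * (a + k)
  lem = solve-∀
2ab≤a²+b² a b | inj₂ b≤a with m≤n⇒∃[o]m+o≡n b≤a
...   | k , refl = ≤-trans (m≤m+n _ (k * k)) (≤-reflexive (lem b k))
  where
  lem : ∀ b k → 2 * ((b + k) * b) + k * k ≡ (b + k) * (b + k) + b * b
  lem = solve-∀

-- One layer of the co-area formula: the bottom level set is split off, and the predecessors carry
-- the remaining ones.
∣-∣-pred : ∀ a b → ∣ a - b ∣ ≡ ∣ ⟦ pos a ⟧ - ⟦ pos b ⟧ ∣ + ∣ pred a - pred b ∣
∣-∣-pred zero    zero    = refl
∣-∣-pred zero    (suc b) = refl
∣-∣-pred (suc a) zero    = cong suc (sym (∣-∣-identityʳ a))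
∣-∣-pred (suc a) (suc b) = refl

∣⟦⟧-⟦⟧∣ : ∀ a b → ∣ ⟦ a ⟧ - ⟦ b ⟧ ∣ ≡ ⟦ a ⟧ * ⟦ not b ⟧ + ⟦ b ⟧ * ⟦ not a ⟧
∣⟦⟧-⟦⟧∣ true  true  = refl
∣⟦⟧-⟦⟧∣ true  false = refl
∣⟦⟧-⟦⟧∣ false true  = refl
∣⟦⟧-⟦⟧∣ false false = refl

pos-pred : ∀ a → a ≡ ⟦ pos a ⟧ + pred a
pos-pred zero    = refl
pos-pred (suc a) = refl

pos-sq : ∀ a → pos (a * a) ≡ pos a
pos-sq zero    = refl
pos-sq (suc a) = refl

∣a²-b²∣ : ∀ a b → ∣ a * a - b * b ∣ ≡ ∣ a - b ∣ * (a + b)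
∣a²-b²∣ a b = trans (trans (sym (∣m+n-m+o∣≡∣n-o∣ (a * b) (a * a) (b * b)))
  (cong₂ ∣_-_∣ (lem₁ a b) (lem₂ a b))) (sym (*-distribʳ-∣-∣ (a + b) a b))
  where
  lem₁ : ∀ a b → a * b + a * a ≡ a * (a + b)
  lem₁ = solve-∀
  lem₂ : ∀ a b → a * b + b * b ≡ b * (a + b)
  lem₂ = solve-∀

∣-∣-sq : ∀ a b → ∣ a - b ∣ * ∣ a - b ∣ + 2 * (a * b) ≡ a * a + b * b
∣-∣-sq a b with ≤-total a b
... | inj₁ a≤b with m≤n⇒∃[o]m+o≡n a≤b
...   | k , refl = trans (cong (λ z → z * z + 2 * (a * (a + k))) (∣m-m+n∣≡n a k)) (lem a k)
  where
  lem : ∀ a k → k * k + 2 * (a * (a + k)) ≡ a * a + (a + k) * (a + k)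
  lem = solve-∀
∣-∣-sq a b | inj₂ b≤a with m≤n⇒∃[o]m+o≡n b≤a
...   | k , refl = trans (cong (λ z → z * z + 2 * ((b + k) * b))
                           (trans (∣-∣-comm (b + k) b) (∣m-m+n∣≡n b k))) (lem b k)
  where
  lem : ∀ b k → k * k + 2 * ((b + k) * b) ≡ (b + k) * (b + k) + b * b
  lem = solve-∀

-- The expansion of (a - c)² without negative numbers; one of the two truncated differences is
-- always zero.
sq-∸ : ∀ a c → a * a + c * c ≡ 2 * (a * c) + ((a ∸ c) * (a ∸ c) + (c ∸ a) * (c ∸ a))
sq-∸ zero    zero    = refl
sq-∸ zero    (suc c) = refl
sq-∸ (suc a) zero    = lem a
  where
  lem : ∀ a → (1 + a) * (1 + a) + 0 ≡ 2 * ((1 + a) * 0) + ((1 + a) * (1 + a) + 0)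
  lem = solve-∀
sq-∸ (suc a) (suc c) = trans (lem a c) (trans (cong (λ z → z + 2 * (a + c + 1)) (sq-∸ a c)) (lem′ a c _))
  where
  lem : ∀ a c → (1 + a) * (1 + a) + (1 + c) * (1 + c) ≡ a * a + c * c + 2 * (a + c + 1)
  lem = solve-∀
  lem′ : ∀ a c z → 2 * (a * c) + z + 2 * (a + c + 1) ≡ 2 * ((1 + a) * (1 + c)) + z
  lem′ = solve-∀

-- If a and b lie on the same side of c, only one of the two parts changes. If c separates them, the
-- changes x and z of the parts add up to the distance of a and b, and x² + z² ≤ (x + z)².
∸-contract : ∀ a b c → ∣ a ∸ c - b ∸ c ∣ * ∣ a ∸ c - b ∸ c ∣ + ∣ c ∸ a - c ∸ b ∣ * ∣ c ∸ a - c ∸ b ∣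
                        ≤ ∣ a - b ∣ * ∣ a - b ∣
∸-contract a       b       zero    rewrite 0∸n≡0 a | 0∸n≡0 b = ≤-reflexive (+-identityʳ _)
∸-contract zero    zero    (suc c) rewrite ∣n-n∣≡0 c = z≤n
∸-contract (suc a) (suc b) (suc c) = ∸-contract a b c
∸-contract zero    (suc b) (suc c) = ≤-trans (+-monoʳ-≤ (x * x) (*-mono-≤ y≤ y≤)) (≤-trans (m≤m+n _ _)
   (≤-trans (≤-reflexive (lem x (suc y))) (*-mono-≤ eq eq)))
  where
  x = b ∸ c
  y = b ∸ x
  y≤ : ∣ suc c - c ∸ b ∣ ≤ suc y
  y≤ with ≤-total b c
  ... | inj₁ b≤c rewrite m≤n⇒m∸n≡0 b≤c = ≤-reflexive (begin
      ∣ suc c - c ∸ b ∣ ≡⟨ ∣-∣-comm (suc c) (c ∸ b) ⟩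
      ∣ c ∸ b - suc c ∣ ≡⟨ m≤n⇒∣m-n∣≡n∸m (≤-trans (m∸n≤m c b) (n≤1+n c)) ⟩
      suc c ∸ (c ∸ b)   ≡⟨ +-∸-assoc 1 (m∸n≤m c b) ⟩
      suc (c ∸ (c ∸ b)) ≡⟨ cong suc (m∸[m∸n]≡n b≤c) ⟩
      suc b ∎)
    where open ≡-Reasoning
  ... | inj₂ c≤b rewrite m≤n⇒m∸n≡0 c≤b = s≤s (≤-reflexive (sym (m∸[m∸n]≡n c≤b)))
  lem : ∀ x z → x * x + z * z + 2 * (x * z) ≡ (x + z) * (x + z)
  lem = solve-∀
  eq : x + suc y ≤ suc b
  eq = ≤-reflexive (trans (+-suc x y) (cong suc (m+[n∸m]≡n (m∸n≤m b c))))
∸-contract (suc a) zero    (suc c) = subst₂ _≤_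
  (cong₂ _+_ (cong₂ _*_ (∣-∣-comm 0 (a ∸ c)) (∣-∣-comm 0 (a ∸ c)))
             (cong₂ _*_ (∣-∣-comm (suc c) (c ∸ a)) (∣-∣-comm (suc c) (c ∸ a))))
  refl (∸-contract zero (suc a) (suc c))

bounded : ∀ {N} (f : Fin N → ℕ) → ∃[ b ] (∀ x → f x ≤ b)
bounded f = ∑ f , term≤∑ f

-- Cheeger and Poincaré inequalities for a weighted graph

module Weighted {N : ℕ} (w : Fin N → Fin N → ℕ) (w-sym : ∀ x y → w x y ≡ w y x) where

  π : Fin N → ℕ
  π x = ∑ (w x)

  W : ℕ
  W = ∑ π

  opaque
    ∫ : (Fin N → ℕ) → ℕ
    ∫ f = ∑ λ x → π x * f x

    ∬ : (Fin N → Fin N → ℕ) → ℕ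
    ∬ F = ∑ λ x → ∑ λ y → w x y * F x y

    ∫-cong : ∀ {f g} → (∀ x → f x ≡ g x) → ∫ f ≡ ∫ g
    ∫-cong e = ∑-cong λ x → cong (π x *_) (e x)

    ∬-cong : ∀ {F G} → (∀ x y → F x y ≡ G x y) → ∬ F ≡ ∬ G
    ∬-cong e = ∑-cong λ x → ∑-cong λ y → cong (w x y *_) (e x y)

    ∬-mono : ∀ {F G} → (∀ x y → F x y ≤ G x y) → ∬ F ≤ ∬ G
    ∬-mono e = ∑-mono λ x → ∑-mono λ y → *-monoʳ-≤ (w x y) (e x y)

    ∫-mono : ∀ {f g} → (∀ x → f x ≤ g x) → ∫ f ≤ ∫ g
    ∫-mono e = ∑-mono λ x → *-monoʳ-≤ (π x) (e x)

    ∫-+ : ∀ f g → ∫ (λ x → f x + g x) ≡ ∫ f + ∫ g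
    ∫-+ f g = trans (∑-cong λ x → *-distribˡ-+ (π x) (f x) (g x)) (∑-+ _ _)

    ∬-+ : ∀ F G → ∬ (λ x y → F x y + G x y) ≡ ∬ F + ∬ G
    ∬-+ F G = trans (∑-cong λ x →
        trans (∑-cong λ y → *-distribˡ-+ (w x y) (F x y) (G x y)) (∑-+ _ _))
      (∑-+ _ _)

    ∫-* : ∀ c f → ∫ (λ x → c * f x) ≡ c * ∫ f
    ∫-* c f = trans (∑-cong λ x → swap* (π x) c (f x)) (∑-*ˡ c _)

    ∬-* : ∀ c F → ∬ (λ x y → c * F x y) ≡ c * ∬ F
    ∬-* c F = trans (∑-cong λ x →
        trans (∑-cong λ y → swap* (w x y) c (F x y)) (∑-*ˡ c _))
      (∑-*ˡ c _)

    ∬-fst : ∀ f → ∬ (λ x y → f x) ≡ ∫ f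
    ∬-fst f = ∑-cong λ x → ∑-*ʳ (f x) (w x)

    ∬-swap : ∀ F → ∬ F ≡ ∬ (λ x y → F y x)
    ∬-swap F = trans (∑-swap _) (∑-cong λ y → ∑-cong λ x → cong (_* F x y) (w-sym x y))

    ∬-snd : ∀ f → ∬ (λ x y → f y) ≡ ∫ f
    ∬-snd f = trans (∬-swap _) (∬-fst f)

    ∫-1 : ∫ (λ _ → 1) ≡ W
    ∫-1 = ∑-cong λ x → *-identityʳ (π x)

    ∫-def : ∀ f → ∫ f ≡ ∑ λ x → π x * f x
    ∫-def f = refl

    ∬-def : ∀ F → ∬ F ≡ ∑ λ x → ∑ λ y → w x y * F x y
    ∬-def F = refl

    ∫-≡0 : ∀ {f} → (∀ x → f x ≡ 0) → ∫ f ≡ 0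
    ∫-≡0 e = ∑-≡0 λ x → trans (cong (π x *_) (e x)) (*-zeroʳ (π x))

  cut : (Fin N → Bool) → ℕ
  cut A = ∬ λ x y → ⟦ A x ⟧ * ⟦ not (A y) ⟧

  -- Conductance at least 1 / q, tested on sets with at most half of the stationary weight.
  Expanding : ℕ → Set
  Expanding q = ∀ A → 2 * ∫ (⟦_⟧ ∘ A) ≤ W → ∫ (⟦_⟧ ∘ A) ≤ q * cut A

  module _ {q : ℕ} (exp : Expanding q) where

    -- Co-area formula: g is the sum of the indicators of its superlevel sets.
    cheeger-L¹ : ∀ M (g : Fin N → ℕ) → (∀ x → g x ≤ M) → 2 * ∫ (λ x → ⟦ pos (g x) ⟧) ≤ W →
                 2 * ∫ g ≤ q * ∬ (λ x y → ∣ g x - g y ∣)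
    cheeger-L¹ zero g g≤ _ =
      ≤-trans (≤-reflexive (cong (2 *_) (∫-≡0 {g} λ x → n≤0⇒n≡0 (g≤ x)))) z≤n
    cheeger-L¹ (suc M) g g≤ half = begin
      2 * ∫ g
        ≡⟨ cong (2 *_) (trans (∫-cong (λ x → pos-pred (g x))) (∫-+ (λ x → ⟦ A x ⟧) g⁻)) ⟩
      2 * (∫ (⟦_⟧ ∘ A) + ∫ g⁻)
        ≡⟨ *-distribˡ-+ 2 (∫ (⟦_⟧ ∘ A)) (∫ g⁻) ⟩
      2 * ∫ (⟦_⟧ ∘ A) + 2 * ∫ g⁻
        ≤⟨ +-mono-≤ (*-monoʳ-≤ 2 (exp A half)) (cheeger-L¹ M g⁻ (λ x → pred-≤ (g≤ x)) half′) ⟩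
      2 * (q * cut A) + q * ∬ E
        ≡⟨ lem q (cut A) (∬ E) ⟩
      q * (cut A + cut A + ∬ E)
        ≡⟨ cong (λ z → q * (cut A + z + ∬ E)) (∬-swap _) ⟩
      q * (cut A + ∬ (λ x y → C y x) + ∬ E)
        ≡⟨ cong (q *_) (trans (∬-+ (λ x y → C x y + C y x) E) (cong (_+ ∬ E) (∬-+ C (λ x y → C y x)))) ⟨
      q * ∬ (λ x y → C x y + C y x + E x y)
        ≡⟨ cong (q *_) (∬-cong λ x y → trans (∣-∣-pred (g x) (g y)) (cong (_+ E x y) (∣⟦⟧-⟦⟧∣ (A x) (A y)))) ⟨
      q * ∬ (λ x y → ∣ g x - g y ∣) ∎
      where
      open ≤-Reasoning
      A : Fin N → Bool
      A x = pos (g x)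
      g⁻ : Fin N → ℕ
      g⁻ x = pred (g x)
      C E : Fin N → Fin N → ℕ
      C x y = ⟦ A x ⟧ * ⟦ not (A y) ⟧
      E x y = ∣ g⁻ x - g⁻ y ∣
      pred-≤ : ∀ {a b} → a ≤ suc b → pred a ≤ b
      pred-≤ z≤n = z≤n
      pred-≤ (s≤s p) = p
      ⟦pos-pred⟧ : ∀ a → ⟦ pos (pred a) ⟧ ≤ ⟦ pos a ⟧
      ⟦pos-pred⟧ zero = z≤n
      ⟦pos-pred⟧ (suc a) = ⟦⟧≤1 (pos a)
      half′ : 2 * ∫ (λ x → ⟦ pos (g⁻ x) ⟧) ≤ W
      half′ = ≤-trans (*-monoʳ-≤ 2 (∫-mono λ x → ⟦pos-pred⟧ (g x))) half
      lem : ∀ q c d → 2 * (q * c) + q * d ≡ q * (c + c + d)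
      lem = solve-∀

    -- Apply `cheeger-L¹` to f² and factor the difference of squares as a difference times a sum.
    -- AM-GM, weighted so that q falls on the difference, leaves terms in f² that integrate to 4 F;
    -- this is half of the left side, which was doubled beforehand to absorb them.
    cheeger-L² : ∀ (f : Fin N → ℕ) → 2 * ∫ (λ x → ⟦ pos (f x) ⟧) ≤ W →
                 ∫ (λ x → f x * f x) ≤ q * q * ∬ (λ x y → ∣ f x - f y ∣ * ∣ f x - f y ∣)
    cheeger-L² f half = *-cancelˡ-≤ {F} {q * q * ∬ Δ²} 4 (+-cancelʳ-≤ (4 * F) (4 * F) (4 * (q * q * ∬ Δ²)) (begin
      4 * F + 4 * F
        ≡⟨ lem₁ F ⟩
      4 * (2 * F)
        ≤⟨ *-monoʳ-≤ 4 (cheeger-L¹ (proj₁ bnd) g (proj₂ bnd) half′) ⟩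
      4 * (q * ∬ D)
        ≡⟨ trans (∬-* 4 (λ x y → q * D x y)) (cong (4 *_) (∬-* q D)) ⟨
      ∬ (λ x y → 4 * (q * D x y))
        ≤⟨ ∬-mono pw ⟩
      ∬ (λ x y → 4 * (q * q) * Δ² x y + (2 * g x + 2 * g y))
        ≡⟨ trans (∬-+ (λ x y → 4 * (q * q) * Δ² x y) (λ x y → 2 * g x + 2 * g y))
             (cong₂ _+_ (∬-* (4 * (q * q)) Δ²)
               (trans (∬-+ (λ x y → 2 * g x) (λ x y → 2 * g y))
                 (cong₂ _+_ (trans (∬-* 2 (λ x y → g x)) (cong (2 *_) (∬-fst g)))
                            (trans (∬-* 2 (λ x y → g y)) (cong (2 *_) (∬-snd g)))))) ⟩
      4 * (q * q) * ∬ Δ² + (2 * F + 2 * F)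
        ≡⟨ lem₂ (q * q) (∬ Δ²) F ⟩
      4 * (q * q * ∬ Δ²) + 4 * F ∎))
      where
      open ≤-Reasoning
      g : Fin N → ℕ
      g x = f x * f x
      F = ∫ g
      D Δ² : Fin N → Fin N → ℕ
      D x y = ∣ g x - g y ∣
      Δ² x y = ∣ f x - f y ∣ * ∣ f x - f y ∣
      bnd = bounded g
      half′ : 2 * ∫ (λ x → ⟦ pos (g x) ⟧) ≤ W
      half′ = subst (λ z → 2 * z ≤ W) (sym (∫-cong λ x → cong ⟦_⟧ (pos-sq (f x)))) half
      lem₁ : ∀ F → 4 * F + 4 * F ≡ 4 * (2 * F)
      lem₁ = solve-∀
      lem₂ : ∀ q E F → 4 * q * E + (2 * F + 2 * F) ≡ 4 * (q * E) + 4 * F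
      lem₂ = solve-∀
      lem₃ : ∀ q d s → 4 * (q * (d * s)) ≡ 2 * (2 * q * d * s)
      lem₃ = solve-∀
      lem₄ : ∀ q d s → 2 * q * d * (2 * q * d) + s ≡ 4 * (q * q) * (d * d) + s
      lem₄ = solve-∀
      lem₅ : ∀ a b → (a + b) * (a + b) ≡ a * a + b * b + 2 * (a * b)
      lem₅ = solve-∀
      lem₆ : ∀ a b → a * a + b * b + (a * a + b * b) ≡ 2 * (a * a) + 2 * (b * b)
      lem₆ = solve-∀
      pw : ∀ x y → 4 * (q * D x y) ≤ 4 * (q * q) * Δ² x y + (2 * g x + 2 * g y)
      pw x y = begin
        4 * (q * D x y)                          ≡⟨ cong (λ z → 4 * (q * z)) (∣a²-b²∣ (f x) (f y)) ⟩
        4 * (q * (d * s))                        ≡⟨ lem₃ q d s ⟩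
        2 * (2 * q * d * s)                      ≤⟨ 2ab≤a²+b² (2 * q * d) s ⟩
        2 * q * d * (2 * q * d) + s * s          ≡⟨ lem₄ q d (s * s) ⟩
        4 * (q * q) * (d * d) + s * s            ≡⟨ cong (4 * (q * q) * (d * d) +_) (lem₅ (f x) (f y)) ⟩
        4 * (q * q) * (d * d) + (g x + g y + 2 * (f x * f y))
          ≤⟨ +-monoʳ-≤ (4 * (q * q) * (d * d)) (+-monoʳ-≤ (g x + g y) (2ab≤a²+b² (f x) (f y))) ⟩
        4 * (q * q) * (d * d) + (g x + g y + (g x + g y))
          ≡⟨ cong (4 * (q * q) * (d * d) +_) (lem₆ (f x) (f y)) ⟩
        4 * (q * q) * Δ² x y + (2 * g x + 2 * g y) ∎
        where
        s = f x + f y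
        d = ∣ f x - f y ∣

    -- Raise t from 0 until the set f > t has at most half of the weight. As long as it has more,
    -- its complement f < t + 1 has less than half, which keeps the lower condition true for the
    -- next t.
    median : ∀ (f : Fin N → ℕ) → ∃[ c ] (2 * ∫ (λ x → ⟦ pos (f x ∸ c) ⟧) ≤ W × 2 * ∫ (λ x → ⟦ pos (c ∸ f x) ⟧) ≤ W)
    median f = search (proj₁ bnd) 0 (λ x → ≤-trans (proj₂ bnd x) (m≤m+n _ 0))
      (none (λ x → 0 ∸ f x) (λ x → 0∸n≡0 (f x)))
      where
      bnd = bounded f
      none : ∀ (g : Fin N → ℕ) → (∀ x → g x ≡ 0) → 2 * ∫ (λ x → ⟦ pos (g x) ⟧) ≤ W
      none g g≡0 = ≤-trans (≤-reflexive (cong (2 *_) (∫-≡0 λ x → cong (⟦_⟧ ∘ pos) (g≡0 x)))) z≤n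
      flip : ∀ a t → ⟦ pos (a ∸ t) ⟧ + ⟦ pos (suc t ∸ a) ⟧ ≡ 1
      flip zero zero = refl
      flip zero (suc t) = refl
      flip (suc a) zero rewrite 0∸n≡0 a = refl
      flip (suc a) (suc t) = flip a t
      other-half : ∀ a b {V} → a + b ≡ V → V < 2 * a → 2 * b ≤ V
      other-half a b refl lt = <⇒≤ (+-cancelˡ-< (2 * a) _ _
        (subst (_< 2 * a + (a + b)) (lem a b) (+-monoˡ-< (a + b) lt)))
        where
        lem : ∀ a b → (a + b) + (a + b) ≡ 2 * a + 2 * b
        lem = solve-∀
      search : ∀ fuel t → (∀ x → f x ≤ fuel + t) → 2 * ∫ (λ x → ⟦ pos (t ∸ f x) ⟧) ≤ W →
        ∃[ c ] (2 * ∫ (λ x → ⟦ pos (f x ∸ c) ⟧) ≤ W × 2 * ∫ (λ x → ⟦ pos (c ∸ f x) ⟧) ≤ W)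
      search zero t f≤ lo = t , none (λ x → f x ∸ t) (λ x → m≤n⇒m∸n≡0 (f≤ x)) , lo
      search (suc fuel) t f≤ lo with 2 * ∫ (λ x → ⟦ pos (f x ∸ t) ⟧) ≤? W
      ... | yes hi = t , hi , lo
      ... | no ¬hi = search fuel (suc t) (λ x → ≤-trans (f≤ x) (≤-reflexive (sym (+-suc fuel t))))
        (other-half (∫ (λ x → ⟦ pos (f x ∸ t) ⟧)) (∫ (λ x → ⟦ pos (suc t ∸ f x) ⟧))
          (trans (sym (∫-+ (λ x → ⟦ pos (f x ∸ t) ⟧) (λ x → ⟦ pos (suc t ∸ f x) ⟧)))
                 (trans (∫-cong λ x → flip (f x) t) ∫-1)) (≰⇒> ¬hi))

    -- The parts of f above and below a median c each live on at most half of the weight, so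
    -- `cheeger-L²` applies to both, and `∸-contract` merges their energies. The bound 2 m (c W) ≤
    -- m² + (c W)² then removes c: it says that the mean square distance to c is at least the
    -- variance.
    poincaré : ∀ (f : Fin N → ℕ) → W * ∫ (λ x → f x * f x) ≤
      ∫ f * ∫ f + W * (q * q * ∬ (λ x y → ∣ f x - f y ∣ * ∣ f x - f y ∣))
    poincaré f = +-cancelʳ-≤ (W * (c * c * W)) _ _ (begin
      W * S + W * (c * c * W)
        ≡⟨ trans (sym (*-distribˡ-+ W S (c * c * W))) (cong (W *_) split) ⟩
      W * (2 * (c * m) + (∫ (sq f⁺) + ∫ (sq f⁻)))
        ≤⟨ *-monoʳ-≤ W (+-monoʳ-≤ (2 * (c * m)) (+-mono-≤ (cheeger-L² f⁺ hi) (cheeger-L² f⁻ lo))) ⟩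
      W * (2 * (c * m) + (q * q * ∬ (Δ² f⁺) + q * q * ∬ (Δ² f⁻)))
        ≡⟨ cong (λ z → W * (2 * (c * m) + z)) (trans (sym (*-distribˡ-+ (q * q) (∬ (Δ² f⁺)) (∬ (Δ² f⁻))))
             (cong (q * q *_) (sym (∬-+ (Δ² f⁺) (Δ² f⁻))))) ⟩
      W * (2 * (c * m) + q * q * ∬ (λ x y → Δ² f⁺ x y + Δ² f⁻ x y))
        ≤⟨ *-monoʳ-≤ W (+-monoʳ-≤ (2 * (c * m)) (*-monoʳ-≤ (q * q) (∬-mono λ x y → ∸-contract (f x) (f y) c))) ⟩
      W * (2 * (c * m) + R)
        ≡⟨ lem₁ W c m R ⟩
      2 * (m * (c * W)) + W * R
        ≤⟨ +-monoˡ-≤ (W * R) (2ab≤a²+b² m (c * W)) ⟩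
      m * m + c * W * (c * W) + W * R
        ≡⟨ lem₂ W c m R ⟩
      m * m + W * R + W * (c * c * W) ∎)
      where
      open ≤-Reasoning
      c = proj₁ (median f)
      hi = proj₁ (proj₂ (median f))
      lo = proj₂ (proj₂ (median f))
      f⁺ f⁻ : Fin N → ℕ
      f⁺ x = f x ∸ c
      f⁻ x = c ∸ f x
      sq : (Fin N → ℕ) → Fin N → ℕ
      sq g x = g x * g x
      Δ² : (Fin N → ℕ) → Fin N → Fin N → ℕ
      Δ² g x y = ∣ g x - g y ∣ * ∣ g x - g y ∣
      m = ∫ f
      S = ∫ (sq f)
      R = q * q * ∬ (Δ² f)
      lem₁ : ∀ W c m R → W * (2 * (c * m) + R) ≡ 2 * (m * (c * W)) + W * R
      lem₁ = solve-∀
      lem₂ : ∀ W c m R → m * m + c * W * (c * W) + W * R ≡ m * m + W * R + W * (c * c * W)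
      lem₂ = solve-∀
      split : S + c * c * W ≡ 2 * (c * m) + (∫ (sq f⁺) + ∫ (sq f⁻))
      split = begin-equality
        S + c * c * W
          ≡⟨ cong (S +_) (trans (cong (c * c *_) (sym ∫-1)) (sym (∫-* (c * c) (λ _ → 1)))) ⟩
        S + ∫ (λ _ → c * c * 1)
          ≡⟨ ∫-+ (sq f) (λ _ → c * c * 1) ⟨
        ∫ (λ x → f x * f x + c * c * 1)
          ≡⟨ ∫-cong (λ x → trans (cong (f x * f x +_) (*-identityʳ (c * c)))
               (trans (sq-∸ (f x) c) (cong (λ z → 2 * z + (sq f⁺ x + sq f⁻ x)) (*-comm (f x) c)))) ⟩
        ∫ (λ x → 2 * (c * f x) + (sq f⁺ x + sq f⁻ x))
          ≡⟨ trans (∫-+ (λ x → 2 * (c * f x)) (λ x → sq f⁺ x + sq f⁻ x))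
               (cong₂ _+_ (trans (∫-* 2 (λ x → c * f x)) (cong (2 *_) (∫-* c f))) (∫-+ (sq f⁺) (sq f⁻))) ⟩
        2 * (c * m) + (∫ (sq f⁺) + ∫ (sq f⁻)) ∎

-- Powers of a transition kernel and first moments of walks

∑-*-*ˡ : ∀ {N K} (v : Fin K → ℕ) (F : Fin K → Fin N → ℕ) (c : Fin N → ℕ) →
  ∑ (λ y → ∑ (λ z → v z * F z y) * c y) ≡ ∑ (λ z → v z * ∑ (λ y → F z y * c y))
∑-*-*ˡ v F c = trans (∑-cong λ y → sym (∑-*ʳ (c y) (λ z → v z * F z y)))
  (trans (∑-swap (λ y z → v z * F z y * c y))
  (∑-cong λ z → trans (∑-cong λ y → *-assoc (v z) (F z y) (c y)) (∑-*ˡ (v z) (λ y → F z y * c y))))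

module Walk {N : ℕ} (κ : Fin N → Fin N → ℕ) where

  step : (Fin N → ℕ) → Fin N → ℕ
  step f x = ∑ λ z → κ x z * f z

  P : ℕ → Fin N → Fin N → ℕ
  P zero    x y = δ x y
  P (suc k) x y = step (λ z → P k z y) x

  P-1 : ∀ x y → P 1 x y ≡ κ x y
  P-1 x y = trans (∑-cong λ z → trans (*-comm (κ x z) (δ z y)) (cong (_* κ x z) (δ-sym z y))) (∑-δ y (κ x))

  P-sucʳ : ∀ k x y → P (suc k) x y ≡ ∑ (λ z → P k x z * κ z y)
  P-sucʳ zero x y = trans (P-1 x y) (sym (∑-δ x (λ z → κ z y)))
  P-sucʳ (suc k) x y = trans (∑-cong λ z → cong (κ x z *_) (P-sucʳ k z y))
    (sym (∑-*-*ˡ (κ x) (P k) (λ z → κ z y)))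

  P-step : ∀ k x (f : Fin N → ℕ) → ∑ (λ y → P (suc k) x y * f y) ≡ ∑ (λ z → κ x z * ∑ (λ y → P k z y * f y))
  P-step k x f = ∑-*-*ˡ (κ x) (P k) f

  -- Reversal turns the first step of a walk into the last one, so the induction peels one side at
  -- the front and the other, by `P-sucʳ`, at the end.
  P-reversible : (π : Fin N → ℕ) → (∀ x z → π x * κ x z ≡ π z * κ z x) →
    ∀ k x y → π x * P k x y ≡ π y * P k y x
  P-reversible π rev zero x y = trans (*-comm (π x) (δ x y)) (trans (sym (δ-subst x y π))
    (trans (*-comm (δ x y) (π y)) (cong (π y *_) (δ-sym x y))))
  P-reversible π rev (suc k) x y = begin
    π x * ∑ (λ z → κ x z * P k z y)   ≡⟨ ∑-*ˡ (π x) (λ z → κ x z * P k z y) ⟨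
    ∑ (λ z → π x * (κ x z * P k z y)) ≡⟨ ∑-cong (λ z → move z) ⟩
    ∑ (λ z → π y * (P k y z * κ z x)) ≡⟨ ∑-*ˡ (π y) (λ z → P k y z * κ z x) ⟩
    π y * ∑ (λ z → P k y z * κ z x)   ≡⟨ cong (π y *_) (P-sucʳ k y x) ⟨
    π y * P (suc k) y x               ∎
    where
    open ≡-Reasoning
    lem : ∀ a b c → a * b * c ≡ b * (a * c)
    lem = solve-∀
    lem′ : ∀ a b c → a * (b * c) ≡ b * (c * a)
    lem′ = solve-∀
    move : ∀ z → π x * (κ x z * P k z y) ≡ π y * (P k y z * κ z x)
    move z = begin
      π x * (κ x z * P k z y)  ≡⟨ *-assoc (π x) (κ x z) (P k z y) ⟨
      π x * κ x z * P k z y    ≡⟨ cong (_* P k z y) (rev x z) ⟩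
      π z * κ z x * P k z y    ≡⟨ lem (π z) (κ z x) (P k z y) ⟩
      κ z x * (π z * P k z y)  ≡⟨ cong (κ z x *_) (P-reversible π rev k z y) ⟩
      κ z x * (π y * P k y z)  ≡⟨ lem′ (κ z x) (π y) (P k y z) ⟩
      π y * (P k y z * κ z x)  ∎

  module _ {M : ℕ} (rowsum : ∀ x → ∑ (κ x) ≤ M) where

    step-≤ : ∀ {f : Fin N → ℕ} {c} → (∀ z → f z ≤ c) → ∀ x → step f x ≤ M * c
    step-≤ {f} {c} f≤ x = ≤-trans (∑-mono λ z → *-monoʳ-≤ (κ x z) (f≤ z))
      (≤-trans (≤-reflexive (∑-*ʳ c (κ x))) (*-monoˡ-≤ c (rowsum x)))

    rowsum-P : ∀ k x → ∑ (P k x) ≤ M ^ k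
    rowsum-P k x = ≤-trans (≤-reflexive (∑-cong λ y → sym (*-identityʳ (P k x y)))) (go k x)
      where
      go : ∀ k x → ∑ (λ y → P k x y * 1) ≤ M ^ k
      go zero x = ≤-reflexive (∑-δ x (λ _ → 1))
      go (suc k) x = ≤-trans (≤-reflexive (P-step k x (λ _ → 1))) (step-≤ (go k) x)

    -- In units of M, one step raises the expected value of `s` by at most b / D, and over k steps
    -- these increments add up. The term `s x` in the hypothesis leaves room for a walk that stays
    -- at x.
    hitting : ∀ D b (s : Fin N → ℕ) → (∀ x → D * step s x ≤ M * (D * s x + b)) →
      ∀ k x → D * ∑ (λ y → P k x y * s y) ≤ M ^ k * (D * s x + k * b)
    hitting D b s h zero x = ≤-trans (≤-reflexive (cong (D *_) (∑-δ x s)))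
      (≤-trans (m≤m+n (D * s x) 0) (m≤m+n _ 0))
    hitting D b s h (suc k) x = begin
      D * ∑ (λ y → P (suc k) x y * s y)
        ≡⟨ cong (D *_) (P-step k x s) ⟩
      D * ∑ (λ z → κ x z * H z)
        ≡⟨ ∑-*ˡ D (λ z → κ x z * H z) ⟨
      ∑ (λ z → D * (κ x z * H z))
        ≤⟨ ∑-mono (λ z → ≤-trans (≤-reflexive (swap* D (κ x z) (H z)))
             (≤-trans (*-monoʳ-≤ (κ x z) (hitting D b s h k z))
               (≤-reflexive (lem₁ (κ x z) (M ^ k) D (s z) (k * b))))) ⟩
      ∑ (λ z → M ^ k * D * (κ x z * s z) + M ^ k * (k * b) * κ x z)
        ≡⟨ trans (∑-+ (λ z → M ^ k * D * (κ x z * s z)) (λ z → M ^ k * (k * b) * κ x z))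
             (cong₂ _+_ (∑-*ˡ (M ^ k * D) (λ z → κ x z * s z)) (∑-*ˡ (M ^ k * (k * b)) (κ x))) ⟩
      M ^ k * D * step s x + M ^ k * (k * b) * ∑ (κ x)
        ≤⟨ +-mono-≤ (≤-trans (≤-reflexive (*-assoc (M ^ k) D (step s x))) (*-monoʳ-≤ (M ^ k) (h x)))
                    (*-monoʳ-≤ (M ^ k * (k * b)) (rowsum x)) ⟩
      M ^ k * (M * (D * s x + b)) + M ^ k * (k * b) * M
        ≡⟨ lem₂ M (M ^ k) (D * s x) b (k * b) ⟩
      M * M ^ k * (D * s x + (b + k * b)) ∎
      where
      open ≤-Reasoning
      H : Fin N → ℕ
      H z = ∑ (λ y → P k z y * s y)
      lem₁ : ∀ κ M D s b → κ * (M * (D * s + b)) ≡ M * D * (κ * s) + M * b * κ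
      lem₁ = solve-∀
      lem₂ : ∀ M K d b k → K * (M * (d + b)) + K * k * M ≡ M * K * (d + (b + k))
      lem₂ = solve-∀

  data IsWalk : Fin N → List (Fin N) → Set where
    []  : ∀ {x} → IsWalk x []
    _∷_ : ∀ {x z zs} → 1 ≤ κ x z → IsWalk z zs → IsWalk x (z ∷ zs)

  -- An unnormalised expectation: walks are weighted by products of `κ`, and the list passed to F
  -- omits the starting point.
  𝔼 : ℕ → Fin N → (List (Fin N) → ℕ) → ℕ
  𝔼 zero    x F = F []
  𝔼 (suc k) x F = ∑ λ z → κ x z * 𝔼 k z (λ zs → F (z ∷ zs))

  𝔼-cong : ∀ k x {F G : List (Fin N) → ℕ} → (∀ zs → F zs ≡ G zs) → 𝔼 k x F ≡ 𝔼 k x G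
  𝔼-cong zero    x e = e []
  𝔼-cong (suc k) x e = ∑-cong λ z → cong (κ x z *_) (𝔼-cong k z λ zs → e (z ∷ zs))

  𝔼-+ : ∀ k x (F G : List (Fin N) → ℕ) → 𝔼 k x (λ zs → F zs + G zs) ≡ 𝔼 k x F + 𝔼 k x G
  𝔼-+ zero    x F G = refl
  𝔼-+ (suc k) x F G = trans
    (∑-cong λ z → trans (cong (κ x z *_) (𝔼-+ k z (λ zs → F (z ∷ zs)) (λ zs → G (z ∷ zs)))) (*-distribˡ-+ (κ x z) _ _))
    (∑-+ (λ z → κ x z * 𝔼 k z (λ zs → F (z ∷ zs))) (λ z → κ x z * 𝔼 k z (λ zs → G (z ∷ zs))))

  𝔼-*ʳ : ∀ k x (F : List (Fin N) → ℕ) c → 𝔼 k x (λ zs → F zs * c) ≡ 𝔼 k x F * c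
  𝔼-*ʳ zero    x F c = refl
  𝔼-*ʳ (suc k) x F c = trans
    (∑-cong λ z → trans (cong (κ x z *_) (𝔼-*ʳ k z (λ zs → F (z ∷ zs)) c)) (sym (*-assoc (κ x z) _ c)))
    (∑-*ʳ c (λ z → κ x z * 𝔼 k z (λ zs → F (z ∷ zs))))

  -- The first moment method one step at a time. Strictness after multiplication by `κ x z` also
  -- forces this weight to be positive, so the list found is a walk that can really occur.
  𝔼-witness : ∀ k x (F G : List (Fin N) → ℕ) → 𝔼 k x F < 𝔼 k x G →
    ∃[ zs ] (length zs ≡ k × IsWalk x zs × F zs < G zs)
  𝔼-witness zero    x F G lt = [] , refl , [] , lt
  𝔼-witness (suc k) x F G lt
    with ∑-witness-< (λ z → κ x z * 𝔼 k z (λ zs → F (z ∷ zs))) (λ z → κ x z * 𝔼 k z (λ zs → G (z ∷ zs))) lt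
  ... | z , lt′ with 𝔼-witness k z (λ zs → F (z ∷ zs)) (λ zs → G (z ∷ zs)) (*-cancelˡ-< (κ x z) _ _ lt′)
  ...   | zs , len , walk , lt″ = z ∷ zs , cong suc len , positive (κ x z) lt′ ∷ walk , lt″
    where
    positive : ∀ c {a b} → c * a < c * b → 1 ≤ c
    positive (suc c) _ = s≤s z≤n

  module _ (t : Fin N) where

    endδ : Fin N → List (Fin N) → ℕ
    endδ x []       = δ x t
    endδ x (z ∷ zs) = endδ z zs

    𝔼-endδ : ∀ k x → 𝔼 k x (endδ x) ≡ P k x t
    𝔼-endδ zero    x = refl
    𝔼-endδ (suc k) x = ∑-cong λ z → cong (κ x z *_) (𝔼-endδ k z)

    visits : (Fin N → ℕ) → List (Fin N) → ℕ
    visits s []       = 0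
    visits s (z ∷ zs) = s z + visits s zs

    𝔼visits : (Fin N → ℕ) → ℕ → Fin N → ℕ
    𝔼visits s k x = 𝔼 k x (λ zs → endδ x zs * visits s zs)

    𝔼visits-suc : ∀ s k x → 𝔼visits s (suc k) x ≡ ∑ (λ z → κ x z * (s z * P k z t)) + ∑ (λ z → κ x z * 𝔼visits s k z)
    𝔼visits-suc s k x = trans (∑-cong λ z → trans (cong (κ x z *_) (row z)) (*-distribˡ-+ (κ x z) _ _))
      (∑-+ (λ z → κ x z * (s z * P k z t)) (λ z → κ x z * 𝔼visits s k z))
      where
      row : ∀ z → 𝔼 k z (λ zs → endδ z zs * (s z + visits s zs)) ≡ s z * P k z t + 𝔼visits s k z
      row z = trans (𝔼-cong k z λ zs → *-distribˡ-+ (endδ z zs) (s z) (visits s zs))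
        (trans (𝔼-+ k z (λ zs → endδ z zs * s z) (λ zs → endδ z zs * visits s zs))
          (cong (_+ 𝔼visits s k z) (trans (𝔼-*ʳ k z (endδ z) (s z)) (trans (cong (_* s z) (𝔼-endδ k z)) (*-comm (P k z t) (s z))))))

    𝔼visits-eq : ∀ s k x → 𝔼visits s k x ≡
      ∑ {k} (λ j → ∑ λ y → P (suc (toℕ j)) x y * (s y * P (k ∸ suc (toℕ j)) y t))
    𝔼visits-eq s zero x = trans (*-zeroʳ (δ x t)) (sym (∑-zero _))
    𝔼visits-eq s (suc k) x = begin
      𝔼visits s (suc k) x
        ≡⟨ 𝔼visits-suc s k x ⟩
      ∑ (λ z → κ x z * (s z * P k z t)) + ∑ (λ z → κ x z * 𝔼visits s k z)
        ≡⟨ cong₂ _+_ (∑-cong λ z → cong (_* (s z * P k z t)) (sym (P-1 x z)))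
             (trans (∑-cong λ z → cong (κ x z *_) (𝔼visits-eq s k z)) (∑-cong λ z → sym (∑-*ˡ (κ x z) (λ j → H j z)))) ⟩
      ∑ (λ z → P 1 x z * (s z * P k z t)) + ∑ (λ z → ∑ λ j → κ x z * H j z)
        ≡⟨ cong (∑ (λ z → P 1 x z * (s z * P k z t)) +_) (∑-swap (λ z j → κ x z * H j z)) ⟩
      ∑ (λ z → P 1 x z * (s z * P k z t)) + ∑ (λ j → ∑ λ z → κ x z * H j z)
        ≡⟨ cong (∑ (λ z → P 1 x z * (s z * P k z t)) +_)
             (∑-cong λ j → P-step (suc (toℕ j)) x (λ y → s y * P (k ∸ suc (toℕ j)) y t)) ⟨
      ∑ (λ z → P 1 x z * (s z * P k z t)) + ∑ {k} (λ j → ∑ λ y → P (suc (suc (toℕ j))) x y * (s y * P (k ∸ suc (toℕ j)) y t))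
        ≡⟨ ∑-suc {k} (λ j → ∑ λ y → P (suc (toℕ j)) x y * (s y * P (suc k ∸ suc (toℕ j)) y t)) ⟨
      ∑ {suc k} (λ j → ∑ λ y → P (suc (toℕ j)) x y * (s y * P (suc k ∸ suc (toℕ j)) y t)) ∎
      where
      open ≡-Reasoning
      H : Fin k → Fin N → ℕ
      H j z = ∑ λ y → P (suc (toℕ j)) z y * (s y * P (k ∸ suc (toℕ j)) y t)

    -- Pairs of times are counted with the start included, whereas `visits` leaves the start out.
    conflicts : (Fin N → Fin N → ℕ) → Fin N → List (Fin N) → ℕ
    conflicts c x []       = 0
    conflicts c x (z ∷ zs) = visits (c x) (z ∷ zs) + conflicts c z zs

    𝔼conflicts : (Fin N → Fin N → ℕ) → ℕ → Fin N → ℕ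
    𝔼conflicts c k x = 𝔼 k x (λ zs → endδ x zs * conflicts c x zs)

    𝔼conflicts-eq : ∀ c k x → 𝔼conflicts c k x ≡
      ∑ {k} (λ i → ∑ λ y → P (toℕ i) x y * 𝔼visits (c y) (k ∸ toℕ i) y)
    𝔼conflicts-eq c zero x = trans (*-zeroʳ (δ x t)) (sym (∑-zero _))
    𝔼conflicts-eq c (suc k) x = begin
      𝔼conflicts c (suc k) x
        ≡⟨ trans (𝔼-cong (suc k) x split) (𝔼-+ (suc k) x (λ zs → endδ x zs * visits (c x) zs) rest) ⟩
      𝔼visits (c x) (suc k) x + ∑ (λ z → κ x z * 𝔼conflicts c k z)
        ≡⟨ cong₂ _+_ (sym (∑-δ x (λ y → 𝔼visits (c y) (suc k) y)))
             (trans (∑-cong λ z → cong (κ x z *_) (𝔼conflicts-eq c k z)) (∑-cong λ z → sym (∑-*ˡ (κ x z) (λ i → H i z)))) ⟩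
      ∑ (λ y → δ x y * 𝔼visits (c y) (suc k) y) + ∑ (λ z → ∑ λ i → κ x z * H i z)
        ≡⟨ cong (∑ (λ y → δ x y * 𝔼visits (c y) (suc k) y) +_) (trans (∑-swap (λ z i → κ x z * H i z))
             (∑-cong λ i → sym (P-step (toℕ i) x (λ y → 𝔼visits (c y) (k ∸ toℕ i) y)))) ⟩
      ∑ (λ y → δ x y * 𝔼visits (c y) (suc k) y) + ∑ {k} (λ i → ∑ λ y → P (suc (toℕ i)) x y * 𝔼visits (c y) (k ∸ toℕ i) y)
        ≡⟨ ∑-suc {k} (λ i → ∑ λ y → P (toℕ i) x y * 𝔼visits (c y) (suc k ∸ toℕ i) y) ⟨
      ∑ {suc k} (λ i → ∑ λ y → P (toℕ i) x y * 𝔼visits (c y) (suc k ∸ toℕ i) y) ∎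
      where
      open ≡-Reasoning
      H : Fin k → Fin N → ℕ
      H i z = ∑ λ y → P (toℕ i) z y * 𝔼visits (c y) (k ∸ toℕ i) y
      rest : List (Fin N) → ℕ
      rest []       = 0
      rest (z ∷ zs) = endδ z zs * conflicts c z zs
      split : ∀ zs → endδ x zs * conflicts c x zs ≡ endδ x zs * visits (c x) zs + rest zs
      split []       = trans (*-zeroʳ (δ x t)) (trans (sym (*-zeroʳ (δ x t))) (sym (+-identityʳ _)))
      split (z ∷ zs) = *-distribˡ-+ (endδ z zs) _ _

    -- The walks that end in t have total weight `P k x t`. Where the first moment falls short, a
    -- natural number e exceeds e * m, which leaves only m = 0 and e nonzero: the walk ends in t and
    -- nothing bad happens on it.
    clean-walk : ∀ s c k x → 𝔼visits s k x + 𝔼conflicts c k x < P k x t →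
      ∃[ zs ] (length zs ≡ k × IsWalk x zs × endδ x zs ≢ 0 × visits s zs ≡ 0 × conflicts c x zs ≡ 0)
    clean-walk s c k x lt
      with 𝔼-witness k x (λ zs → endδ x zs * (visits s zs + conflicts c x zs)) (endδ x)
        (subst₂ _<_ (trans (sym (𝔼-+ k x (λ zs → endδ x zs * visits s zs) (λ zs → endδ x zs * conflicts c x zs)))
            (𝔼-cong k x λ zs → sym (*-distribˡ-+ (endδ x zs) (visits s zs) (conflicts c x zs)))) (sym (𝔼-endδ k x)) lt)
    ... | zs , len , walk , lt′ = zs , len , walk , nonzero lt′ ,
          m+n≡0⇒m≡0 (visits s zs) (clean (endδ x zs) _ lt′) , m+n≡0⇒n≡0 (visits s zs) (clean (endδ x zs) _ lt′)
      where
      nonzero : ∀ {a b} → a < b → b ≢ 0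
      nonzero (s≤s _) ()
      clean : ∀ e m → e * m < e → m ≡ 0
      clean e zero    _  = refl
      clean e (suc m) lt = ⊥-elim (<-irrefl refl (<-≤-trans lt (m≤m*n e (suc m))))

-- Mixing of the lazy random walk

∑-cauchy-schwarz : ∀ {N} (v s : Fin N → ℕ) →
  ∑ (λ i → v i * s i) * ∑ (λ i → v i * s i) ≤ ∑ v * ∑ (λ i → v i * (s i * s i))
∑-cauchy-schwarz v s = *-cancelˡ-≤ {_} {_} 2 (begin
  2 * (∑ vs * ∑ vs)
    ≡⟨ cong (2 *_) (product vs vs) ⟩
  2 * ∑ (λ i → ∑ λ j → vs i * vs j)
    ≡⟨ trans (∑-cong λ i → ∑-*ˡ 2 (λ j → vs i * vs j)) (∑-*ˡ 2 (λ i → ∑ λ j → vs i * vs j)) ⟨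
  ∑ (λ i → ∑ λ j → 2 * (vs i * vs j))
    ≤⟨ ∑-mono (λ i → ∑-mono λ j → pw i j) ⟩
  ∑ (λ i → ∑ λ j → vss i * v j + v i * vss j)
    ≡⟨ trans (∑-cong λ i → ∑-+ (λ j → vss i * v j) (λ j → v i * vss j))
         (∑-+ (λ i → ∑ λ j → vss i * v j) (λ i → ∑ λ j → v i * vss j)) ⟩
  ∑ (λ i → ∑ λ j → vss i * v j) + ∑ (λ i → ∑ λ j → v i * vss j)
    ≡⟨ cong₂ _+_ (product vss v) (product v vss) ⟨
  ∑ vss * ∑ v + ∑ v * ∑ vss
    ≡⟨ lem (∑ v) (∑ vss) ⟩
  2 * (∑ v * ∑ vss) ∎)
  where
  open ≤-Reasoning
  vs vss : Fin _ → ℕ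
  vs i = v i * s i
  vss i = v i * (s i * s i)
  product : ∀ {N} (f g : Fin N → ℕ) → ∑ f * ∑ g ≡ ∑ (λ i → ∑ λ j → f i * g j)
  product f g = trans (sym (∑-*ʳ (∑ g) f)) (∑-cong λ i → sym (∑-*ˡ (f i) g))
  lem : ∀ a b → b * a + a * b ≡ 2 * (a * b)
  lem = solve-∀
  lem₁ : ∀ a b s t → 2 * (a * s * (b * t)) ≡ a * b * (2 * (s * t))
  lem₁ = solve-∀
  lem₂ : ∀ a b s t → a * b * (s * s + t * t) ≡ a * (s * s) * b + a * (b * (t * t))
  lem₂ = solve-∀
  pw : ∀ i j → 2 * (vs i * vs j) ≤ vss i * v j + v i * vss j
  pw i j = ≤-trans (≤-reflexive (lem₁ (v i) (v j) (s i) (s j)))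
    (≤-trans (*-monoʳ-≤ (v i * v j) (2ab≤a²+b² (s i) (s j))) (≤-reflexive (lem₂ (v i) (v j) (s i) (s j))))

m*m≤n*n⇒m≤n : ∀ m n → m * m ≤ n * n → m ≤ n
m*m≤n*n⇒m≤n m n le with m ≤? n
... | yes p = p
... | no ¬p = ⊥-elim (<-irrefl refl (<-≤-trans (*-mono-< (≰⇒> ¬p) (≰⇒> ¬p)) le))

-- M is a common multiple of the positive numbers 2 π x, which makes all transition weights natural
-- numbers. The second alternative of `balanced` admits points of weight zero, such as the tuples
-- outside the expanding set.
module LazyWalk {N : ℕ} (w : Fin N → Fin N → ℕ) (w-sym : ∀ x y → w x y ≡ w y x)
                (a : Fin N → ℕ) (M : ℕ)
                (balanced : ∀ x → 2 * (a x * Weighted.π w w-sym x) ≡ M ⊎ Weighted.π w w-sym x ≡ 0) where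

  open Weighted w w-sym

  -- M times the transition probabilities of the lazy walk; a x stands for M / (2 π x).
  κ : Fin N → Fin N → ℕ
  κ x z = a x * (w x z + δ x z * π x)

  open Walk κ public

  w≡0 : ∀ {x} → π x ≡ 0 → ∀ z → w x z ≡ 0
  w≡0 {x} π≡0 z = n≤0⇒n≡0 (≤-trans (term≤∑ (w x) z) (≤-reflexive π≡0))

  2πκ : ∀ x z → 2 * (π x * κ x z) ≡ M * (w x z + δ x z * π x)
  2πκ x z with balanced x
  ... | inj₁ e = trans (lem (π x) (a x) (w x z + δ x z * π x)) (cong (_* (w x z + δ x z * π x)) e)
    where
    lem : ∀ p a s → 2 * (p * (a * s)) ≡ 2 * (a * p) * s
    lem = solve-∀
  ... | inj₂ e rewrite e | w≡0 e z | *-zeroʳ (δ x z) = sym (*-zeroʳ M)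

  step-eq : ∀ f x → step f x ≡ a x * ∑ (λ z → w x z * (f x + f z))
  step-eq f x = begin
    ∑ (λ z → κ x z * f z)
      ≡⟨ ∑-cong (λ z → lem₁ (a x) (w x z) (δ x z) (π x) (f z)) ⟩
    ∑ (λ z → a x * (w x z * f z + δ x z * (π x * f z)))
      ≡⟨ trans (∑-*ˡ (a x) _) (cong (a x *_) (∑-+ (λ z → w x z * f z) (λ z → δ x z * (π x * f z)))) ⟩
    a x * (∑ (λ z → w x z * f z) + ∑ (λ z → δ x z * (π x * f z)))
      ≡⟨ cong (λ s → a x * (∑ (λ z → w x z * f z) + s)) (trans (∑-δ x (λ z → π x * f z)) (sym (∑-*ʳ (f x) (w x)))) ⟩
    a x * (∑ (λ z → w x z * f z) + ∑ (λ z → w x z * f x))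
      ≡⟨ cong (a x *_) (trans (∑-cong λ z → lem₂ (w x z) (f x) (f z)) (∑-+ (λ z → w x z * f z) (λ z → w x z * f x))) ⟨
    a x * ∑ (λ z → w x z * (f x + f z)) ∎
    where
    open ≡-Reasoning
    lem₁ : ∀ a w d p f → a * (w + d * p) * f ≡ a * (w * f + d * (p * f))
    lem₁ = solve-∀
    lem₂ : ∀ w x z → w * (x + z) ≡ w * z + w * x
    lem₂ = solve-∀

  rowsum-κ : ∀ x → ∑ (κ x) ≤ M
  rowsum-κ x = ≤-trans (≤-reflexive eq) bound
    where
    lem : ∀ a p → a * (p + p) ≡ 2 * (a * p)
    lem = solve-∀
    eq : ∑ (κ x) ≡ 2 * (a x * π x)
    eq = trans (trans (∑-*ˡ (a x) (λ z → w x z + δ x z * π x)) (cong (a x *_)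
           (trans (∑-+ (w x) (λ z → δ x z * π x)) (cong (π x +_) (∑-δ x (λ _ → π x)))))) (lem (a x) (π x))
    bound : 2 * (a x * π x) ≤ M
    bound with balanced x
    ... | inj₁ e = ≤-reflexive e
    ... | inj₂ e rewrite e | *-zeroʳ (a x) = z≤n

  ∫-step : ∀ f → ∫ (step f) ≡ M * ∫ f
  ∫-step f = *-cancelˡ-≡ _ _ 2 (begin
    2 * ∫ (step f)
      ≡⟨ cong (2 *_) (∫-def (step f)) ⟩
    2 * ∑ (λ x → π x * step f x)
      ≡⟨ ∑-*ˡ 2 (λ x → π x * step f x) ⟨
    ∑ (λ x → 2 * (π x * step f x))
      ≡⟨ ∑-cong row ⟩
    ∑ (λ x → M * (∑ (λ z → w x z * f z) + π x * f x))
      ≡⟨ trans (∑-*ˡ M _) (cong (M *_) (∑-+ (λ x → ∑ (λ z → w x z * f z)) (λ x → π x * f x))) ⟩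
    M * (∑ (λ x → ∑ (λ z → w x z * f z)) + ∑ (λ x → π x * f x))
      ≡⟨ cong (M *_) (cong₂ _+_ (trans (sym (∬-def (λ x z → f z))) (∬-snd f)) (sym (∫-def f))) ⟩
    M * (∫ f + ∫ f)
      ≡⟨ lem M (∫ f) ⟩
    2 * (M * ∫ f) ∎)
    where
    open ≡-Reasoning
    lem : ∀ M s → M * (s + s) ≡ 2 * (M * s)
    lem = solve-∀
    lem₁ : ∀ p k f → 2 * (p * (k * f)) ≡ 2 * (p * k) * f
    lem₁ = solve-∀
    lem₂ : ∀ M w d p f → M * (w + d * p) * f ≡ M * (w * f + d * (p * f))
    lem₂ = solve-∀
    row : ∀ x → 2 * (π x * step f x) ≡ M * (∑ (λ z → w x z * f z) + π x * f x)
    row x = begin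
      2 * (π x * step f x)
        ≡⟨ trans (∑-*ˡ 2 _) (cong (2 *_) (∑-*ˡ (π x) (λ z → κ x z * f z))) ⟨
      ∑ (λ z → 2 * (π x * (κ x z * f z)))
        ≡⟨ ∑-cong (λ z → trans (lem₁ (π x) (κ x z) (f z)) (trans (cong (_* f z) (2πκ x z)) (lem₂ M (w x z) (δ x z) (π x) (f z)))) ⟩
      ∑ (λ z → M * (w x z * f z + δ x z * (π x * f z)))
        ≡⟨ trans (∑-*ˡ M _) (cong (M *_) (∑-+ (λ z → w x z * f z) (λ z → δ x z * (π x * f z)))) ⟩
      M * (∑ (λ z → w x z * f z) + ∑ (λ z → δ x z * (π x * f z)))
        ≡⟨ cong (λ s → M * (∑ (λ z → w x z * f z) + s)) (∑-δ x (λ z → π x * f z)) ⟩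
      M * (∑ (λ z → w x z * f z) + π x * f x) ∎

  -- A lazy step averages the sums f x + f z (`step-eq`). Cauchy-Schwarz bounds its square by the
  -- average of their squares, and the parallelogram identity converts these into the norm of f
  -- minus its Dirichlet energy. This is the use of laziness: it keeps eigenvalues away from -1.
  energy : ∀ (f : Fin N → ℕ) →
    4 * ∫ (λ x → step f x * step f x) + M * M * ∬ (λ x y → ∣ f x - f y ∣ * ∣ f x - f y ∣)
      ≤ 4 * (M * M * ∫ (λ x → f x * f x))
  energy f = begin
    4 * ∫ (λ x → step f x * step f x) + M * M * ∬ Δ²
      ≡⟨ cong (_+ M * M * ∬ Δ²) (trans (cong (4 *_) (∫-def _)) (sym (∑-*ˡ 4 _))) ⟩
    ∑ (λ x → 4 * (π x * (step f x * step f x))) + M * M * ∬ Δ²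
      ≤⟨ +-monoˡ-≤ (M * M * ∬ Δ²) (∑-mono row) ⟩
    ∑ (λ x → M * M * ∑ (λ z → w x z * s² x z)) + M * M * ∬ Δ²
      ≡⟨ cong (_+ M * M * ∬ Δ²) (trans (∑-*ˡ (M * M) _) (cong (M * M *_) (sym (∬-def s²)))) ⟩
    M * M * ∬ s² + M * M * ∬ Δ²
      ≡⟨ trans (sym (*-distribˡ-+ (M * M) (∬ s²) (∬ Δ²))) (cong (M * M *_) (sym (∬-+ s² Δ²))) ⟩
    M * M * ∬ (λ x y → s² x y + Δ² x y)
      ≡⟨ cong (M * M *_) (∬-cong λ x y → parallelogram (f x) (f y)) ⟩
    M * M * ∬ (λ x y → 2 * f² x + 2 * f² y)
      ≡⟨ cong (M * M *_) (trans (∬-+ (λ x y → 2 * f² x) (λ x y → 2 * f² y))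
           (cong₂ _+_ (trans (∬-* 2 (λ x y → f² x)) (cong (2 *_) (∬-fst f²)))
                      (trans (∬-* 2 (λ x y → f² y)) (cong (2 *_) (∬-snd f²))))) ⟩
    M * M * (2 * ∫ f² + 2 * ∫ f²)
      ≡⟨ lem (M * M) (∫ f²) ⟩
    4 * (M * M * ∫ f²) ∎
    where
    open ≤-Reasoning
    f² : Fin N → ℕ
    f² x = f x * f x
    s² Δ² : Fin N → Fin N → ℕ
    s² x y = (f x + f y) * (f x + f y)
    Δ² x y = ∣ f x - f y ∣ * ∣ f x - f y ∣
    lem : ∀ M s → M * (2 * s + 2 * s) ≡ 4 * (M * s)
    lem = solve-∀
    par₁ : ∀ x y d → (x + y) * (x + y) + d ≡ x * x + y * y + (d + 2 * (x * y))
    par₁ = solve-∀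
    par₂ : ∀ x y → x * x + y * y + (x * x + y * y) ≡ 2 * (x * x) + 2 * (y * y)
    par₂ = solve-∀
    parallelogram : ∀ x y → (x + y) * (x + y) + ∣ x - y ∣ * ∣ x - y ∣ ≡ 2 * (x * x) + 2 * (y * y)
    parallelogram x y = trans (par₁ x y _) (trans (cong (x * x + y * y +_) (∣-∣-sq x y)) (par₂ x y))
    lem₁ : ∀ p a t → 4 * (p * (a * t * (a * t))) ≡ 4 * (p * (a * a)) * (t * t)
    lem₁ = solve-∀
    lem₂ : ∀ p a s → 4 * (p * (a * a)) * (p * s) ≡ 2 * (a * p) * (2 * (a * p)) * s
    lem₂ = solve-∀
    row : ∀ x → 4 * (π x * (step f x * step f x)) ≤ M * M * ∑ (λ z → w x z * s² x z)
    row x with balanced x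
    ... | inj₂ e rewrite e = z≤n
    ... | inj₁ e = begin
      4 * (π x * (step f x * step f x))
        ≡⟨ cong (λ z → 4 * (π x * (z * z))) (step-eq f x) ⟩
      4 * (π x * (a x * T * (a x * T)))
        ≡⟨ lem₁ (π x) (a x) T ⟩
      4 * (π x * (a x * a x)) * (T * T)
        ≤⟨ *-monoʳ-≤ (4 * (π x * (a x * a x))) (∑-cauchy-schwarz (w x) (λ z → f x + f z)) ⟩
      4 * (π x * (a x * a x)) * (π x * ∑ (λ z → w x z * s² x z))
        ≡⟨ lem₂ (π x) (a x) _ ⟩
      2 * (a x * π x) * (2 * (a x * π x)) * ∑ (λ z → w x z * s² x z)
        ≡⟨ cong (λ m → m * m * ∑ (λ z → w x z * s² x z)) e ⟩
      M * M * ∑ (λ z → w x z * s² x z) ∎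
      where T = ∑ (λ z → w x z * (f x + f z))

  ∫-P : ∀ k y → ∫ (λ x → P k x y) ≡ M ^ k * π y
  ∫-P zero y = trans (∫-def _) (trans (∑-cong λ x → trans (cong (π x *_) (δ-sym x y)) (*-comm (π x) (δ y x)))
    (trans (∑-δ y π) (sym (+-identityʳ (π y)))))
  ∫-P (suc k) y = trans (∫-step (λ x → P k x y)) (trans (cong (M *_) (∫-P k y)) (sym (*-assoc M (M ^ k) (π y))))

  reversible : ∀ x z → π x * κ x z ≡ π z * κ z x
  reversible x z = *-cancelˡ-≡ _ _ 2 (trans (2πκ x z) (trans (cong (M *_)
    (cong₂ _+_ (w-sym x z) (trans (cong (_* π x) (δ-sym x z)) (δ-subst z x π)))) (sym (2πκ z x))))

  module _ {q g : ℕ} (exp : Expanding q) (g-def : 4 * (q * q) ≡ suc g) where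

    -- As ∫ (step f) = M ∫ f, this says that the variance W ∫ f² - (∫ f)², relative to M², shrinks
    -- by the factor g / (g + 1) = 1 - 1 / (4 q²): the energy lost in `energy` is bounded below by
    -- `poincaré`.
    contraction : ∀ (f : Fin N → ℕ) →
      suc g * (W * ∫ (λ x → step f x * step f x)) ≤ g * (M * M * (W * ∫ (λ x → f x * f x))) + M * M * (∫ f * ∫ f)
    contraction f = +-cancelʳ-≤ (M * M * A + M * M * (W * R)) _ _ (begin
      suc g * (W * S′) + (M * M * A + M * M * (W * R))
        ≡⟨ cong (λ z → z * (W * S′) + (M * M * A + M * M * (W * R))) (sym g-def) ⟩
      4 * (q * q) * (W * S′) + (M * M * A + M * M * (W * R))
        ≡⟨ lem₁ (q * q) W S′ (M * M) A E ⟩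
      W * (q * q) * (4 * S′ + M * M * E) + M * M * A
        ≤⟨ +-mono-≤ (*-monoʳ-≤ (W * (q * q)) (energy f)) (*-monoʳ-≤ (M * M) (poincaré {q} exp f)) ⟩
      W * (q * q) * (4 * (M * M * S)) + M * M * (m * m + W * R)
        ≡⟨ lem₂ (q * q) W S (M * M) (m * m) (W * R) ⟩
      4 * (q * q) * (M * M * A) + M * M * (m * m) + M * M * (W * R)
        ≡⟨ cong (λ z → z * (M * M * A) + M * M * (m * m) + M * M * (W * R)) g-def ⟩
      suc g * (M * M * A) + M * M * (m * m) + M * M * (W * R)
        ≡⟨ lem₃ g (M * M * A) (M * M * (m * m)) (M * M * (W * R)) ⟩
      g * (M * M * A) + M * M * (m * m) + (M * M * A + M * M * (W * R)) ∎)
      where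
      open ≤-Reasoning
      S = ∫ (λ x → f x * f x)
      S′ = ∫ (λ x → step f x * step f x)
      A = W * S
      m = ∫ f
      E = ∬ (λ x y → ∣ f x - f y ∣ * ∣ f x - f y ∣)
      R = q * q * E
      lem₁ : ∀ q W S M A E → 4 * q * (W * S) + (M * A + M * (W * (q * E))) ≡ W * q * (4 * S + M * E) + M * A
      lem₁ = solve-∀
      lem₂ : ∀ q W S M m r → W * q * (4 * (M * S)) + M * (m + r) ≡ 4 * q * (M * (W * S)) + M * m + M * r
      lem₂ = solve-∀
      lem₃ : ∀ g a b c → (1 + g) * a + b + c ≡ g * a + b + (a + c)
      lem₃ = solve-∀

    -- `contraction` is iterated on the columns of `P`, starting from the point mass at y, whose
    -- second moment is `π y`.
    decay : ∀ k y → suc g ^ k * (W * ∫ (λ x → P k x y * P k x y))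
      ≤ suc g ^ k * (M ^ k * π y * (M ^ k * π y)) + M ^ k * M ^ k * (g ^ k * (W * π y))
    decay zero y = ≤-trans (≤-reflexive (cong (λ z → 1 * (W * z)) eq)) (≤-trans (≤-reflexive lem)
      (m≤n+m (1 * 1 * (1 * (W * π y))) (suc g ^ 0 * (M ^ 0 * π y * (M ^ 0 * π y)))))
      where
      δ²≡δ : ∀ b → ⟦ b ⟧ * ⟦ b ⟧ ≡ ⟦ b ⟧
      δ²≡δ true = refl
      δ²≡δ false = refl
      eq : ∫ (λ x → δ x y * δ x y) ≡ π y
      eq = trans (∫-cong λ x → δ²≡δ _) (trans (∫-P 0 y) (+-identityʳ (π y)))
      lem : 1 * (W * π y) ≡ 1 * 1 * (1 * (W * π y))
      lem = cong (λ z → z + 0) (sym (+-identityʳ (W * π y)))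
    decay (suc k) y = begin
      suc g * G * A′
        ≡⟨ lem₁ (suc g) G A′ ⟩
      G * (suc g * A′)
        ≤⟨ *-monoʳ-≤ G (contraction (λ x → P k x y)) ⟩
      G * (g * (M * M * A) + M * M * (∫ f * ∫ f))
        ≡⟨ cong (λ z → G * (g * (M * M * A) + M * M * (z * z))) (∫-P k y) ⟩
      G * (g * (M * M * A) + M * M * (m * m))
        ≡⟨ lem₂ G g (M * M) A (m * m) ⟩
      g * (M * M) * (G * A) + G * (M * M) * (m * m)
        ≤⟨ +-monoˡ-≤ (G * (M * M) * (m * m)) (*-monoʳ-≤ (g * (M * M)) (decay k y)) ⟩
      g * (M * M) * (G * (m * m) + M ^ k * M ^ k * (g ^ k * (W * π y))) + G * (M * M) * (m * m)
        ≡⟨ lem₃ G g M (M ^ k) (π y) (g ^ k) (W * π y) ⟩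
      suc g * G * (M * M ^ k * π y * (M * M ^ k * π y)) + M * M ^ k * (M * M ^ k) * (g * g ^ k * (W * π y)) ∎
      where
      open ≤-Reasoning
      f : Fin N → ℕ
      f x = P k x y
      G = suc g ^ k
      A = W * ∫ (λ x → P k x y * P k x y)
      A′ = W * ∫ (λ x → P (suc k) x y * P (suc k) x y)
      m = M ^ k * π y
      lem₁ : ∀ g G A → g * G * A ≡ G * (g * A)
      lem₁ = solve-∀
      lem₂ : ∀ G g M A m → G * (g * (M * A) + M * m) ≡ g * M * (G * A) + G * M * m
      lem₂ = solve-∀
      lem₃ : ∀ G g M k p h v → g * (M * M) * (G * (k * p * (k * p)) + k * k * (h * v)) + G * (M * M) * (k * p * (k * p))
        ≡ (1 + g) * G * (M * k * p * (M * k * p)) + M * k * (M * k) * (g * h * v)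
      lem₃ = solve-∀

    -- A single term is at most the whole sum, and the sum of the squared deviations of W f from m =
    -- ∫ f is W (W ∫ f² - m²).
    deviation : ∀ (f : Fin N → ℕ) x →
      π x * (∣ W * f x - ∫ f ∣ * ∣ W * f x - ∫ f ∣) + W * (∫ f * ∫ f) ≤ W * (W * ∫ (λ x → f x * f x))
    deviation f x = +-cancelʳ-≤ (W * (m * m)) _ _ (begin
      π x * d² x + W * (m * m) + W * (m * m)
        ≡⟨ lem₁ (π x * d² x) W m ⟩
      π x * d² x + 2 * (W * m) * m
        ≤⟨ +-monoˡ-≤ _ (≤-trans (term≤∑ (λ y → π y * d² y) x) (≤-reflexive (sym (∫-def d²)))) ⟩
      ∫ d² + 2 * (W * m) * m
        ≡⟨ cong (∫ d² +_) (∫-* (2 * (W * m)) f) ⟨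
      ∫ d² + ∫ (λ y → 2 * (W * m) * f y)
        ≡⟨ ∫-+ d² (λ y → 2 * (W * m) * f y) ⟨
      ∫ (λ y → d² y + 2 * (W * m) * f y)
        ≡⟨ ∫-cong (λ y → trans (cong (d² y +_) (lem₂ W m (f y))) (trans (∣-∣-sq (W * f y) m) (lem₃ W (f y) (m * m)))) ⟩
      ∫ (λ y → W * W * (f y * f y) + m * m * 1)
        ≡⟨ trans (∫-+ (λ y → W * W * (f y * f y)) (λ _ → m * m * 1))
             (cong₂ _+_ (∫-* (W * W) (λ y → f y * f y)) (trans (∫-* (m * m) (λ _ → 1)) (cong (m * m *_) ∫-1))) ⟩
      W * W * ∫ (λ y → f y * f y) + m * m * W
        ≡⟨ cong₂ _+_ (*-assoc W W _) (*-comm (m * m) W) ⟩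
      W * (W * ∫ (λ y → f y * f y)) + W * (m * m) ∎)
      where
      open ≤-Reasoning
      m = ∫ f
      d² : Fin N → ℕ
      d² y = ∣ W * f y - m ∣ * ∣ W * f y - m ∣
      lem₁ : ∀ d W m → d + W * (m * m) + W * (m * m) ≡ d + 2 * (W * m) * m
      lem₁ = solve-∀
      lem₂ : ∀ W m f → 2 * (W * m) * f ≡ 2 * (W * f * m)
      lem₂ = solve-∀
      lem₃ : ∀ W f m → W * f * (W * f) + m ≡ W * W * (f * f) + m * 1
      lem₃ = solve-∀

    module Mixing (k : ℕ) (fast : g ^ k * (4 * (W * W)) ≤ suc g ^ k) where

      variance : ∀ y → 4 * (W * W) * (W * ∫ (λ x → P k x y * P k x y))
        ≤ 4 * (W * W) * (M ^ k * π y * (M ^ k * π y)) + M ^ k * M ^ k * (W * π y)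
      variance y = *-cancelˡ-≤ (suc g ^ k) {{m^n≢0 (suc g) k}} (begin
        G * (V * A)                               ≡⟨ swap* G V A ⟩
        V * (G * A)                               ≤⟨ *-monoʳ-≤ V (decay k y) ⟩
        V * (G * m² + Mk² * (g ^ k * (W * π y)))  ≡⟨ lem₁ V G m² Mk² (g ^ k) (W * π y) ⟩
        G * (V * m²) + Mk² * (W * π y) * (g ^ k * V)
          ≤⟨ +-monoʳ-≤ (G * (V * m²)) (*-monoʳ-≤ (Mk² * (W * π y)) fast) ⟩
        G * (V * m²) + Mk² * (W * π y) * G        ≡⟨ lem₂ G (V * m²) (Mk² * (W * π y)) ⟩
        G * (V * m² + Mk² * (W * π y))            ∎)
        where
        open ≤-Reasoning
        G = suc g ^ k
        V = 4 * (W * W)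
        A = W * ∫ (λ x → P k x y * P k x y)
        m² = M ^ k * π y * (M ^ k * π y)
        Mk² = M ^ k * M ^ k
        lem₁ : ∀ V G m K g p → V * (G * m + K * (g * p)) ≡ G * (V * m) + K * p * (g * V)
        lem₁ = solve-∀
        lem₂ : ∀ G a b → G * a + b * G ≡ G * (a + b)
        lem₂ = solve-∀

      -- The factor 4 W² in `fast` is chosen to turn the variance into a pointwise bound with
      -- relative error 1/2. Weights are integers, so `π x` and `π y` are at least 1, and 4 π x d² ≤
      -- M^(2k) π y yields (2 d)² ≤ (M^k π y)².
      close : ∀ x y → 1 ≤ π x → 1 ≤ π y → 2 * ∣ W * P k x y - M ^ k * π y ∣ ≤ M ^ k * π y
      close x y 1≤πx 1≤πy = m*m≤n*n⇒m≤n _ _ (≤-trans (≤-reflexive (lem₀ d)) (begin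
        4 * (d * d)                 ≤⟨ m≤n*m (4 * (d * d)) (π x) {{>-nonZero 1≤πx}} ⟩
        π x * (4 * (d * d))         ≤⟨ *-cancelˡ-≤ (W * W) {{>-nonZero (*-mono-≤ 1≤W 1≤W)}} main ⟩
        Mk² * π y                   ≤⟨ *-monoʳ-≤ Mk² (m*m≥m (π y)) ⟩
        Mk² * (π y * π y)           ≡⟨ lem₃ (M ^ k) (π y) ⟩
        m * m ∎))
        where
        open ≤-Reasoning
        m = M ^ k * π y
        d = ∣ W * P k x y - m ∣
        Mk² = M ^ k * M ^ k
        f : Fin N → ℕ
        f x = P k x y
        1≤W : 1 ≤ W
        1≤W = ≤-trans 1≤πx (term≤∑ π x)
        lem₀ : ∀ d → 2 * d * (2 * d) ≡ 4 * (d * d)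
        lem₀ = solve-∀
        lem₁ : ∀ W p d m → W * W * (p * (4 * d)) + 4 * (W * W) * (W * m) ≡ 4 * (W * W) * (p * d + W * m)
        lem₁ = solve-∀
        lem₂ : ∀ W A m K p → W * (4 * (W * W) * m + K * (W * p)) ≡ W * W * (K * p) + 4 * (W * W) * (W * m)
        lem₂ = solve-∀
        lem₃ : ∀ k p → k * k * (p * p) ≡ k * p * (k * p)
        lem₃ = solve-∀
        lem₄ : ∀ W V A → V * (W * A) ≡ W * (V * A)
        lem₄ = solve-∀
        dev : π x * (d * d) + W * (m * m) ≤ W * (W * ∫ (λ x → f x * f x))
        dev = subst (λ m → π x * (∣ W * f x - m ∣ * ∣ W * f x - m ∣) + W * (m * m) ≤ W * (W * ∫ (λ x → f x * f x)))
                (∫-P k y) (deviation f x)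
        main : W * W * (π x * (4 * (d * d))) ≤ W * W * (Mk² * π y)
        main = +-cancelʳ-≤ (4 * (W * W) * (W * (m * m))) _ _ (begin
          W * W * (π x * (4 * (d * d))) + 4 * (W * W) * (W * (m * m))
            ≡⟨ lem₁ W (π x) (d * d) (m * m) ⟩
          4 * (W * W) * (π x * (d * d) + W * (m * m))
            ≤⟨ *-monoʳ-≤ (4 * (W * W)) dev ⟩
          4 * (W * W) * (W * (W * ∫ (λ x → f x * f x)))
            ≡⟨ lem₄ W (4 * (W * W)) _ ⟩
          W * (4 * (W * W) * (W * ∫ (λ x → f x * f x)))
            ≤⟨ *-monoʳ-≤ W (variance y) ⟩
          W * (4 * (W * W) * (m * m) + Mk² * (W * π y))
            ≡⟨ lem₂ W 0 (m * m) Mk² (π y) ⟩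
          W * W * (Mk² * π y) + 4 * (W * W) * (W * (m * m)) ∎)

      P-lower : ∀ x y → 1 ≤ π x → 1 ≤ π y → M ^ k * π y ≤ 2 * (W * P k x y)
      P-lower x y px py = +-cancelʳ-≤ m m (2 * (W * P k x y)) (begin
        m + m                              ≡⟨ cong (m +_) (+-identityʳ m) ⟨
        2 * m                              ≤⟨ *-monoʳ-≤ 2 (m≤n+∣n-m∣ m (W * P k x y)) ⟩
        2 * (W * P k x y + d)              ≡⟨ *-distribˡ-+ 2 (W * P k x y) d ⟩
        2 * (W * P k x y) + 2 * d          ≤⟨ +-monoʳ-≤ _ (close x y px py) ⟩
        2 * (W * P k x y) + m ∎)
        where
        open ≤-Reasoning
        m = M ^ k * π y
        d = ∣ W * P k x y - m ∣

      P-upper : ∀ x y → 1 ≤ π x → 1 ≤ π y → 2 * (W * P k x y) ≤ 3 * (M ^ k * π y)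
      P-upper x y px py = begin
        2 * (W * P k x y)         ≤⟨ *-monoʳ-≤ 2 (m≤n+∣m-n∣ (W * P k x y) m) ⟩
        2 * (m + d)               ≡⟨ *-distribˡ-+ 2 m d ⟩
        2 * m + 2 * d             ≤⟨ +-monoʳ-≤ (2 * m) (close x y px py) ⟩
        2 * m + m                 ≡⟨ lem m ⟩
        3 * m ∎
        where
        open ≤-Reasoning
        m = M ^ k * π y
        d = ∣ W * P k x y - m ∣
        lem : ∀ m → 2 * m + m ≡ 3 * m
        lem = solve-∀

-- Rare conflicts on walks with fixed ends

∑-scale : ∀ {N} c (p f : Fin N → ℕ) → c * ∑ (λ x → p x * f x) ≡ ∑ (λ x → p x * (c * f x))
∑-scale c p f = trans (sym (∑-*ˡ c (λ x → p x * f x))) (∑-cong λ x → swap* c (p x) (f x))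

∑-monoʳ : ∀ {N} (p : Fin N → ℕ) {f g : Fin N → ℕ} → (∀ x → f x ≤ g x) → ∑ (λ x → p x * f x) ≤ ∑ (λ x → p x * g x)
∑-monoʳ p f≤g = ∑-mono λ x → *-monoʳ-≤ (p x) (f≤g x)

three-gaps : ∀ {h i g l} → i + g + l ≡ 3 * h → h ≤ i ⊎ h ≤ g ⊎ h ≤ l
three-gaps {h} {i} {g} {l} e with h ≤? i | h ≤? g | h ≤? l
... | yes p | _     | _     = inj₁ p
... | no _  | yes p | _     = inj₂ (inj₁ p)
... | no _  | no _  | yes p = inj₂ (inj₂ p)
... | no ¬i | no ¬g | no ¬l = ⊥-elim (<-irrefl (trans e (lem h))
        (+-mono-< (+-mono-< (≰⇒> ¬i) (≰⇒> ¬g)) (≰⇒> ¬l)))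
  where
  lem : ∀ h → 3 * h ≡ h + h + h
  lem = solve-∀

module Connect {N : ℕ} (w : Fin N → Fin N → ℕ) (w-sym : ∀ x y → w x y ≡ w y x)
               (a : Fin N → ℕ) (M : ℕ)
               (balanced : ∀ x → 2 * (a x * Weighted.π w w-sym x) ≡ M ⊎ Weighted.π w w-sym x ≡ 0)
               (1≤M : 1 ≤ M)
               (h : ℕ)
               (lower : ∀ k → h ≤ k → ∀ x y → 1 ≤ Weighted.π w w-sym x → 1 ≤ Weighted.π w w-sym y →
                  M ^ k * Weighted.π w w-sym y ≤ 2 * (Weighted.W w w-sym * LazyWalk.P w w-sym a M balanced k x y))
               (upper : ∀ k → h ≤ k → ∀ x y → 1 ≤ Weighted.π w w-sym x → 1 ≤ Weighted.π w w-sym y →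
                  2 * (Weighted.W w w-sym * LazyWalk.P w w-sym a M balanced k x y) ≤ 3 * (M ^ k * Weighted.π w w-sym y))
               where

  open Weighted w w-sym
  open LazyWalk w w-sym a M balanced

  rev : ∀ k x y → π x * P k x y ≡ π y * P k y x
  rev = P-reversible π reversible

  module _ (D b : ℕ)
           (s : Fin N → ℕ) (c : Fin N → Fin N → ℕ)
           (s-supp : ∀ y → s y ≡ 0 ⊎ 1 ≤ π y)
           (c-supp : ∀ x y → c x y ≡ 0 ⊎ (1 ≤ π x × 1 ≤ π y))
           (c-sym : ∀ x y → c x y ≡ c y x)
           (c-diag : ∀ x → c x x ≡ 0)
           (s-step : ∀ x → D * step s x ≤ M * (D * s x + b))
           (c-step : ∀ u x → D * step (c u) x ≤ M * (D * c u x + b))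
           (S T : Fin N) (πS : 1 ≤ π S) (πT : 1 ≤ π T)
           (sS : s S ≡ 0) (sT : s T ≡ 0) (cST : c S T ≡ 0)
           where

    K : ℕ
    K = 3 * h

    B : ℕ
    B = 3 * (M ^ K * π T) * (K * b)

    E : ℕ
    E = 2 * W

    lower′ : ∀ {k} → h ≤ k → ∀ {x y} → 1 ≤ π x → 1 ≤ π y → M ^ k * π y ≤ E * P k x y
    lower′ {k} h≤k {x} {y} px py = ≤-trans (lower k h≤k x y px py) (≤-reflexive (sym (*-assoc 2 W (P k x y))))

    upper′ : ∀ {k} → h ≤ k → ∀ {x y} → 1 ≤ π x → 1 ≤ π y → E * P k x y ≤ 3 * (M ^ k * π y)
    upper′ {k} h≤k {x} {y} px py = ≤-trans (≤-reflexive (*-assoc 2 W (P k x y))) (upper k h≤k x y px py)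

    hit-s : ∀ k x → s x ≡ 0 → D * ∑ (λ y → P k x y * s y) ≤ M ^ k * (k * b)
    hit-s k x sx = ≤-trans (hitting rowsum-κ D b s s-step k x)
      (≤-reflexive (cong (λ z → M ^ k * (z + k * b)) (trans (cong (D *_) sx) (*-zeroʳ D))))

    hit-c : ∀ k u x → c u x ≡ 0 → D * ∑ (λ y → P k x y * c u y) ≤ M ^ k * (k * b)
    hit-c k u x cux = ≤-trans (hitting rowsum-κ D b (c u) (c-step u) k x)
      (≤-reflexive (cong (λ z → M ^ k * (z + k * b)) (trans (cong (D *_) cux) (*-zeroʳ D))))

    spread : ∀ i (f : Fin N → ℕ) X → (∀ y → f y ≤ X) → ∀ x → ∑ (λ y → P i x y * f y) ≤ M ^ i * X
    spread i f X f≤ x = ≤-trans (∑-monoʳ (P i x) f≤)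
      (≤-trans (≤-reflexive (∑-*ʳ X (P i x))) (*-monoˡ-≤ X (rowsum-P rowsum-κ i x)))

    exponents : ∀ i g l → i + g + l ≡ K → M ^ i * M ^ g * M ^ l ≡ M ^ K
    exponents i g l e = trans (cong (_* M ^ l) (sym (^-distribˡ-+-* M i g)))
      (trans (sym (^-distribˡ-+-* M (i + g) l)) (cong (M ^_) e))

    -- A pair (y , z) of visited vertices, met i steps after S, g steps apart and l steps before T.
    pair : ℕ → ℕ → ℕ → ℕ
    pair i g l = ∑ λ y → P i S y * ∑ λ z → P g y z * (c y z * P l z T)

    -- After a long last gap T no longer depends on z, so `P l z T` is replaced by a multiple of
    -- `π T`. What remains is the chance that a walk from y meets a conflict with y itself g steps
    -- later, which is small because `c y y` vanishes.
    pair-late : ∀ i g l → i + g + l ≡ K → h ≤ l → E * (D * pair i g l) ≤ B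
    pair-late i g l e h≤l = begin
      E * (D * pair i g l)
        ≡⟨ trans (cong (E *_) (∑-scale D (P i S) G)) (∑-scale E (P i S) (λ y → D * G y)) ⟩
      ∑ (λ y → P i S y * (E * (D * G y)))
        ≤⟨ spread i _ _ middle S ⟩
      M ^ i * (3 * (M ^ l * π T) * (M ^ g * (g * b)))
        ≡⟨ lem (M ^ i) (M ^ l) (M ^ g) (π T) (g * b) ⟩
      3 * (M ^ i * M ^ g * M ^ l * π T) * (g * b)
        ≡⟨ cong (λ z → 3 * (z * π T) * (g * b)) (exponents i g l e) ⟩
      3 * (M ^ K * π T) * (g * b)
        ≤⟨ *-monoʳ-≤ (3 * (M ^ K * π T)) (*-monoˡ-≤ b g≤K) ⟩
      B ∎
      where
      open ≤-Reasoning
      G : Fin N → ℕ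
      G y = ∑ λ z → P g y z * (c y z * P l z T)
      g≤K : g ≤ K
      g≤K = ≤-trans (m≤n+m g i) (≤-trans (m≤m+n (i + g) l) (≤-reflexive e))
      lem : ∀ i l g p b → i * (3 * (l * p) * (g * b)) ≡ 3 * (i * g * l * p) * b
      lem = solve-∀
      pw : ∀ y z → E * (c y z * P l z T) ≤ 3 * (M ^ l * π T) * c y z
      pw y z with c-supp y z
      ... | inj₁ c≡0 rewrite c≡0 | *-zeroʳ E = z≤n
      ... | inj₂ (_ , πz) = ≤-trans (≤-reflexive (swap* E (c y z) (P l z T)))
              (≤-trans (*-monoʳ-≤ (c y z) (upper′ h≤l πz πT)) (≤-reflexive (*-comm (c y z) _)))
      middle : ∀ y → E * (D * G y) ≤ 3 * (M ^ l * π T) * (M ^ g * (g * b))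
      middle y = begin
        E * (D * G y)
          ≡⟨ trans (swap* E D (G y)) (cong (D *_) (∑-scale E (P g y) (λ z → c y z * P l z T))) ⟩
        D * ∑ (λ z → P g y z * (E * (c y z * P l z T)))
          ≤⟨ *-monoʳ-≤ D (∑-monoʳ (P g y) (pw y)) ⟩
        D * ∑ (λ z → P g y z * (3 * (M ^ l * π T) * c y z))
          ≡⟨ trans (cong (D *_) (sym (∑-scale (3 * (M ^ l * π T)) (P g y) (c y)))) (swap* D (3 * (M ^ l * π T)) _) ⟩
        3 * (M ^ l * π T) * (D * ∑ (λ z → P g y z * c y z))
          ≤⟨ *-monoʳ-≤ (3 * (M ^ l * π T)) (hit-c g y y (c-diag y)) ⟩
        3 * (M ^ l * π T) * (M ^ g * (g * b)) ∎

    -- A long first gap bounds `P i S y` by a multiple of `π y`. Reversibility carries this weight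
    -- through the other two factors to T, so that the walk is read backwards: from T to z, and then
    -- from z to a tuple in conflict with z.
    pair-early : ∀ i g l → i + g + l ≡ K → h ≤ i → E * (D * pair i g l) ≤ B
    pair-early i g l e h≤i = begin
      E * (D * pair i g l)
        ≡⟨ trans (swap* E D _) (cong (D *_) (∑-scale E (P i S) G)) ⟩
      D * ∑ (λ y → P i S y * (E * G y))
        ≤⟨ *-monoʳ-≤ D (∑-mono (λ y → row y)) ⟩
      D * ∑ (λ y → ∑ λ z → P l T z * (3 * (M ^ i * π T) * (P g z y * c z y)))
        ≡⟨ cong (D *_) (trans (∑-swap (λ y z → P l T z * (3 * (M ^ i * π T) * (P g z y * c z y))))
             (∑-cong λ z → trans (∑-*ˡ (P l T z) _) (cong (P l T z *_) (∑-*ˡ (3 * (M ^ i * π T)) (λ y → P g z y * c z y))))) ⟩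
      D * ∑ (λ z → P l T z * (3 * (M ^ i * π T) * ∑ (λ y → P g z y * c z y)))
        ≡⟨ ∑-scale D (P l T) _ ⟩
      ∑ (λ z → P l T z * (D * (3 * (M ^ i * π T) * ∑ (λ y → P g z y * c z y))))
        ≤⟨ spread l _ _ (λ z → ≤-trans (≤-reflexive (swap* D (3 * (M ^ i * π T)) _))
             (*-monoʳ-≤ (3 * (M ^ i * π T)) (hit-c g z z (c-diag z)))) T ⟩
      M ^ l * (3 * (M ^ i * π T) * (M ^ g * (g * b)))
        ≡⟨ lem (M ^ i) (M ^ l) (M ^ g) (π T) (g * b) ⟩
      3 * (M ^ i * M ^ g * M ^ l * π T) * (g * b)
        ≡⟨ cong (λ z → 3 * (z * π T) * (g * b)) (exponents i g l e) ⟩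
      3 * (M ^ K * π T) * (g * b)
        ≤⟨ *-monoʳ-≤ (3 * (M ^ K * π T)) (*-monoˡ-≤ b g≤K) ⟩
      B ∎
      where
      open ≤-Reasoning
      G : Fin N → ℕ
      G y = ∑ λ z → P g y z * (c y z * P l z T)
      g≤K : g ≤ K
      g≤K = ≤-trans (m≤n+m g i) (≤-trans (m≤m+n (i + g) l) (≤-reflexive e))
      lem : ∀ i l g p b → l * (3 * (i * p) * (g * b)) ≡ 3 * (i * g * l * p) * b
      lem = solve-∀
      lem₁ : ∀ p E q c r → p * (E * (q * (c * r))) ≡ E * p * (c * (q * r))
      lem₁ = solve-∀
      lem₂ : ∀ i p c q r → 3 * (i * p) * (c * (q * r)) ≡ 3 * i * c * (p * q * r)
      lem₂ = solve-∀
      lem₃ : ∀ i p c q r → 3 * i * c * (p * q * r) ≡ 3 * i * c * q * (p * r)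
      lem₃ = solve-∀
      lem₄ : ∀ i p c q r → 3 * i * c * q * (p * r) ≡ r * (3 * (i * p) * (q * c))
      lem₄ = solve-∀
      entry : ∀ y z → P i S y * (E * (P g y z * (c y z * P l z T))) ≤ P l T z * (3 * (M ^ i * π T) * (P g z y * c z y))
      entry y z with c-supp y z
      ... | inj₁ c≡0 rewrite c≡0 | *-zeroʳ (P g y z) | *-zeroʳ E | *-zeroʳ (P i S y) = z≤n
      ... | inj₂ (πy , πz) = begin
        P i S y * (E * (P g y z * (c y z * P l z T)))
          ≡⟨ lem₁ (P i S y) E (P g y z) (c y z) (P l z T) ⟩
        E * P i S y * (c y z * (P g y z * P l z T))
          ≤⟨ *-monoˡ-≤ _ (upper′ h≤i πS πy) ⟩
        3 * (M ^ i * π y) * (c y z * (P g y z * P l z T))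
          ≡⟨ lem₂ (M ^ i) (π y) (c y z) (P g y z) (P l z T) ⟩
        3 * M ^ i * c y z * (π y * P g y z * P l z T)
          ≡⟨ cong₂ (λ u v → 3 * M ^ i * u * (v * P l z T)) (c-sym y z) (rev g y z) ⟩
        3 * M ^ i * c z y * (π z * P g z y * P l z T)
          ≡⟨ lem₃ (M ^ i) (π z) (c z y) (P g z y) (P l z T) ⟩
        3 * M ^ i * c z y * P g z y * (π z * P l z T)
          ≡⟨ cong (3 * M ^ i * c z y * P g z y *_) (rev l z T) ⟩
        3 * M ^ i * c z y * P g z y * (π T * P l T z)
          ≡⟨ lem₄ (M ^ i) (π T) (c z y) (P g z y) (P l T z) ⟩
        P l T z * (3 * (M ^ i * π T) * (P g z y * c z y)) ∎
      row : ∀ y → P i S y * (E * G y) ≤ ∑ (λ z → P l T z * (3 * (M ^ i * π T) * (P g z y * c z y)))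
      row y = ≤-trans (≤-reflexive (trans (cong (P i S y *_) (sym (∑-*ˡ E (λ z → P g y z * (c y z * P l z T)))))
                (sym (∑-*ˡ (P i S y) (λ z → E * (P g y z * (c y z * P l z T)))))))
        (∑-mono (entry y))

    -- A long middle gap decouples y from z. With the last piece read backwards from T, one
    -- application of `hitting` replaces z by T in `c y z` and a second one replaces y by S. The
    -- chain ends at `c S T`, which is why the two ends must not conflict.
    pair-far : ∀ i g l → i + g + l ≡ K → h ≤ g → E * (D * pair i g l) ≤ B
    pair-far i g l e h≤g = begin
      E * (D * pair i g l)
        ≡⟨ trans (cong (E *_) (∑-scale D (P i S) G)) (∑-scale E (P i S) (λ y → D * G y)) ⟩
      ∑ (λ y → P i S y * (E * (D * G y)))
        ≤⟨ ∑-monoʳ (P i S) middle ⟩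
      ∑ (λ y → P i S y * (3 * (M ^ g * π T) * (M ^ l * (D * c T y + l * b))))
        ≡⟨ ∑-scale (3 * (M ^ g * π T)) (P i S) (λ y → M ^ l * (D * c T y + l * b)) ⟨
      3 * (M ^ g * π T) * ∑ (λ y → P i S y * (M ^ l * (D * c T y + l * b)))
        ≡⟨ cong (3 * (M ^ g * π T) *_) (sym (∑-scale (M ^ l) (P i S) (λ y → D * c T y + l * b))) ⟩
      3 * (M ^ g * π T) * (M ^ l * ∑ (λ y → P i S y * (D * c T y + l * b)))
        ≤⟨ *-monoʳ-≤ (3 * (M ^ g * π T)) (*-monoʳ-≤ (M ^ l) outer) ⟩
      3 * (M ^ g * π T) * (M ^ l * (M ^ i * (i * b) + M ^ i * (l * b)))
        ≡⟨ lem (M ^ i) (M ^ l) (M ^ g) (π T) b i l ⟩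
      3 * (M ^ i * M ^ g * M ^ l * π T) * ((i + l) * b)
        ≡⟨ cong (λ z → 3 * (z * π T) * ((i + l) * b)) (exponents i g l e) ⟩
      3 * (M ^ K * π T) * ((i + l) * b)
        ≤⟨ *-monoʳ-≤ (3 * (M ^ K * π T)) (*-monoˡ-≤ b i+l≤K) ⟩
      B ∎
      where
      open ≤-Reasoning
      G : Fin N → ℕ
      G y = ∑ λ z → P g y z * (c y z * P l z T)
      i+l≤K : i + l ≤ K
      i+l≤K = ≤-trans (+-monoˡ-≤ l (m≤m+n i g)) (≤-reflexive e)
      lem : ∀ i l g p b u v → 3 * (g * p) * (l * (i * (u * b) + i * (v * b))) ≡ 3 * (i * g * l * p) * ((u + v) * b)
      lem = solve-∀
      outer : ∑ (λ y → P i S y * (D * c T y + l * b)) ≤ M ^ i * (i * b) + M ^ i * (l * b)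
      outer = begin
        ∑ (λ y → P i S y * (D * c T y + l * b))
          ≡⟨ trans (∑-cong λ y → *-distribˡ-+ (P i S y) (D * c T y) (l * b))
               (∑-+ (λ y → P i S y * (D * c T y)) (λ y → P i S y * (l * b))) ⟩
        ∑ (λ y → P i S y * (D * c T y)) + ∑ (λ y → P i S y * (l * b))
          ≤⟨ +-mono-≤ (≤-trans (≤-reflexive (sym (∑-scale D (P i S) (c T)))) (hit-c i T S (trans (c-sym T S) cST)))
               (spread i (λ _ → l * b) (l * b) (λ _ → ≤-refl) S) ⟩
        M ^ i * (i * b) + M ^ i * (l * b) ∎
      lem₁ : ∀ E q c r → E * (q * (c * r)) ≡ E * q * (c * r)
      lem₁ = solve-∀
      lem₂ : ∀ g p c r → 3 * (g * p) * (c * r) ≡ 3 * g * c * (p * r)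
      lem₂ = solve-∀
      lem₃ : ∀ g p c r → 3 * g * c * (p * r) ≡ r * (3 * (g * p) * c)
      lem₃ = solve-∀
      entry : ∀ y z → E * (P g y z * (c y z * P l z T)) ≤ P l T z * (3 * (M ^ g * π T) * c y z)
      entry y z with c-supp y z
      ... | inj₁ c≡0 rewrite c≡0 | *-zeroʳ (P g y z) | *-zeroʳ E = z≤n
      ... | inj₂ (πy , πz) = begin
        E * (P g y z * (c y z * P l z T))              ≡⟨ lem₁ E (P g y z) (c y z) (P l z T) ⟩
        E * P g y z * (c y z * P l z T)                ≤⟨ *-monoˡ-≤ _ (upper′ h≤g πy πz) ⟩
        3 * (M ^ g * π z) * (c y z * P l z T)          ≡⟨ lem₂ (M ^ g) (π z) (c y z) (P l z T) ⟩
        3 * M ^ g * c y z * (π z * P l z T)            ≡⟨ cong (3 * M ^ g * c y z *_) (rev l z T) ⟩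
        3 * M ^ g * c y z * (π T * P l T z)            ≡⟨ lem₃ (M ^ g) (π T) (c y z) (P l T z) ⟩
        P l T z * (3 * (M ^ g * π T) * c y z)          ∎
      middle : ∀ y → E * (D * G y) ≤ 3 * (M ^ g * π T) * (M ^ l * (D * c T y + l * b))
      middle y = begin
        E * (D * G y)
          ≡⟨ trans (swap* E D (G y)) (cong (D *_) (sym (∑-*ˡ E (λ z → P g y z * (c y z * P l z T))))) ⟩
        D * ∑ (λ z → E * (P g y z * (c y z * P l z T)))
          ≤⟨ *-monoʳ-≤ D (∑-mono (entry y)) ⟩
        D * ∑ (λ z → P l T z * (3 * (M ^ g * π T) * c y z))
          ≡⟨ trans (cong (D *_) (sym (∑-scale (3 * (M ^ g * π T)) (P l T) (c y)))) (swap* D (3 * (M ^ g * π T)) _) ⟩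
        3 * (M ^ g * π T) * (D * ∑ (λ z → P l T z * c y z))
          ≤⟨ *-monoʳ-≤ (3 * (M ^ g * π T)) (hitting rowsum-κ D b (c y) (c-step y) l T) ⟩
        3 * (M ^ g * π T) * (M ^ l * (D * c y T + l * b))
          ≡⟨ cong (λ u → 3 * (M ^ g * π T) * (M ^ l * (D * u + l * b))) (c-sym y T) ⟩
        3 * (M ^ g * π T) * (M ^ l * (D * c T y + l * b)) ∎

    pair-≤ : ∀ i g l → i + g + l ≡ K → E * (D * pair i g l) ≤ B
    pair-≤ i g l e with three-gaps {h} {i} {g} {l} e
    ... | inj₁ p        = pair-early i g l e p
    ... | inj₂ (inj₁ p) = pair-far i g l e p
    ... | inj₂ (inj₂ p) = pair-late i g l e p

    single : ℕ → ℕ → ℕ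
    single g l = ∑ λ z → P g S z * (s z * P l z T)

    single-late : ∀ g l → g + l ≡ K → h ≤ l → E * (D * single g l) ≤ B
    single-late g l e h≤l = begin
      E * (D * single g l)
        ≡⟨ trans (swap* E D _) (cong (D *_) (∑-scale E (P g S) (λ z → s z * P l z T))) ⟩
      D * ∑ (λ z → P g S z * (E * (s z * P l z T)))
        ≤⟨ *-monoʳ-≤ D (∑-monoʳ (P g S) pw) ⟩
      D * ∑ (λ z → P g S z * (3 * (M ^ l * π T) * s z))
        ≡⟨ trans (cong (D *_) (sym (∑-scale (3 * (M ^ l * π T)) (P g S) s))) (swap* D (3 * (M ^ l * π T)) _) ⟩
      3 * (M ^ l * π T) * (D * ∑ (λ z → P g S z * s z))
        ≤⟨ *-monoʳ-≤ (3 * (M ^ l * π T)) (hit-s g S sS) ⟩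
      3 * (M ^ l * π T) * (M ^ g * (g * b))
        ≡⟨ lem (M ^ l) (M ^ g) (π T) (g * b) ⟩
      3 * (M ^ 0 * M ^ g * M ^ l * π T) * (g * b)
        ≡⟨ cong (λ z → 3 * (z * π T) * (g * b)) (exponents 0 g l e) ⟩
      3 * (M ^ K * π T) * (g * b)
        ≤⟨ *-monoʳ-≤ (3 * (M ^ K * π T)) (*-monoˡ-≤ b (≤-trans (m≤m+n g l) (≤-reflexive e))) ⟩
      B ∎
      where
      open ≤-Reasoning
      lem : ∀ l g p b → 3 * (l * p) * (g * b) ≡ 3 * (1 * g * l * p) * b
      lem = solve-∀
      pw : ∀ z → E * (s z * P l z T) ≤ 3 * (M ^ l * π T) * s z
      pw z with s-supp z
      ... | inj₁ s≡0 rewrite s≡0 | *-zeroʳ E = z≤n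
      ... | inj₂ πz = ≤-trans (≤-reflexive (swap* E (s z) (P l z T)))
              (≤-trans (*-monoʳ-≤ (s z) (upper′ h≤l πz πT)) (≤-reflexive (*-comm (s z) _)))

    single-early : ∀ g l → g + l ≡ K → h ≤ g → E * (D * single g l) ≤ B
    single-early g l e h≤g = begin
      E * (D * single g l)
        ≡⟨ trans (swap* E D _) (cong (D *_) (sym (∑-*ˡ E (λ z → P g S z * (s z * P l z T))))) ⟩
      D * ∑ (λ z → E * (P g S z * (s z * P l z T)))
        ≤⟨ *-monoʳ-≤ D (∑-mono entry) ⟩
      D * ∑ (λ z → P l T z * (3 * (M ^ g * π T) * s z))
        ≡⟨ trans (cong (D *_) (sym (∑-scale (3 * (M ^ g * π T)) (P l T) s))) (swap* D (3 * (M ^ g * π T)) _) ⟩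
      3 * (M ^ g * π T) * (D * ∑ (λ z → P l T z * s z))
        ≤⟨ *-monoʳ-≤ (3 * (M ^ g * π T)) (hit-s l T sT) ⟩
      3 * (M ^ g * π T) * (M ^ l * (l * b))
        ≡⟨ lem (M ^ l) (M ^ g) (π T) (l * b) ⟩
      3 * (M ^ 0 * M ^ g * M ^ l * π T) * (l * b)
        ≡⟨ cong (λ z → 3 * (z * π T) * (l * b)) (exponents 0 g l e) ⟩
      3 * (M ^ K * π T) * (l * b)
        ≤⟨ *-monoʳ-≤ (3 * (M ^ K * π T)) (*-monoˡ-≤ b (≤-trans (m≤n+m l g) (≤-reflexive e))) ⟩
      B ∎
      where
      open ≤-Reasoning
      lem : ∀ l g p b → 3 * (g * p) * (l * b) ≡ 3 * (1 * g * l * p) * b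
      lem = solve-∀
      lem₁ : ∀ E q c r → E * (q * (c * r)) ≡ E * q * (c * r)
      lem₁ = solve-∀
      lem₂ : ∀ g p c r → 3 * (g * p) * (c * r) ≡ 3 * g * c * (p * r)
      lem₂ = solve-∀
      lem₃ : ∀ g p c r → 3 * g * c * (p * r) ≡ r * (3 * (g * p) * c)
      lem₃ = solve-∀
      entry : ∀ z → E * (P g S z * (s z * P l z T)) ≤ P l T z * (3 * (M ^ g * π T) * s z)
      entry z with s-supp z
      ... | inj₁ s≡0 rewrite s≡0 | *-zeroʳ (P g S z) | *-zeroʳ E = z≤n
      ... | inj₂ πz = begin
        E * (P g S z * (s z * P l z T))              ≡⟨ lem₁ E (P g S z) (s z) (P l z T) ⟩
        E * P g S z * (s z * P l z T)                ≤⟨ *-monoˡ-≤ _ (upper′ h≤g πS πz) ⟩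
        3 * (M ^ g * π z) * (s z * P l z T)          ≡⟨ lem₂ (M ^ g) (π z) (s z) (P l z T) ⟩
        3 * M ^ g * s z * (π z * P l z T)            ≡⟨ cong (3 * M ^ g * s z *_) (rev l z T) ⟩
        3 * M ^ g * s z * (π T * P l T z)            ≡⟨ lem₃ (M ^ g) (π T) (s z) (P l T z) ⟩
        P l T z * (3 * (M ^ g * π T) * s z)          ∎

    single-≤ : ∀ g l → g + l ≡ K → E * (D * single g l) ≤ B
    single-≤ g l e with three-gaps {h} {0} {g} {l} e
    -- The first gap is empty here, so h is 0 and every gap counts as long.
    ... | inj₁ p        = single-late g l e (≤-trans p z≤n)
    ... | inj₂ (inj₁ p) = single-early g l e p
    ... | inj₂ (inj₂ p) = single-late g l e p

    ∑-≤-const : ∀ {n} (f : Fin n → ℕ) c → (∀ i → E * (D * f i) ≤ c) → E * (D * ∑ f) ≤ n * c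
    ∑-≤-const {n} f c f≤ = ≤-trans (≤-reflexive (trans (cong (E *_) (sym (∑-*ˡ D f))) (sym (∑-*ˡ E (λ i → D * f i)))))
      (≤-trans (∑-mono f≤) (≤-reflexive (∑-const n c)))

    visits-≤ : E * (D * 𝔼visits T s K S) ≤ K * B
    visits-≤ = ≤-trans (≤-reflexive (cong (λ z → E * (D * z)) (𝔼visits-eq T s K S)))
      (∑-≤-const _ B λ j → single-≤ (suc (toℕ j)) (K ∸ suc (toℕ j)) (m+[n∸m]≡n (Finₚ.toℕ<n j)))

    conflicts-≤ : E * (D * 𝔼conflicts T c K S) ≤ K * (K * B)
    conflicts-≤ = ≤-trans (≤-reflexive (cong (λ z → E * (D * z)) (𝔼conflicts-eq T c K S)))
      (∑-≤-const _ (K * B) row)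
      where
      row : ∀ i → E * (D * ∑ (λ y → P (toℕ i) S y * 𝔼visits T (c y) (K ∸ toℕ i) y)) ≤ K * B
      row i = ≤-trans (≤-reflexive (cong (λ z → E * (D * z)) expand))
        (≤-trans (∑-≤-const (λ j → pair (toℕ i) (suc (toℕ j)) (K ∸ toℕ i ∸ suc (toℕ j))) B
            (λ j → pair-≤ (toℕ i) (suc (toℕ j)) (K ∸ toℕ i ∸ suc (toℕ j))
              (trans (+-assoc (toℕ i) _ _) (trans (cong (toℕ i +_) (m+[n∸m]≡n (Finₚ.toℕ<n j)))
                (m+[n∸m]≡n (<⇒≤ (Finₚ.toℕ<n i)))))))
          (*-monoˡ-≤ B (m∸n≤m K (toℕ i))))
        where
        H : Fin N → Fin (K ∸ toℕ i) → ℕ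
        H y j = ∑ λ z → P (suc (toℕ j)) y z * (c y z * P (K ∸ toℕ i ∸ suc (toℕ j)) z T)
        expand : ∑ (λ y → P (toℕ i) S y * 𝔼visits T (c y) (K ∸ toℕ i) y)
               ≡ ∑ (λ j → pair (toℕ i) (suc (toℕ j)) (K ∸ toℕ i ∸ suc (toℕ j)))
        expand = trans (∑-cong λ y → trans (cong (P (toℕ i) S y *_) (𝔼visits-eq T (c y) (K ∸ toℕ i) y))
                   (sym (∑-*ˡ (P (toℕ i) S y) (H y))))
                 (∑-swap (λ y j → P (toℕ i) S y * H y j))

    -- Both error bounds are multiples of `M ^ K * π T`, and mixing bounds `E * P K S T` from below
    -- by the same quantity. The walk weights therefore cancel, and only a comparison of numbers is
    -- left.
    few-bad : (K + K * K) * (3 * (K * b)) < D → 𝔼visits T s K S + 𝔼conflicts T c K S < P K S T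
    few-bad enough = *-cancelˡ-< (E * D) _ _ (begin-strict
      E * D * (𝔼visits T s K S + 𝔼conflicts T c K S)
        ≡⟨ lem₁ E D (𝔼visits T s K S) (𝔼conflicts T c K S) ⟩
      E * (D * 𝔼visits T s K S) + E * (D * 𝔼conflicts T c K S)
        ≤⟨ +-mono-≤ visits-≤ conflicts-≤ ⟩
      K * B + K * (K * B)
        ≡⟨ lem₂ K (M ^ K * π T) (K * b) ⟩
      (K + K * K) * (3 * (K * b)) * (M ^ K * π T)
        <⟨ *-monoˡ-< (M ^ K * π T) {{>-nonZero (*-mono-≤ (m^n>0 M {{>-nonZero 1≤M}} K) πT)}} enough ⟩
      D * (M ^ K * π T)
        ≤⟨ *-monoʳ-≤ D (lower′ (m≤m+n h (h + (h + 0))) πS πT) ⟩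
      D * (E * P K S T)
        ≡⟨ lem₃ D E (P K S T) ⟩
      E * D * P K S T ∎)
      where
      open ≤-Reasoning
      lem₁ : ∀ E D a b → E * D * (a + b) ≡ E * (D * a) + E * (D * b)
      lem₁ = solve-∀
      lem₂ : ∀ K p b → K * (3 * p * b) + K * (K * (3 * p * b)) ≡ (K + K * K) * (3 * b) * p
      lem₂ = solve-∀
      lem₃ : ∀ D E p → D * (E * p) ≡ E * D * p
      lem₃ = solve-∀

-- Extraction of an expanding set that keeps its density

_∩_ _∖_ : ∀ {N} → (Fin N → Bool) → (Fin N → Bool) → Fin N → Bool
(u ∩ S) x = u x ∧ S x
(u ∖ S) x = u x ∧ not (S x)

_⊑_ : ∀ {N} → (Fin N → Bool) → (Fin N → Bool) → Set
v ⊑ u = ∀ x → v x ≡ true → u x ≡ true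

∧-trueˡ : ∀ {a b} → a ∧ b ≡ true → a ≡ true
∧-trueˡ {true} _ = refl

module Extraction {N : ℕ} (A : Fin N → Fin N → ℕ) (A-sym : ∀ x y → A x y ≡ A y x) (d : Fin N → ℕ) where

  vol : (Fin N → Bool) → ℕ
  vol u = ∑ λ x → ⟦ u x ⟧ * d x

  e : (Fin N → Bool) → (Fin N → Bool) → ℕ
  e u v = ∑ λ x → ∑ λ y → ⟦ u x ⟧ * (⟦ v y ⟧ * A x y)

  card : (Fin N → Bool) → ℕ
  card u = ∑ λ x → ⟦ u x ⟧

  split : ∀ (u S : Fin N → Bool) x → ⟦ u x ⟧ ≡ ⟦ (u ∩ S) x ⟧ + ⟦ (u ∖ S) x ⟧
  split u S x with u x | S x
  ... | false | _     = refl
  ... | true  | false = refl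
  ... | true  | true  = refl

  vol-split : ∀ u S → vol u ≡ vol (u ∩ S) + vol (u ∖ S)
  vol-split u S = trans (∑-cong λ x → trans (cong (_* d x) (split u S x)) (*-distribʳ-+ (d x) ⟦ (u ∩ S) x ⟧ _))
    (∑-+ (λ x → ⟦ (u ∩ S) x ⟧ * d x) (λ x → ⟦ (u ∖ S) x ⟧ * d x))

  card-split : ∀ u S → card u ≡ card (u ∩ S) + card (u ∖ S)
  card-split u S = trans (∑-cong (split u S)) (∑-+ (λ x → ⟦ (u ∩ S) x ⟧) (λ x → ⟦ (u ∖ S) x ⟧))

  e-splitˡ : ∀ u v S → e u v ≡ e (u ∩ S) v + e (u ∖ S) v
  e-splitˡ u v S = trans (∑-cong λ x → trans (∑-cong λ y → trans (cong (_* (⟦ v y ⟧ * A x y)) (split u S x))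
      (*-distribʳ-+ (⟦ v y ⟧ * A x y) ⟦ (u ∩ S) x ⟧ _))
      (∑-+ (λ y → ⟦ (u ∩ S) x ⟧ * (⟦ v y ⟧ * A x y)) (λ y → ⟦ (u ∖ S) x ⟧ * (⟦ v y ⟧ * A x y))))
    (∑-+ (λ x → ∑ λ y → ⟦ (u ∩ S) x ⟧ * (⟦ v y ⟧ * A x y)) (λ x → ∑ λ y → ⟦ (u ∖ S) x ⟧ * (⟦ v y ⟧ * A x y)))

  e-sym : ∀ u v → e u v ≡ e v u
  e-sym u v = trans (∑-swap (λ x y → ⟦ u x ⟧ * (⟦ v y ⟧ * A x y)))
    (∑-cong λ y → ∑-cong λ x → trans (swap* ⟦ u x ⟧ ⟦ v y ⟧ (A x y)) (cong (λ z → ⟦ v y ⟧ * (⟦ u x ⟧ * z)) (A-sym x y)))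

  e-split : ∀ u S → e u u ≡ e (u ∩ S) (u ∩ S) + e (u ∖ S) (u ∖ S) + 2 * e (u ∩ S) (u ∖ S)
  e-split u S = begin
    e u u                               ≡⟨ e-splitˡ u u S ⟩
    e B u + e C u                       ≡⟨ cong₂ _+_ (trans (e-sym B u) (e-splitˡ u B S)) (trans (e-sym C u) (e-splitˡ u C S)) ⟩
    (e B B + e C B) + (e B C + e C C)   ≡⟨ cong (λ z → (e B B + z) + (e B C + e C C)) (e-sym C B) ⟩
    (e B B + e B C) + (e B C + e C C)   ≡⟨ lem (e B B) (e B C) (e C C) ⟩
    e B B + e C C + 2 * e B C           ∎
    where
    open ≡-Reasoning
    B = u ∩ S
    C = u ∖ S
    lem : ∀ a b c → (a + b) + (b + c) ≡ a + c + 2 * b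
    lem = solve-∀

  vol-cong : ∀ {u v : Fin N → Bool} → (∀ x → u x ≡ v x) → vol u ≡ vol v
  vol-cong eq = ∑-cong λ x → cong (λ b → ⟦ b ⟧ * d x) (eq x)

  e-cong : ∀ {u u′ v v′ : Fin N → Bool} → (∀ x → u x ≡ u′ x) → (∀ x → v x ≡ v′ x) → e u v ≡ e u′ v′
  e-cong eq eq′ = ∑-cong λ x → ∑-cong λ y → cong₂ (λ a b → ⟦ a ⟧ * (⟦ b ⟧ * A x y)) (eq x) (eq′ y)

  card-positive : ∀ u → 1 ≤ vol u → 1 ≤ card u
  card-positive u 1≤vol with ∑-witness-< {N} (λ _ → 0) (λ x → ⟦ u x ⟧ * d x)
                                (≤-trans (≤-reflexive (cong suc (∑-≡0 {N} {λ _ → 0} λ _ → refl))) 1≤vol)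
  ... | x , pos = ≤-trans (positive (u x) pos) (term≤∑ (λ x → ⟦ u x ⟧) x)
    where
    positive : ∀ b {c} → 0 < ⟦ b ⟧ * c → 1 ≤ ⟦ b ⟧
    positive true _ = ≤-refl

  module _ (h : ℕ) where

    q : ℕ
    q = 8 * h

    Expander : (Fin N → Bool) → Set
    Expander v = ∀ S → 2 * vol (v ∩ S) ≤ vol v → vol (v ∩ S) ≤ q * e (v ∩ S) (v ∖ S)

    -- The density e / vol of a set may fall by 1 / (4 h) whenever its volume halves, which happens at
    -- most h times; lev bounds the number of halvings still to come.
    Dense : ℕ → (Fin N → Bool) → Set
    Dense lev v = vol v * (h + lev) ≤ e v v * (4 * h)

    -- Stated for Boolean vectors, over which the search for a sparse cut is decidable; `extract`
    -- translates back to predicates.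
    Sparse : (Fin N → Bool) → Subset N → Set
    Sparse u S = 2 * vol (u ∩ Vec.lookup S) ≤ vol u × q * e (u ∩ Vec.lookup S) (u ∖ Vec.lookup S) < vol (u ∩ Vec.lookup S)

    sparse? : ∀ u → Dec (∃ (Sparse u))
    sparse? u = anySubset? λ S → (2 * vol (u ∩ Vec.lookup S) ≤? vol u) ×-dec
      (q * e (u ∩ Vec.lookup S) (u ∖ Vec.lookup S) <? vol (u ∩ Vec.lookup S))

    -- Crossing edges count twice in `e u u`; scaled by 4 h they weigh 8 h times the cut, which
    -- explains `q`. Sparsity bounds this by the volume of `u ∩ S`, exactly the loss of one level on
    -- that side alone, so the other side pays nothing.
    one-side-dense : ∀ lev u S → Dense (suc lev) u → q * e (u ∩ S) (u ∖ S) ≤ vol (u ∩ S) →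
      ¬ Dense (suc lev) (u ∖ S) → Dense lev (u ∩ S)
    one-side-dense lev u S dense sparse ¬denseC = +-cancelʳ-≤ (vB + vC * (h + suc lev)) _ _ (begin
      vB * (h + lev) + (vB + vC * (h + suc lev))
        ≡⟨ lem₁ vB vC h lev ⟩
      (vB + vC) * (h + suc lev)
        ≡⟨ cong (_* (h + suc lev)) (vol-split u S) ⟨
      vol u * (h + suc lev)
        ≤⟨ dense ⟩
      e u u * (4 * h)
        ≡⟨ cong (_* (4 * h)) (e-split u S) ⟩
      (e B B + e C C + 2 * e B C) * (4 * h)
        ≡⟨ lem₂ (e B B) (e C C) (e B C) h ⟩
      e B B * (4 * h) + (q * e B C + e C C * (4 * h))
        ≤⟨ +-monoʳ-≤ (e B B * (4 * h)) (+-mono-≤ sparse (<⇒≤ (≰⇒> ¬denseC))) ⟩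
      e B B * (4 * h) + (vB + vC * (h + suc lev)) ∎)
      where
      open ≤-Reasoning
      B = u ∩ S
      C = u ∖ S
      vB = vol B
      vC = vol C
      lem₁ : ∀ b c h l → b * (h + l) + (b + c * (h + (1 + l))) ≡ (b + c) * (h + (1 + l))
      lem₁ = solve-∀
      lem₂ : ∀ b c x h → (b + c + 2 * x) * (4 * h) ≡ b * (4 * h) + (8 * h * x + c * (4 * h))
      lem₂ = solve-∀

    -- Passing to C keeps the level; passing to the smaller side B gives up one level but halves the
    -- volume, so `vol u < 2 ^ lev` persists and the levels cannot run out while the volume is
    -- positive. Cardinality drops in both cases, which makes it suitable as fuel.
    extract : ∀ fuel lev u → card u ≤ fuel → vol u < 2 ^ lev → 1 ≤ vol u → Dense lev u →
      ∃[ v ] (v ⊑ u × 1 ≤ vol v × Dense 0 v × Expander v)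
    extract zero lev u card≤ _ 1≤vol _ with ≤-trans (card-positive u 1≤vol) card≤
    ... | ()
    extract (suc fuel) zero u _ vol< 1≤vol _ = ⊥-elim (<-irrefl refl (<-≤-trans vol< 1≤vol))
    extract (suc fuel) (suc lev) u card≤ vol< 1≤vol dense with sparse? u
    ... | no ¬sparse = u , (λ _ eq → eq) , 1≤vol ,
          ≤-trans (*-monoʳ-≤ (vol u) (+-monoʳ-≤ h z≤n)) dense , expander
      where
      expander : Expander u
      expander S half with vol (u ∩ S) ≤? q * e (u ∩ S) (u ∖ S)
      ... | yes p = p
      ... | no ¬p = ⊥-elim (¬sparse (Vec.tabulate S ,
            subst (λ z → 2 * z ≤ vol u) (vol-cong eq∩) half ,
            subst₂ _<_ (cong (q *_) (e-cong eq∩ eq∖)) (vol-cong eq∩) (≰⇒> ¬p)))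
        where
        eq∩ : ∀ x → (u ∩ S) x ≡ (u ∩ Vec.lookup (Vec.tabulate S)) x
        eq∩ x = cong (u x ∧_) (sym (lookup∘tabulate S x))
        eq∖ : ∀ x → (u ∖ S) x ≡ (u ∖ Vec.lookup (Vec.tabulate S)) x
        eq∖ x = cong (λ b → u x ∧ not b) (sym (lookup∘tabulate S x))
    ... | yes (S′ , half , sparse) = result
      where
      S = Vec.lookup S′
      B = u ∩ S
      C = u ∖ S
      1≤vB : 1 ≤ vol B
      1≤vB = ≤-trans (s≤s z≤n) sparse
      vB≤vC : vol B ≤ vol C
      vB≤vC = +-cancelˡ-≤ (vol B) _ _ (≤-trans (≤-reflexive (cong (vol B +_) (sym (+-identityʳ (vol B)))))
        (≤-trans half (≤-reflexive (vol-split u S))))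
      1≤vC : 1 ≤ vol C
      1≤vC = ≤-trans 1≤vB vB≤vC
      cards : card B + card C ≤ suc fuel
      cards = ≤-trans (≤-reflexive (sym (card-split u S))) card≤
      cardB : card B ≤ fuel
      cardB = +-cancelʳ-≤ 1 _ _ (≤-trans (+-monoʳ-≤ (card B) (card-positive C 1≤vC))
        (≤-trans cards (≤-reflexive (+-comm 1 fuel))))
      cardC : card C ≤ fuel
      cardC = +-cancelˡ-≤ 1 _ _ (≤-trans (+-monoˡ-≤ (card C) (card-positive B 1≤vB)) cards)
      volB : vol B < 2 ^ lev
      volB = *-cancelˡ-< 2 _ _ (≤-<-trans half vol<)
      volC : vol C < 2 ^ suc lev
      volC = ≤-<-trans (≤-trans (m≤n+m (vol C) (vol B)) (≤-reflexive (sym (vol-split u S)))) vol<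
      Goal = ∃[ v ] (v ⊑ u × 1 ≤ vol v × Dense 0 v × Expander v)
      lift : ∀ {w} → w ⊑ u → ∃[ v ] (v ⊑ w × 1 ≤ vol v × Dense 0 v × Expander v) → Goal
      lift w⊑u (v , v⊑w , rest) = v , (λ x eq → w⊑u x (v⊑w x eq)) , rest
      result : Goal
      result with vol C * (h + suc lev) ≤? e C C * (4 * h)
      ... | yes denseC = lift (λ x → ∧-trueˡ) (extract fuel (suc lev) C cardC volC 1≤vC denseC)
      ... | no ¬denseC = lift (λ x → ∧-trueˡ)
              (extract fuel lev B cardB volB 1≤vB (one-side-dense lev u S dense (<⇒≤ sparse) ¬denseC))

-- The number of steps needed for geometric decay

bernoulli : ∀ g m → g ^ suc m + suc m * g ^ m ≤ suc g ^ suc m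
bernoulli g zero = ≤-reflexive (lem g)
  where
  lem : ∀ g → g * 1 + 1 ≡ (1 + g) * 1
  lem = solve-∀
bernoulli g (suc m) = begin
  g * g ^ suc m + suc (suc m) * g ^ suc m
    ≤⟨ m≤m+n _ (suc m * g ^ m) ⟩
  g * g ^ suc m + suc (suc m) * (g * g ^ m) + suc m * g ^ m
    ≡⟨ lem g (suc m) (g ^ m) ⟩
  suc g * (g ^ suc m + suc m * g ^ m)
    ≤⟨ *-monoʳ-≤ (suc g) (bernoulli g m) ⟩
  suc g * suc g ^ suc m ∎
  where
  open ≤-Reasoning
  lem : ∀ g m p → g * (g * p) + (1 + m) * (g * p) + m * p ≡ (1 + g) * (g * p + m * p)
  lem = solve-∀

halving : ∀ g → g ^ suc g * 2 ≤ suc g ^ suc g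
halving g = ≤-trans (≤-trans (≤-reflexive (lem (g ^ suc g))) (+-monoʳ-≤ (g ^ suc g) (m≤n+m (g * g ^ g) (g ^ g)))) (bernoulli g g)
  where
  lem : ∀ a → a * 2 ≡ a + a
  lem = solve-∀

-- By `halving`, each block of g + 1 steps gains a factor 2, and j blocks fit into k steps; the
-- surplus steps o cannot increase the ratio g / (g + 1) to their power.
fast-decay : ∀ g j k → suc g * j ≤ k → g ^ k * 2 ^ j ≤ suc g ^ k
fast-decay g j k le with m≤n⇒∃[o]m+o≡n le
... | o , refl = begin
  g ^ (G * j + o) * 2 ^ j             ≡⟨ cong (_* 2 ^ j) (^-distribˡ-+-* g (G * j) o) ⟩
  g ^ (G * j) * g ^ o * 2 ^ j         ≡⟨ lem (g ^ (G * j)) (g ^ o) (2 ^ j) ⟩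
  g ^ (G * j) * 2 ^ j * g ^ o         ≡⟨ cong (λ z → z * 2 ^ j * g ^ o) (^-*-assoc g G j) ⟨
  (g ^ G) ^ j * 2 ^ j * g ^ o         ≡⟨ cong (_* g ^ o) (^-distribʳ-* j (g ^ G) 2) ⟨
  (g ^ G * 2) ^ j * g ^ o             ≤⟨ *-mono-≤ (^-monoˡ-≤ j (halving g)) (^-monoˡ-≤ o (n≤1+n g)) ⟩
  (G ^ G) ^ j * G ^ o                 ≡⟨ cong (_* G ^ o) (^-*-assoc G G j) ⟩
  G ^ (G * j) * G ^ o                 ≡⟨ ^-distribˡ-+-* G (G * j) o ⟨
  G ^ (G * j + o)                     ∎
  where
  open ≤-Reasoning
  G = suc g
  lem : ∀ a b c → a * b * c ≡ a * c * b
  lem = solve-∀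

-- Loop erasure

module LoopErasure {X : Set} (_≟_ : (x y : X) → Dec (x ≡ y)) (R : X → X → Set) (t : X) where

  data Steps : X → List X → Set where
    stop : Steps t []
    _∷_  : ∀ {x z zs} → x ≡ z ⊎ R x z → Steps z zs → Steps x (z ∷ zs)

  -- The list holds only the interior of a path from x to t, matching the inner vertices of a
  -- subdivided edge; an empty list is a direct edge.
  data Chain : X → List X → Set where
    last : ∀ {x} → R x t → Chain x []
    _∷_  : ∀ {x y ps} → R x y → Chain y ps → Chain x (y ∷ ps)

  data Distinct : List X → Set where
    []  : Distinct []
    _∷_ : ∀ {x xs} → x ∉ xs → Distinct xs → Distinct (x ∷ xs)

  record SimplePath (x : X) (zs : List X) : Set where
    field
      ps       : List X
      chain    : Chain x ps
      distinct : Distinct (x ∷ ps)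
      t∉ps     : t ∉ ps
      ps⊆zs    : ∀ {y} → y ∈ ps → y ∈ zs
      short    : length ps ≤ length zs

  suffix : ∀ {x y ps} → Chain y ps → Distinct ps → t ∉ ps → x ∈ ps → SimplePath x ps
  suffix {x} {y} {p ∷ ps} (_ ∷ c) (p∉ ∷ ds) t∉ (here refl) = record
    { ps = ps ; chain = c ; distinct = p∉ ∷ ds ; t∉ps = t∉ ∘ there ; ps⊆zs = there ; short = n≤1+n _ }
  suffix (_ ∷ c) (p∉ ∷ ds) t∉ (there x∈) = record
    { ps = ps ; chain = chain ; distinct = distinct ; t∉ps = t∉ps ; ps⊆zs = there ∘ ps⊆zs ; short = m≤n⇒m≤1+n short }
    where open SimplePath (suffix c ds (t∉ ∘ there) x∈)

  -- The tail is made simple first. If x occurs on the simple path from z, everything up to that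
  -- occurrence is dropped by `suffix`; a walk is cut at its first visit to t. Only vertices of the
  -- walk are used, so its properties pass to the path.
  loop-erase : ∀ x zs → Steps x zs → x ≢ t → SimplePath x zs
  loop-erase x [] stop x≢t = ⊥-elim (x≢t refl)
  loop-erase x (z ∷ zs) (r ∷ steps) x≢t with x ≟ z | z ≟ t
  ... | yes refl | _ = record
    { ps = ps ; chain = chain ; distinct = distinct ; t∉ps = t∉ps ; ps⊆zs = there ∘ ps⊆zs ; short = m≤n⇒m≤1+n short }
    where open SimplePath (loop-erase x zs steps x≢t)
  loop-erase x (z ∷ zs) (inj₁ x≡z ∷ steps) x≢t | no x≢z | _ = ⊥-elim (x≢z x≡z)
  loop-erase x (z ∷ zs) (inj₂ r ∷ steps) x≢t | no x≢z | yes refl = record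
    { ps = [] ; chain = last r ; distinct = (λ ()) ∷ [] ; t∉ps = λ () ; ps⊆zs = λ () ; short = z≤n }
  loop-erase x (z ∷ zs) (inj₂ r ∷ steps) x≢t | no x≢z | no z≢t = extend (loop-erase z zs steps z≢t)
    where
    extend : SimplePath z zs → SimplePath x (z ∷ zs)
    extend p with ∈? _≟_ x (SimplePath.ps p) | SimplePath.distinct p
    ... | yes x∈ | _ ∷ ds = record
      { ps = q.ps ; chain = q.chain ; distinct = q.distinct ; t∉ps = q.t∉ps
      ; ps⊆zs = there ∘ SimplePath.ps⊆zs p ∘ q.ps⊆zs ; short = m≤n⇒m≤1+n (≤-trans q.short (SimplePath.short p)) }
      where module q = SimplePath (suffix (SimplePath.chain p) ds (SimplePath.t∉ps p) x∈)
    ... | no x∉ | ds = record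
      { ps = z ∷ SimplePath.ps p ; chain = r ∷ SimplePath.chain p
      ; distinct = (λ { (here eq) → x≢z eq ; (there x∈) → x∉ x∈ }) ∷ ds
      ; t∉ps = λ { (here eq) → z≢t (sym eq) ; (there t∈) → SimplePath.t∉ps p t∈ }
      ; ps⊆zs = λ { (here eq) → here eq ; (there y∈) → there (SimplePath.ps⊆zs p y∈) }
      ; short = s≤s (SimplePath.short p) }

  chain-first : ∀ {x ps} → Chain x ps → ∀ k → toℕ k ≡ 0 → R x (lookup ps k)
  chain-first (r ∷ _) zero _ = r

  chain-last : ∀ {x ps} → Chain x ps → ∀ k → suc (toℕ k) ≡ length ps → R (lookup ps k) t
  chain-last (_ ∷ last r) zero _ = r
  chain-last (_ ∷ c) (suc k) eq = chain-last c k (suc-injective eq)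

  chain-next : ∀ {x ps} → Chain x ps → ∀ k k′ → toℕ k′ ≡ suc (toℕ k) → R (lookup ps k) (lookup ps k′)
  chain-next (_ ∷ c) zero    (suc k′) eq = chain-first c k′ (suc-injective eq)
  chain-next (_ ∷ c) (suc k) (suc k′) eq = chain-next c k k′ (suc-injective eq)

  chain-direct : ∀ {x ps} → Chain x ps → length ps ≡ 0 → R x t
  chain-direct (last r) _ = r

  lookup-injective : ∀ {ps} → Distinct ps → ∀ k k′ → lookup ps k ≡ lookup ps k′ → k ≡ k′
  lookup-injective (_ ∷ _)  zero    zero     _  = refl
  lookup-injective {p ∷ ps} (p∉ ∷ _) zero    (suc k′) eq = ⊥-elim (p∉ (subst (_∈ ps) (sym eq) (∈-lookup k′)))
  lookup-injective {p ∷ ps} (p∉ ∷ _) (suc k) zero     eq = ⊥-elim (p∉ (subst (_∈ ps) eq (∈-lookup k)))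
  lookup-injective (_ ∷ ds) (suc k) (suc k′) eq = cong suc (lookup-injective ds k k′ eq)

-- Clean paths between two points of an expanding set

true-or-false : ∀ b → b ≡ true ⊎ b ≡ false
true-or-false true  = inj₁ refl
true-or-false false = inj₂ refl

module ExpanderPaths
  {N : ℕ} (A : Fin N → Fin N → ℕ) (A-sym : ∀ x y → A x y ≡ A y x)
  (d : Fin N → ℕ) (rowsum : ∀ x → ∑ (A x) ≤ d x)
  (v : Fin N → Bool)
  (h : ℕ) (1≤h : 1 ≤ h)
  (vol< : Extraction.vol A A-sym d v < 2 ^ h)
  (expander : Extraction.Expander A A-sym d h v)
  (a : Fin N → ℕ) (M : ℕ) (1≤M : 1 ≤ M)
  (a-inverse : ∀ x → v x ≡ true → 2 * (a x * d x) ≡ M)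
  where

  open Extraction A A-sym d using (vol; e)

  deg : Fin N → ℕ
  deg x = ∑ λ y → ⟦ v y ⟧ * A x y

  deg≤d : ∀ x → deg x ≤ d x
  deg≤d x = ≤-trans (∑-mono λ y → ≤-trans (*-monoˡ-≤ (A x y) (⟦⟧≤1 (v y))) (≤-reflexive (*-identityˡ (A x y)))) (rowsum x)

  loop : Fin N → ℕ
  loop x = ⟦ v x ⟧ * (d x ∸ deg x)

  -- Edges leaving v are replaced by loops, so that the stationary measure is d restricted to v.
  w : Fin N → Fin N → ℕ
  w x y = ⟦ v x ⟧ * (⟦ v y ⟧ * A x y) + δ x y * loop y

  w-sym : ∀ x y → w x y ≡ w y x
  w-sym x y = cong₂ _+_
    (trans (swap* ⟦ v x ⟧ ⟦ v y ⟧ (A x y)) (cong (λ z → ⟦ v y ⟧ * (⟦ v x ⟧ * z)) (A-sym x y)))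
    (trans (δ-subst x y loop) (cong (_* loop x) (δ-sym x y)))

  open Weighted w w-sym

  π-eq : ∀ x → π x ≡ ⟦ v x ⟧ * d x
  π-eq x = begin
    ∑ (w x)
      ≡⟨ ∑-+ (λ y → ⟦ v x ⟧ * (⟦ v y ⟧ * A x y)) (λ y → δ x y * loop y) ⟩
    ∑ (λ y → ⟦ v x ⟧ * (⟦ v y ⟧ * A x y)) + ∑ (λ y → δ x y * loop y)
      ≡⟨ cong₂ _+_ (∑-*ˡ ⟦ v x ⟧ (λ y → ⟦ v y ⟧ * A x y)) (∑-δ x loop) ⟩
    ⟦ v x ⟧ * deg x + ⟦ v x ⟧ * (d x ∸ deg x)
      ≡⟨ *-distribˡ-+ ⟦ v x ⟧ (deg x) (d x ∸ deg x) ⟨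
    ⟦ v x ⟧ * (deg x + (d x ∸ deg x))
      ≡⟨ cong (⟦ v x ⟧ *_) (m+[n∸m]≡n (deg≤d x)) ⟩
    ⟦ v x ⟧ * d x ∎
    where open ≡-Reasoning

  W≡vol : W ≡ vol v
  W≡vol = ∑-cong π-eq

  π-true : ∀ {x} → v x ≡ true → π x ≡ d x
  π-true {x} eq = trans (π-eq x) (trans (cong (λ b → ⟦ b ⟧ * d x) eq) (*-identityˡ (d x)))

  π-false : ∀ {x} → v x ≡ false → π x ≡ 0
  π-false {x} eq = trans (π-eq x) (cong (λ b → ⟦ b ⟧ * d x) eq)

  balanced : ∀ x → 2 * (a x * π x) ≡ M ⊎ π x ≡ 0
  balanced x with true-or-false (v x)
  ... | inj₁ eq = inj₁ (trans (cong (λ z → 2 * (a x * z)) (π-true eq)) (a-inverse x eq))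
  ... | inj₂ eq = inj₂ (π-false eq)

  open LazyWalk w w-sym a M balanced

  ∫≡vol : ∀ S → ∫ (⟦_⟧ ∘ S) ≡ vol (v ∩ S)
  ∫≡vol S = trans (∫-def _) (∑-cong λ x → trans (cong (_* ⟦ S x ⟧) (π-eq x))
    (trans (lem ⟦ v x ⟧ (d x) ⟦ S x ⟧) (cong (_* d x) (sym (⟦∧⟧ (v x) (S x))))))
    where
    lem : ∀ v d s → v * d * s ≡ v * s * d
    lem = solve-∀

  e≤cut : ∀ S → e (v ∩ S) (v ∖ S) ≤ cut S
  e≤cut S = ≤-trans (∑-mono λ x → ∑-mono λ y → entry x y) (≤-reflexive (sym (∬-def _)))
    where
    lem : ∀ v s v′ s′ A → v * s * (v′ * s′ * A) ≡ v * (v′ * A) * (s * s′)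
    lem = solve-∀
    entry : ∀ x y → ⟦ (v ∩ S) x ⟧ * (⟦ (v ∖ S) y ⟧ * A x y) ≤ w x y * (⟦ S x ⟧ * ⟦ not (S y) ⟧)
    entry x y = ≤-trans (≤-reflexive (trans
        (cong₂ (λ m n → m * (n * A x y)) (⟦∧⟧ (v x) (S x)) (⟦∧⟧ (v y) (not (S y))))
        (lem ⟦ v x ⟧ ⟦ S x ⟧ ⟦ v y ⟧ ⟦ not (S y) ⟧ (A x y))))
      (*-monoˡ-≤ (⟦ S x ⟧ * ⟦ not (S y) ⟧) (m≤m+n (⟦ v x ⟧ * (⟦ v y ⟧ * A x y)) (δ x y * loop y)))

  q : ℕ
  q = 8 * h

  expanding : Expanding q
  expanding S half = ≤-trans (≤-reflexive (∫≡vol S))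
    (≤-trans (expander S (subst₂ (λ m n → 2 * m ≤ n) (∫≡vol S) W≡vol half)) (*-monoʳ-≤ q (e≤cut S)))

  g : ℕ
  g = pred (4 * (q * q))

  g-def : 4 * (q * q) ≡ suc g
  g-def = sym (suc-pred (4 * (q * q)) {{>-nonZero (*-mono-≤ {1} {4} (s≤s z≤n) (*-mono-≤ 1≤q 1≤q))}})
    where
    1≤q : 1 ≤ q
    1≤q = *-mono-≤ {1} {8} (s≤s z≤n) 1≤h

  -- There are 2 + 2 h halvings, as 4 W² ≤ 2 ^ (2 + 2 h), and by `fast-decay` each of them takes 4
  -- q² steps.
  mixingTime : ℕ
  mixingTime = 4 * (q * q) * (2 + 2 * h)

  fast : ∀ k → mixingTime ≤ k → g ^ k * (4 * (W * W)) ≤ suc g ^ k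
  fast k le = ≤-trans (*-monoʳ-≤ (g ^ k) 4W²≤)
    (fast-decay g (2 + 2 * h) k (subst (λ G → G * (2 + 2 * h) ≤ k) g-def le))
    where
    W≤ : W ≤ 2 ^ h
    W≤ = ≤-trans (≤-reflexive W≡vol) (<⇒≤ vol<)
    lem : ∀ a b → 4 * (a * b) ≡ 2 * (2 * (a * b))
    lem = solve-∀
    4W²≤ : 4 * (W * W) ≤ 2 ^ (2 + 2 * h)
    4W²≤ = ≤-trans (*-monoʳ-≤ 4 (*-mono-≤ W≤ W≤)) (≤-reflexive (trans (lem (2 ^ h) (2 ^ h))
      (cong (λ z → 2 * (2 * z)) (trans (sym (^-distribˡ-+-* 2 h h)) (cong (λ z → 2 ^ (h + z)) (sym (+-identityʳ h)))))))

  lower : ∀ k → mixingTime ≤ k → ∀ x y → 1 ≤ π x → 1 ≤ π y → M ^ k * π y ≤ 2 * (W * P k x y)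
  lower k le = Mixing.P-lower {q} {g} expanding g-def k (fast k le)

  upper : ∀ k → mixingTime ≤ k → ∀ x y → 1 ≤ π x → 1 ≤ π y → 2 * (W * P k x y) ≤ 3 * (M ^ k * π y)
  upper k le = Mixing.P-upper {q} {g} expanding g-def k (fast k le)

  -- Moves inside v weigh no more than in the whole graph. The loop and the laziness together weigh
  -- at most 2 d x, and they contribute the term D * s x. Since probabilities are relative to `d`, a
  -- hypothesis about all of A suffices and the degrees inside v do not enter.
  step-bound : ∀ D b (s : Fin N → ℕ) → (∀ x → v x ≡ true → D * ∑ (λ z → A x z * s z) ≤ b * d x) →
    ∀ x → D * step s x ≤ M * (D * s x + b)
  step-bound D b s hit x with true-or-false (v x)
  ... | inj₂ eq = ≤-trans (≤-reflexive (cong (D *_) zero-step)) (≤-trans (≤-reflexive (*-zeroʳ D)) z≤n)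
    where
    zero-step : step s x ≡ 0
    zero-step = ∑-≡0 λ z → cong (_* s z) (trans (cong₂ (λ m n → a x * (m + δ x z * n)) (w≡0 (π-false eq) z) (π-false eq))
      (trans (cong (a x *_) (*-zeroʳ (δ x z))) (*-zeroʳ (a x))))
  ... | inj₁ eq = begin
    D * step s x
      ≡⟨ cong (D *_) (trans (∑-cong λ z → *-assoc (a x) _ (s z)) (∑-*ˡ (a x) (λ z → (w x z + δ x z * π x) * s z))) ⟩
    D * (a x * ∑ (λ z → (w x z + δ x z * π x) * s z))
      ≤⟨ *-monoʳ-≤ D (*-monoʳ-≤ (a x) bound) ⟩
    D * (a x * (∑ (λ z → A x z * s z) + 2 * d x * s x))
      ≡⟨ lem₁ D (a x) (∑ (λ z → A x z * s z)) (d x) (s x) ⟩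
    a x * (D * ∑ (λ z → A x z * s z)) + 2 * (a x * d x) * (D * s x)
      ≤⟨ +-monoˡ-≤ (2 * (a x * d x) * (D * s x)) (*-monoʳ-≤ (a x) (hit x eq)) ⟩
    a x * (b * d x) + 2 * (a x * d x) * (D * s x)
      -- This term is half of `M * b`; it is doubled so that M need not be divided by 2.
      ≤⟨ m≤m+n _ (a x * (b * d x)) ⟩
    a x * (b * d x) + 2 * (a x * d x) * (D * s x) + a x * (b * d x)
      ≡⟨ lem₂ (a x) b (d x) (D * s x) ⟩
    2 * (a x * d x) * (D * s x + b)
      ≡⟨ cong (_* (D * s x + b)) (a-inverse x eq) ⟩
    M * (D * s x + b) ∎
    where
    open ≤-Reasoning
    lem₁ : ∀ D a S d s → D * (a * (S + 2 * d * s)) ≡ a * (D * S) + 2 * (a * d) * (D * s)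
    lem₁ = solve-∀
    lem₂ : ∀ a b d s → a * (b * d) + 2 * (a * d) * s + a * (b * d) ≡ 2 * (a * d) * (s + b)
    lem₂ = solve-∀
    lem₃ : ∀ e δ l p s → (e + δ * l + δ * p) * s ≡ e * s + δ * ((l + p) * s)
    lem₃ = solve-∀
    w≤A : ∀ z → ⟦ v x ⟧ * (⟦ v z ⟧ * A x z) ≤ A x z
    w≤A z = ≤-trans (*-mono-≤ (⟦⟧≤1 (v x)) (*-monoˡ-≤ (A x z) (⟦⟧≤1 (v z)))) (≤-reflexive (trans (*-identityˡ _) (*-identityˡ _)))
    loop≤d : loop x ≤ d x
    loop≤d = ≤-trans (*-mono-≤ (⟦⟧≤1 (v x)) (m∸n≤m (d x) (deg x))) (≤-reflexive (*-identityˡ (d x)))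
    bound : ∑ (λ z → (w x z + δ x z * π x) * s z) ≤ ∑ (λ z → A x z * s z) + 2 * d x * s x
    bound = begin
      ∑ (λ z → (w x z + δ x z * π x) * s z)
        ≡⟨ ∑-cong (λ z → lem₃ (⟦ v x ⟧ * (⟦ v z ⟧ * A x z)) (δ x z) (loop z) (π x) (s z)) ⟩
      ∑ (λ z → ⟦ v x ⟧ * (⟦ v z ⟧ * A x z) * s z + δ x z * ((loop z + π x) * s z))
        ≡⟨ ∑-+ (λ z → ⟦ v x ⟧ * (⟦ v z ⟧ * A x z) * s z) (λ z → δ x z * ((loop z + π x) * s z)) ⟩
      ∑ (λ z → ⟦ v x ⟧ * (⟦ v z ⟧ * A x z) * s z) + ∑ (λ z → δ x z * ((loop z + π x) * s z))
        ≤⟨ +-mono-≤ (∑-mono λ z → *-monoˡ-≤ (s z) (w≤A z))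
             (≤-trans (≤-reflexive (∑-δ x (λ z → (loop z + π x) * s z)))
               (*-monoˡ-≤ (s x) (+-mono-≤ loop≤d (≤-reflexive (trans (π-true eq) (sym (+-identityʳ (d x)))))))) ⟩
      ∑ (λ z → A x z * s z) + 2 * d x * s x ∎

  module _
    (τ : ℕ) (mixed : mixingTime ≤ τ)
    (D b : ℕ) (enough : (3 * τ + 3 * τ * (3 * τ)) * (3 * (3 * τ * b)) < D)
    (1≤d : ∀ x → v x ≡ true → 1 ≤ d x)
    (forb : Fin N → Bool) (conf : Fin N → Fin N → Bool)
    (conf-sym : ∀ x y → conf x y ≡ conf y x) (conf-diag : ∀ x → conf x x ≡ false)
    (hit-forb : ∀ x → v x ≡ true → D * ∑ (λ z → A x z * ⟦ forb z ⟧) ≤ b * d x)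
    (hit-conf : ∀ u x → v x ≡ true → D * ∑ (λ z → A x z * ⟦ conf u z ⟧) ≤ b * d x)
    (S T : Fin N) (vS : v S ≡ true) (vT : v T ≡ true)
    (forbS : forb S ≡ false) (forbT : forb T ≡ false) (confST : conf S T ≡ false)
    where

    -- Restricted to v, as is `c` below, because the mixing estimates hold only at points of
    -- positive stationary weight.
    s : Fin N → ℕ
    s y = ⟦ v y ⟧ * ⟦ forb y ⟧

    c : Fin N → Fin N → ℕ
    c x y = ⟦ v x ⟧ * (⟦ v y ⟧ * ⟦ conf x y ⟧)

    π≥1 : ∀ {x} → v x ≡ true → 1 ≤ π x
    π≥1 {x} eq = ≤-trans (1≤d x eq) (≤-reflexive (sym (π-true eq)))

    hit-mono : ∀ (f f′ : Fin N → ℕ) → (∀ z → f z ≤ f′ z) → ∀ x → D * ∑ (λ z → A x z * f′ z) ≤ b * d x →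
      D * ∑ (λ z → A x z * f z) ≤ b * d x
    hit-mono f f′ f≤ x = ≤-trans (*-monoʳ-≤ D (∑-monoʳ (A x) f≤))

    few : 𝔼visits T s (3 * τ) S + 𝔼conflicts T c (3 * τ) S < P (3 * τ) S T
    few = Connect.few-bad w w-sym a M balanced 1≤M τ (λ k le → lower k (≤-trans mixed le)) (λ k le → upper k (≤-trans mixed le)) D b s c
      s-supp c-supp c-sym c-diag
      (step-bound D b s λ x eq → hit-mono s _ (λ z → ≤-trans (*-monoˡ-≤ _ (⟦⟧≤1 (v z))) (≤-reflexive (*-identityˡ _))) x (hit-forb x eq))
      (λ u → step-bound D b (c u) λ x eq → hit-mono (c u) _ (λ z →
        ≤-trans (*-mono-≤ (⟦⟧≤1 (v u)) (*-monoˡ-≤ _ (⟦⟧≤1 (v z)))) (≤-reflexive (trans (*-identityˡ _) (*-identityˡ _)))) x (hit-conf u x eq))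
      S T (π≥1 vS) (π≥1 vT)
      (vanish forbS) (vanish forbT) (vanish₂ confST) enough
      where
      vanish : ∀ {x} → forb x ≡ false → s x ≡ 0
      vanish {x} eq = trans (cong (λ b → ⟦ v x ⟧ * ⟦ b ⟧) eq) (*-zeroʳ ⟦ v x ⟧)
      vanish₂ : ∀ {x y} → conf x y ≡ false → c x y ≡ 0
      vanish₂ {x} {y} eq = trans (cong (λ b → ⟦ v x ⟧ * (⟦ v y ⟧ * ⟦ b ⟧)) eq)
        (trans (cong (⟦ v x ⟧ *_) (*-zeroʳ ⟦ v y ⟧)) (*-zeroʳ ⟦ v x ⟧))
      s-supp : ∀ y → s y ≡ 0 ⊎ 1 ≤ π y
      s-supp y with true-or-false (v y)
      ... | inj₁ eq = inj₂ (π≥1 eq)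
      ... | inj₂ eq = inj₁ (cong (λ b → ⟦ b ⟧ * ⟦ forb y ⟧) eq)
      c-supp : ∀ x y → c x y ≡ 0 ⊎ (1 ≤ π x × 1 ≤ π y)
      c-supp x y with true-or-false (v x) | true-or-false (v y)
      ... | inj₁ eq | inj₁ eq′ = inj₂ (π≥1 eq , π≥1 eq′)
      ... | inj₁ _  | inj₂ eq  = inj₁ (trans (cong (λ b → ⟦ v x ⟧ * (⟦ b ⟧ * ⟦ conf x y ⟧)) eq) (*-zeroʳ ⟦ v x ⟧))
      ... | inj₂ eq | _        = inj₁ (cong (λ b → ⟦ b ⟧ * (⟦ v y ⟧ * ⟦ conf x y ⟧)) eq)
      c-sym : ∀ x y → c x y ≡ c y x
      c-sym x y = trans (swap* ⟦ v x ⟧ ⟦ v y ⟧ _) (cong (λ b → ⟦ v y ⟧ * (⟦ v x ⟧ * ⟦ b ⟧)) (conf-sym x y))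
      c-diag : ∀ x → c x x ≡ 0
      c-diag x = vanish₂ (conf-diag x)

    open LoopErasure Finₚ._≟_ (λ x y → 1 ≤ A x y) T

    κ-step : ∀ {x z} → 1 ≤ κ x z → v x ≡ true → v z ≡ true × (x ≡ z ⊎ 1 ≤ A x z)
    κ-step {x} {z} pos vx with x Finₚ.≟ z
    ... | yes refl = vx , inj₁ refl
    ... | no _ = edge (v z) refl (≤-trans pos (≤-reflexive (cong (a x *_)
        (trans (+-identityʳ _) (trans (+-identityʳ _) (cong (λ b → ⟦ b ⟧ * (⟦ v z ⟧ * A x z)) vx))))))
      where
      edge : ∀ vz → v z ≡ vz → 1 ≤ a x * (1 * (⟦ vz ⟧ * A x z)) → v z ≡ true × (x ≡ z ⊎ 1 ≤ A x z)
      edge false _ p rewrite *-zeroʳ (a x) with p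
      ... | ()
      edge true eq p = eq , inj₂ (factor (a x) (≤-trans p (≤-reflexive (cong (a x *_) (trans (+-identityʳ _) (+-identityʳ _))))))
        where
        factor : ∀ m {n} → 1 ≤ m * n → 1 ≤ n
        factor m {zero}  le = ≤-trans le (≤-reflexive (*-zeroʳ m))
        factor m {suc n} le = s≤s z≤n

    walk-steps : ∀ x zs → v x ≡ true → IsWalk x zs → endδ T x zs ≢ 0 → Steps x zs × (∀ {y} → y ∈ zs → v y ≡ true)
    walk-steps x [] vx [] ends with x Finₚ.≟ T
    ... | yes refl = stop , λ ()
    ... | no _ = ⊥-elim (ends refl)
    walk-steps x (z ∷ zs) vx (pos ∷ walk) ends with κ-step pos vx
    ... | vz , r with walk-steps z zs vz walk ends
    ...   | steps , vzs = r ∷ steps , λ { (here refl) → vz ; (there y∈) → vzs y∈ }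

    ⟦⟧≡0 : ∀ {b} → ⟦ b ⟧ ≡ 0 → b ≡ false
    ⟦⟧≡0 {false} _ = refl

    1*1*≡0 : ∀ {b b′ n} → b ≡ true → b′ ≡ true → ⟦ b ⟧ * (⟦ b′ ⟧ * n) ≡ 0 → n ≡ 0
    1*1*≡0 refl refl eq = trans (sym (trans (+-identityʳ _) (+-identityʳ _))) eq

    visits≡0 : ∀ f zs → visits T f zs ≡ 0 → ∀ {y} → y ∈ zs → f y ≡ 0
    visits≡0 f (z ∷ zs) eq (here refl) = m+n≡0⇒m≡0 (f z) eq
    visits≡0 f (z ∷ zs) eq (there y∈) = visits≡0 f zs (m+n≡0⇒n≡0 (f z) eq) y∈

    conflicts≡0 : ∀ x zs → conflicts T c x zs ≡ 0 → (∀ {y} → y ∈ (x ∷ zs) → v y ≡ true) →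
      ∀ {y z} → y ∈ (x ∷ zs) → z ∈ (x ∷ zs) → conf y z ≡ false
    conflicts≡0 x zs eq vs (here refl) (here refl) = conf-diag x
    conflicts≡0 x (z ∷ zs) eq vs (here refl) (there z∈) = ⟦⟧≡0 (1*1*≡0 (vs (here refl)) (vs (there z∈))
      (visits≡0 (c x) (z ∷ zs) (m+n≡0⇒m≡0 _ eq) z∈))
    conflicts≡0 x (z ∷ zs) eq vs (there y∈) (here refl) = trans (conf-sym _ x)
      (conflicts≡0 x (z ∷ zs) eq vs (here refl) (there y∈))
    conflicts≡0 x (z ∷ zs) eq vs (there y∈) (there z∈) =
      conflicts≡0 z zs (m+n≡0⇒n≡0 (visits T (c x) (z ∷ zs)) eq) (vs ∘ there) y∈ z∈

    T∈ : ∀ {x zs} → Steps x zs → T ∈ (x ∷ zs)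
    T∈ stop = here refl
    T∈ (_ ∷ steps) = there (T∈ steps)

    record CleanPath : Set where
      field
        ps       : List (Fin N)
        short    : length ps ≤ 3 * τ
        chain    : Chain S ps
        distinct : Distinct ps
        S∉ps     : S ∉ ps
        T∉ps     : T ∉ ps
        inside   : ∀ {y} → y ∈ ps → v y ≡ true
        allowed  : ∀ {y} → y ∈ ps → forb y ≡ false
        disjoint : ∀ {y z} → y ∈ (S ∷ T ∷ ps) → z ∈ (S ∷ T ∷ ps) → conf y z ≡ false

    opaque
      clean-path : S ≢ T → CleanPath
      clean-path S≢T = from-walk (clean-walk T s c (3 * τ) S few)
        where
        1*≡0 : ∀ {b n} → b ≡ true → ⟦ b ⟧ * n ≡ 0 → n ≡ 0
        1*≡0 refl eq = trans (sym (+-identityʳ _)) eq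
        from-walk : ∃[ zs ] (length zs ≡ 3 * τ × IsWalk S zs × endδ T S zs ≢ 0 × visits T s zs ≡ 0 × conflicts T c S zs ≡ 0) →
          CleanPath
        from-walk (zs , len , walk , ends , visit0 , conf0) = from-steps (walk-steps S zs vS walk ends)
          where
          from-steps : Steps S zs × (∀ {y} → y ∈ zs → v y ≡ true) → CleanPath
          from-steps (steps , vzs) = from-simple (loop-erase S zs steps S≢T)
            where
            all-v : ∀ {y} → y ∈ (S ∷ zs) → v y ≡ true
            all-v (here refl) = vS
            all-v (there y∈) = vzs y∈
            from-simple : SimplePath S zs → CleanPath
            from-simple record { ps = ps ; chain = chain ; distinct = S∉ ∷ ds ; t∉ps = t∉ ; ps⊆zs = ps⊆zs ; short = short } = record
              { ps = ps
              ; short = ≤-trans short (≤-reflexive len)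
              ; chain = chain
              ; distinct = ds
              ; S∉ps = S∉
              ; T∉ps = t∉
              ; inside = λ y∈ → vzs (ps⊆zs y∈)
              ; allowed = λ {y} y∈ → ⟦⟧≡0 (1*≡0 {v y} {⟦ forb y ⟧} (vzs (ps⊆zs y∈)) (visits≡0 s zs visit0 (ps⊆zs y∈)))
              ; disjoint = λ y∈ z∈ → conflicts≡0 S zs conf0 all-v (onWalk y∈) (onWalk z∈)
              }
              where
              onWalk : ∀ {y} → y ∈ (S ∷ T ∷ ps) → y ∈ (S ∷ zs)
              onWalk (here refl) = here refl
              onWalk (there (here refl)) = T∈ steps
              onWalk (there (there y∈)) = there (ps⊆zs y∈)

-- Sums over r-tuples

∏ : ∀ {r} → (Fin r → ℕ) → ℕ
∏ = Product.sum

∏-cong : ∀ {r} {f g : Fin r → ℕ} → (∀ i → f i ≡ g i) → ∏ f ≡ ∏ g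
∏-cong = Product.sum-cong-≗

∏-comm : ∀ {r s} (f : Fin r → Fin s → ℕ) → ∏ (λ i → ∏ (f i)) ≡ ∏ (λ j → ∏ λ i → f i j)
∏-comm = Product.∑-comm

∏-≤1 : ∀ {r} (f : Fin r → ℕ) → (∀ i → f i ≤ 1) → ∏ f ≤ 1
∏-≤1 {zero}  f f≤ = ≤-refl
∏-≤1 {suc r} f f≤ = *-mono-≤ (f≤ zero) (∏-≤1 (f ∘ suc) (f≤ ∘ suc))

∏-positive : ∀ {r} (f : Fin r → ℕ) → 1 ≤ ∏ f → ∀ i → 1 ≤ f i
∏-positive {suc r} f p zero with f zero
... | suc _ = s≤s z≤n
∏-positive {suc r} f p (suc i) = ∏-positive (f ∘ suc) (right (f zero) p) i
  where
  right : ∀ m {k} → 1 ≤ m * k → 1 ≤ k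
  right m {zero}  le = ≤-trans le (≤-reflexive (*-zeroʳ m))
  right m {suc k} le = s≤s z≤n

∑-++ : ∀ m {k} (F : Fin (m + k) → ℕ) → ∑ F ≡ ∑ (λ i → F (i ↑ˡ k)) + ∑ (λ j → F (m ↑ʳ j))
∑-++ zero    F = cong (_+ ∑ F) (sym (∑-zero _))
∑-++ (suc m) {k} F = trans (∑-suc F) (trans (cong (F zero +_) (∑-++ m (F ∘ suc)))
  (trans (sym (+-assoc (F zero) _ _)) (cong (_+ ∑ (λ j → F (suc m ↑ʳ j))) (sym (∑-suc (λ i → F (i ↑ˡ k)))))))

∑-combine : ∀ m {k} (F : Fin (m * k) → ℕ) → ∑ F ≡ ∑ λ (i : Fin m) → ∑ λ (j : Fin k) → F (combine i j)
∑-combine zero {k} F = trans (∑-zero F) (sym (∑-zero λ i → ∑ λ (j : Fin k) → F (combine i j)))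
∑-combine (suc m) {k} F = trans (∑-++ k F)
  (trans (cong (∑ (λ j → F (j ↑ˡ (m * k))) +_) (∑-combine m (λ i → F (k ↑ʳ i)))) (sym (∑-suc {m} λ i → ∑ λ j → F (combine i j))))

tuples : ∀ {n} r → ((Fin r → Fin n) → ℕ) → ℕ
tuples {n} r Φ = ∑ {n ^ r} (Φ ∘ finToFun)

_◂_ : ∀ {n r} → Fin n → (Fin r → Fin n) → Fin (suc r) → Fin n
(v ◂ t) zero    = v
(v ◂ t) (suc i) = t i

-- Decoding a number gives a tuple that agrees with the intended one only entry by entry, so
-- summands must respect pointwise equality.
Extensional : ∀ {n r} → ((Fin r → Fin n) → ℕ) → Set
Extensional Φ = ∀ {s t} → (∀ i → s i ≡ t i) → Φ s ≡ Φ t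

tuples-suc : ∀ {n} r (Φ : (Fin (suc r) → Fin n) → ℕ) → Extensional Φ →
  tuples (suc r) Φ ≡ ∑ λ v → tuples r λ t → Φ (v ◂ t)
tuples-suc {n} r Φ ext = trans (∑-combine n (Φ ∘ finToFun)) (∑-cong λ v → ∑-cong {n ^ r} λ t → ext (decode v t))
  where
  decode : ∀ v t i → finToFun {n} {suc r} (combine v t) i ≡ (v ◂ finToFun t) i
  decode v t zero    = cong proj₁ (Finₚ.remQuot-combine v t)
  decode v t (suc i) = cong (λ p → finToFun (proj₂ p) i) (Finₚ.remQuot-combine v t)

mult : ∀ {n} → List (Fin n) → Fin n → ℕ
mult []       v = 0
mult (x ∷ xs) v = δ x v + mult xs v

mult-∈ : ∀ {n} {X : List (Fin n)} {v} → v ∈ X → 1 ≤ mult X v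
mult-∈ {v = v} (here refl) = ≤-trans (≤-reflexive (sym (δ-refl v))) (m≤m+n _ _)
mult-∈ (there v∈) = ≤-trans (mult-∈ v∈) (m≤n+m _ _)

repeats : ∀ {n r} → (Fin r → Fin n) → ℕ
repeats {r = zero}  t = 0
repeats {r = suc r} t = repeats (t ∘ suc) + ∑ λ j → δ (t (suc j)) (t zero)

repeats-ext : ∀ {n r} → Extensional {n} {r} repeats
repeats-ext {r = zero}  e = refl
repeats-ext {r = suc r} e = cong₂ _+_ (repeats-ext (e ∘ suc)) (∑-cong λ j → cong₂ δ (e (suc j)) (e zero))

repeats-≥1 : ∀ {n r} (t : Fin r → Fin n) {i j} → i ≢ j → t i ≡ t j → 1 ≤ repeats t
repeats-≥1 t {zero}  {zero}  i≢j eq = ⊥-elim (i≢j refl)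
repeats-≥1 t {zero}  {suc j} i≢j eq = ≤-trans (≤-reflexive (sym (trans (cong (λ v → δ v (t zero)) (sym eq)) (δ-refl (t zero)))))
  (≤-trans (term≤∑ (λ j → δ (t (suc j)) (t zero)) j) (m≤n+m _ _))
repeats-≥1 t {suc i} {zero}  i≢j eq = repeats-≥1 t {zero} {suc i} (i≢j ∘ sym) (sym eq)
repeats-≥1 t {suc i} {suc j} i≢j eq = ≤-trans (repeats-≥1 (t ∘ suc) (i≢j ∘ cong suc) eq) (m≤m+n _ _)

module TupleSums {n : ℕ} (f : Fin n → ℕ) where

  F : ℕ
  F = ∑ f

  weight : ∀ {r} → (Fin r → Fin n) → ℕ
  weight t = ∏ (f ∘ t)

  weight-ext : ∀ {r} → Extensional {n} {r} weight
  weight-ext e = ∏-cong (cong f ∘ e)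

  total : ∀ r → tuples r weight ≡ F ^ r
  total zero    = trans (∑-suc _) (cong suc (∑-zero _))
  total (suc r) = trans (tuples-suc r weight weight-ext)
    (trans (∑-cong λ v → trans (∑-*ˡ (f v) (weight ∘ finToFun {n} {r})) (cong (f v *_) (total r))) (∑-*ʳ (F ^ r) f))

  module _ (f≤1 : ∀ v → f v ≤ 1) (D : ℕ) (D≤F : D ≤ F) where

    δ-mass : ∀ u → ∑ (λ v → f v * δ u v) ≤ 1
    δ-mass u = ≤-trans (≤-reflexive (trans (∑-cong λ v → *-comm (f v) (δ u v)) (∑-δ u f))) (f≤1 u)

    mult-mass : ∀ X → ∑ (λ v → f v * mult X v) ≤ length X
    mult-mass []      = ≤-reflexive (∑-≡0 λ v → *-zeroʳ (f v))
    mult-mass (x ∷ X) = ≤-trans (≤-reflexive (trans (∑-cong λ v → *-distribˡ-+ (f v) (δ x v) (mult X v))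
        (∑-+ (λ v → f v * δ x v) (λ v → f v * mult X v)))) (+-mono-≤ (δ-mass x) (mult-mass X))

    -- A union bound: for f the indicator of a set of F ≥ D vertices, the r entries of a random
    -- tuple from it are independent and uniform, and each meets a given vertex with probability at
    -- most 1 / D. The induction splits off the first entry.
    hits-mass : ∀ r X → D * tuples r (λ t → weight t * ∑ (λ i → mult X (t i))) ≤ r * length X * F ^ r
    hits-mass zero X = ≤-reflexive (trans (cong (D *_) (∑-≡0 λ t → cong (weight {0} (finToFun {n} {0} t) *_) (∑-zero (λ i → mult X (finToFun {n} {0} t i))))) (*-zeroʳ D))
    hits-mass (suc r) X = begin
      D * tuples (suc r) (λ t → weight t * ∑ (λ i → mult X (t i)))
        ≡⟨ cong (D *_) (tuples-suc r _ ext) ⟩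
      D * ∑ (λ v → tuples r λ t → f v * weight t * ∑ (λ i → mult X ((v ◂ t) i)))
        ≡⟨ cong (D *_) (trans (∑-cong row) (∑-+ (λ v → F ^ r * (f v * mult X v)) (λ v → f v * H))) ⟩
      D * (∑ (λ v → F ^ r * (f v * mult X v)) + ∑ (λ v → f v * H))
        ≡⟨ cong (D *_) (cong₂ _+_ (∑-*ˡ (F ^ r) (λ v → f v * mult X v)) (∑-*ʳ H f)) ⟩
      D * (F ^ r * ∑ (λ v → f v * mult X v) + F * H)
        ≡⟨ lem₁ D (F ^ r) (∑ (λ v → f v * mult X v)) F H ⟩
      D * (F ^ r * ∑ (λ v → f v * mult X v)) + F * (D * H)
        ≤⟨ +-mono-≤ (*-mono-≤ D≤F (*-monoʳ-≤ (F ^ r) (mult-mass X))) (*-monoʳ-≤ F (hits-mass r X)) ⟩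
      F * (F ^ r * length X) + F * (r * length X * F ^ r)
        ≡⟨ lem₂ F (F ^ r) (length X) r ⟩
      suc r * length X * F ^ suc r ∎
      where
      open ≤-Reasoning
      tup : Fin (n ^ r) → Fin r → Fin n
      tup = finToFun
      wt : Fin (n ^ r) → ℕ
      wt t = weight (tup t)
      H = tuples r (λ t → weight t * ∑ (λ i → mult X (t i)))
      ext : Extensional {n} {suc r} (λ t → weight t * ∑ (λ i → mult X (t i)))
      ext e = cong₂ _*_ (weight-ext e) (∑-cong λ i → cong (mult X) (e i))
      lem₁ : ∀ D p m F H → D * (p * m + F * H) ≡ D * (p * m) + F * (D * H)
      lem₁ = solve-∀
      lem₂ : ∀ F p x r → F * (p * x) + F * (r * x * p) ≡ (1 + r) * x * (F * p)
      lem₂ = solve-∀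
      lem₃ : ∀ f w m h → f * w * (m + h) ≡ f * m * w + f * (w * h)
      lem₃ = solve-∀
      row : ∀ v → tuples r (λ t → f v * weight t * ∑ (λ i → mult X ((v ◂ t) i))) ≡ F ^ r * (f v * mult X v) + f v * H
      row v = begin-equality
        tuples r (λ t → f v * weight t * ∑ (λ i → mult X ((v ◂ t) i)))
          ≡⟨ ∑-cong (λ t → trans (cong (f v * wt t *_) (∑-suc _))
               (lem₃ (f v) (wt t) (mult X v) _)) ⟩
        ∑ {n ^ r} (λ t → f v * mult X v * wt t + f v * (wt t * ∑ (λ i → mult X (tup t i))))
          ≡⟨ ∑-+ {n ^ r} (λ t → f v * mult X v * wt t) (λ t → f v * (wt t * ∑ (λ i → mult X (tup t i)))) ⟩
        ∑ {n ^ r} (λ t → f v * mult X v * wt t) + ∑ {n ^ r} (λ t → f v * (wt t * ∑ (λ i → mult X (tup t i))))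
          ≡⟨ cong₂ _+_ (trans (∑-*ˡ (f v * mult X v) (wt)) (trans (cong (f v * mult X v *_) (total r)) (*-comm _ (F ^ r))))
               (∑-*ˡ (f v) _) ⟩
        F ^ r * (f v * mult X v) + f v * H ∎

    -- A union bound over pairs of entries: once the other entries are fixed, the first one
    -- coincides with each of them with probability at most 1 / D.
    repeats-mass : ∀ r → D * tuples r (λ t → weight t * repeats t) ≤ r * r * F ^ r
    repeats-mass zero = ≤-reflexive (trans (cong (D *_) (∑-≡0 λ t → *-zeroʳ (weight {0} (finToFun {n} {0} t)))) (*-zeroʳ D))
    repeats-mass (suc r) = begin
      D * tuples (suc r) (λ t → weight t * repeats t)
        ≡⟨ cong (D *_) (tuples-suc r _ ext) ⟩
      D * ∑ (λ v → tuples r λ t → f v * weight t * (repeats t + ∑ (λ j → δ (t j) v)))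
        ≡⟨ cong (D *_) (trans (∑-cong row) (∑-+ (λ v → f v * R) (λ v → ∑ {n ^ r} λ t → wt t * ∑ λ j → f v * δ (tup t j) v))) ⟩
      D * (∑ (λ v → f v * R) + ∑ (λ v → ∑ {n ^ r} λ t → wt t * ∑ λ j → f v * δ (tup t j) v))
        ≤⟨ *-monoʳ-≤ D (+-mono-≤ (≤-reflexive (∑-*ʳ R f)) collisions) ⟩
      D * (F * R + F ^ r * r)
        ≡⟨ lem₁ D F R (F ^ r * r) ⟩
      F * (D * R) + D * (F ^ r * r)
        ≤⟨ +-mono-≤ (*-monoʳ-≤ F (repeats-mass r)) (*-monoˡ-≤ (F ^ r * r) D≤F) ⟩
      F * (r * r * F ^ r) + F * (F ^ r * r)
        -- The surplus r + 1 completes r² + r to the square of r + 1.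
        ≤⟨ m≤m+n _ (F * F ^ r * suc r) ⟩
      F * (r * r * F ^ r) + F * (F ^ r * r) + F * F ^ r * suc r
        ≡⟨ lem₂ F (F ^ r) r ⟩
      suc r * suc r * F ^ suc r ∎
      where
      open ≤-Reasoning
      tup : Fin (n ^ r) → Fin r → Fin n
      tup = finToFun
      wt : Fin (n ^ r) → ℕ
      wt t = weight (tup t)
      R = tuples r (λ t → weight t * repeats t)
      ext : Extensional {n} {suc r} (λ t → weight t * repeats t)
      ext {s} {t} e = cong₂ _*_ (weight-ext e) (repeats-ext {n} {suc r} {s} {t} e)
      lem₁ : ∀ D F R p → D * (F * R + p) ≡ F * (D * R) + D * p
      lem₁ = solve-∀
      lem₂ : ∀ F p r → F * (r * r * p) + F * (p * r) + F * p * (1 + r) ≡ (1 + r) * (1 + r) * (F * p)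
      lem₂ = solve-∀
      lem₃ : ∀ f w m h → f * w * (m + h) ≡ f * (w * m) + w * (f * h)
      lem₃ = solve-∀
      row : ∀ v → tuples r (λ t → f v * weight t * (repeats t + ∑ (λ j → δ (t j) v)))
        ≡ f v * R + ∑ {n ^ r} (λ t → wt t * ∑ λ j → f v * δ (tup t j) v)
      row v = begin-equality
        tuples r (λ t → f v * weight t * (repeats t + ∑ (λ j → δ (t j) v)))
          ≡⟨ ∑-cong (λ t → trans (lem₃ (f v) (wt t) (repeats (tup t)) _)
               (cong (λ z → f v * (wt t * repeats (tup t)) + wt t * z)
                 (sym (∑-*ˡ (f v) (λ j → δ (tup t j) v))))) ⟩
        ∑ {n ^ r} (λ t → f v * (wt t * repeats (tup t)) + wt t * ∑ λ j → f v * δ (tup t j) v)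
          ≡⟨ trans (∑-+ {n ^ r} (λ t → f v * (wt t * repeats (tup t))) (λ t → wt t * ∑ λ j → f v * δ (tup t j) v))
               (cong (_+ ∑ {n ^ r} (λ t → wt t * ∑ λ j → f v * δ (tup t j) v)) (∑-*ˡ {n ^ r} (f v) (λ t → wt t * repeats (tup t)))) ⟩
        f v * R + ∑ {n ^ r} (λ t → wt t * ∑ λ j → f v * δ (tup t j) v) ∎
      collisions : ∑ (λ v → ∑ {n ^ r} λ t → wt t * ∑ λ j → f v * δ (tup t j) v) ≤ F ^ r * r
      collisions = begin
        ∑ (λ v → ∑ {n ^ r} λ t → wt t * ∑ λ j → f v * δ (tup t j) v)
          ≡⟨ ∑-swap (λ v (t : Fin (n ^ r)) → wt t * ∑ λ j → f v * δ (tup t j) v) ⟩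
        ∑ {n ^ r} (λ t → ∑ λ v → wt t * ∑ λ j → f v * δ (tup t j) v)
          ≡⟨ ∑-cong {n ^ r} (λ t → trans (∑-*ˡ (wt t) (λ v → ∑ λ j → f v * δ (tup t j) v))
               (cong (wt t *_) (∑-swap (λ v j → f v * δ (tup t j) v)))) ⟩
        ∑ {n ^ r} (λ t → wt t * ∑ λ j → ∑ λ v → f v * δ (tup t j) v)
          ≤⟨ ∑-mono {n ^ r} (λ t → *-monoʳ-≤ (wt t) (≤-trans (∑-mono λ j → δ-mass (tup t j))
               (≤-reflexive (trans (∑-const r 1) (*-identityʳ r))))) ⟩
        ∑ {n ^ r} (λ t → wt t * r)
          ≡⟨ trans (∑-*ʳ {n ^ r} r (wt)) (cong (_* r) (total r)) ⟩
        F ^ r * r ∎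

-- Degrees, edges and the power mean inequality

listSum≡∑ : ∀ {n} (f : Fin n → ℕ) → ListAction.sum (map f (allFin n)) ≡ ∑ f
listSum≡∑ {n} f = go n id
  where
  go : ∀ m (g : Fin m → Fin n) → ListAction.sum (map f (tabulate g)) ≡ ∑ (f ∘ g)
  go zero    g = sym (∑-zero _)
  go (suc m) g = trans (cong (f (g zero) +_) (go m (g ∘ suc))) (sym (∑-suc (f ∘ g)))

if≡⟦⟧ : ∀ b → (if b then 1 else 0) ≡ ⟦ b ⟧
if≡⟦⟧ true  = refl
if≡⟦⟧ false = refl

<ᵇ-true : ∀ {a b} → a < b → (a <ᵇ b) ≡ true
<ᵇ-true = Equivalence.to T-≡ ∘ <⇒<ᵇ

<ᵇ-false : ∀ {a b} → ¬ a < b → (a <ᵇ b) ≡ false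
<ᵇ-false {a} {b} ¬lt with true-or-false (a <ᵇ b)
... | inj₁ eq = ⊥-elim (¬lt (<ᵇ⇒< a b (Equivalence.from T-≡ eq)))
... | inj₂ eq = eq

⟦⟧-positive : ∀ b → 1 ≤ ⟦ b ⟧ → Bool.T b
⟦⟧-positive true _ = tt

module Adjacency {n : ℕ} (G : Graph n) where

  α : Fin n → Fin n → ℕ
  α i j = ⟦ adj G i j ⟧

  α-sym : ∀ i j → α i j ≡ α j i
  α-sym i j = cong ⟦_⟧ (Graph.sym G i j)

  degree : Fin n → ℕ
  degree v = ∑ λ u → α u v

  forward : Fin n → Fin n → ℕ
  forward i j = ⟦ (toℕ i <ᵇ toℕ j) ∧ adj G i j ⟧

  α-split : ∀ i j → α i j ≡ forward i j + forward j i
  α-split i j with <-cmp (toℕ i) (toℕ j)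
  ... | tri< i<j _ j≮i rewrite <ᵇ-true i<j | <ᵇ-false j≮i = sym (+-identityʳ _)
  ... | tri> i≮j _ j<i rewrite <ᵇ-true j<i | <ᵇ-false i≮j = α-sym i j
  ... | tri≈ i≮j i≡j j≮i rewrite <ᵇ-false i≮j | <ᵇ-false j≮i | Finₚ.toℕ-injective i≡j = cong ⟦_⟧ (irrefl G j)

  edgeCount≡ : edgeCount G ≡ ∑ λ i → ∑ λ j → forward i j
  edgeCount≡ = trans (listSum≡∑ _) (∑-cong λ i → trans (listSum≡∑ _) (∑-cong λ j → if≡⟦⟧ _))

  handshake : ∑ degree ≡ 2 * edgeCount G
  handshake = trans (∑-cong λ v → trans (∑-cong λ u → trans (α-split u v) (+-comm (forward u v) (forward v u)))
      (∑-+ (λ u → forward v u) (λ u → forward u v)))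
    (trans (∑-+ (λ v → ∑ λ u → forward v u) (λ v → ∑ λ u → forward u v))
    (trans (cong₂ _+_ (sym edgeCount≡) (trans (∑-swap (λ v u → forward u v)) (sym edgeCount≡)))
      (cong (edgeCount G +_) (sym (+-identityʳ _)))))

  -- Power mean inequality; a vertex of degree below e / n contributes too little to matter.
  degree-powers : ∀ r → 1 ≤ n → edgeCount G ^ suc r ≤ n ^ r * ∑ (λ v → degree v ^ suc r)
  degree-powers r 1≤n = *-cancelˡ-≤ n {{>-nonZero 1≤n}} (+-cancelʳ-≤ (n * e ^ suc r) _ _ (begin
    n * e ^ suc r + n * e ^ suc r
      ≡⟨ lem₁ n e (e ^ r) ⟩
    n * e ^ r * (2 * e)
      ≡⟨ cong (n * e ^ r *_) handshake ⟨
    n * e ^ r * ∑ degree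
      ≡⟨ ∑-*ˡ (n * e ^ r) degree ⟨
    ∑ (λ v → n * e ^ r * degree v)
      ≤⟨ ∑-mono row ⟩
    ∑ (λ v → n * n ^ r * degree v ^ suc r + e ^ suc r)
      ≡⟨ trans (∑-+ (λ v → n * n ^ r * degree v ^ suc r) (λ _ → e ^ suc r))
           (cong₂ _+_ (∑-*ˡ (n * n ^ r) (λ v → degree v ^ suc r)) (∑-const n (e ^ suc r))) ⟩
    n * n ^ r * S + n * e ^ suc r
      ≡⟨ cong (_+ n * e ^ suc r) (*-assoc n (n ^ r) S) ⟩
    n * (n ^ r * S) + n * e ^ suc r ∎))
    where
    open ≤-Reasoning
    e = edgeCount G
    S = ∑ (λ v → degree v ^ suc r)
    lem₁ : ∀ n e p → n * (e * p) + n * (e * p) ≡ n * p * (2 * e)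
    lem₁ = solve-∀
    lem₂ : ∀ n p x → n * p * x ≡ p * (n * x)
    lem₂ = solve-∀
    lem₃ : ∀ n x p q → n * x * (p * q) ≡ n * p * (x * q)
    lem₃ = solve-∀
    row : ∀ v → n * e ^ r * degree v ≤ n * n ^ r * degree v ^ suc r + e ^ suc r
    row v with e ≤? n * degree v
    ... | yes le = ≤-trans (begin
        n * e ^ r * degree v                   ≡⟨ trans (lem₂ n (e ^ r) (degree v)) (*-comm (e ^ r) _) ⟩
        n * degree v * e ^ r                   ≤⟨ *-monoʳ-≤ (n * degree v) (^-monoˡ-≤ r le) ⟩
        n * degree v * (n * degree v) ^ r      ≡⟨ cong (n * degree v *_) (^-distribʳ-* r n (degree v)) ⟩
        n * degree v * (n ^ r * degree v ^ r)  ≡⟨ lem₃ n (degree v) (n ^ r) (degree v ^ r) ⟩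
        n * n ^ r * degree v ^ suc r           ∎) (m≤m+n _ _)
    ... | no ¬le = ≤-trans (begin
        n * e ^ r * degree v   ≡⟨ lem₂ n (e ^ r) (degree v) ⟩
        e ^ r * (n * degree v) ≤⟨ *-monoʳ-≤ (e ^ r) (<⇒≤ (≰⇒> ¬le)) ⟩
        e ^ r * e              ≡⟨ *-comm (e ^ r) e ⟩
        e ^ suc r              ∎) (m≤n+m _ _)

-- The tuple graph

module TupleGraph {n : ℕ} (G : Graph n) (r : ℕ) where

  open Adjacency G

  tup : Fin (n ^ r) → Fin r → Fin n
  tup = finToFun

  A : Fin (n ^ r) → Fin (n ^ r) → ℕ
  A x y = ∏ λ i → ∏ λ j → α (tup x i) (tup y j)

  common : Fin (n ^ r) → Fin n → ℕ
  common x v = ∏ λ i → α (tup x i) v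

  codegree : Fin (n ^ r) → ℕ
  codegree x = ∑ (common x)

  d : Fin (n ^ r) → ℕ
  d x = codegree x ^ r

  α≤1 : ∀ i j → α i j ≤ 1
  α≤1 i j = ⟦⟧≤1 (adj G i j)

  common≤1 : ∀ x v → common x v ≤ 1
  common≤1 x v = ∏-≤1 _ (λ i → α≤1 (tup x i) v)

  A≡common : ∀ x y → A x y ≡ ∏ (λ j → common x (tup y j))
  A≡common x y = ∏-comm (λ i j → α (tup x i) (tup y j))

  A-sym : ∀ x y → A x y ≡ A y x
  A-sym x y = trans (A≡common x y) (∏-cong λ j → ∏-cong λ i → α-sym (tup x i) (tup y j))

  A-complete : ∀ {x y} → 1 ≤ A x y → ∀ i j → Bool.T (adj G (tup x i) (tup y j))
  A-complete {x} {y} p i j = ⟦⟧-positive _ (∏-positive _ (∏-positive _ p i) j)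

  -- A tuple is adjacent to x exactly when all its entries are common neighbours of the entries of
  -- x, repetitions allowed. Neighbourhoods are thus full powers of sets, which is what makes the
  -- rareness bounds below available.
  rowsum : ∀ x → ∑ (A x) ≡ d x
  rowsum x = trans (∑-cong (A≡common x)) (TupleSums.total (common x) r)

  hits : List (Fin n) → Fin (n ^ r) → ℕ
  hits X y = ∑ λ i → mult X (tup y i)

  hits-rare : ∀ {D} X x → D ≤ codegree x → D * ∑ (λ z → A x z * hits X z) ≤ r * length X * d x
  hits-rare {D} X x D≤ = ≤-trans (≤-reflexive (cong (D *_) (∑-cong λ z → cong (_* hits X z) (A≡common x z))))
    (TupleSums.hits-mass (common x) (common≤1 x) D D≤ r X)

  repeats-rare : ∀ {D} x → D ≤ codegree x → D * ∑ (λ z → A x z * repeats (tup z)) ≤ r * r * d x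
  repeats-rare {D} x D≤ = ≤-trans (≤-reflexive (cong (D *_) (∑-cong λ z → cong (_* repeats (tup z)) (A≡common x z))))
    (TupleSums.repeats-mass (common x) (common≤1 x) D D≤ r)

  -- Double counting of the pairs formed by a vertex and an r-tuple of its neighbours.
  ∑-codegree : ∑ codegree ≡ ∑ (λ v → degree v ^ r)
  ∑-codegree = trans (∑-swap common) (∑-cong λ v → TupleSums.total (λ u → α u v) r)

  codegree≤n : ∀ x → codegree x ≤ n
  codegree≤n x = ≤-trans (∑-mono (common≤1 x)) (≤-reflexive (trans (∑-const n 1) (*-identityʳ n)))

-- The dense core of tuples with large codegree

does⇒ : {P : Set} (P? : Dec P) → does P? ≡ true → P
does⇒ (yes p) _ = p

does⇒¬ : {P : Set} (P? : Dec P) → does P? ≡ false → ¬ P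
does⇒¬ (no ¬p) _ = ¬p

module DenseCore {n : ℕ} (G : Graph n) (r D h : ℕ) (1≤n : 1 ≤ n) (1≤D : 1 ≤ D)
  (small : n ^ suc r * n ^ suc r < 2 ^ h)
  (many : 5 * (D * n ^ suc r) ≤ ∑ (TupleGraph.codegree G (suc r))) where

  open TupleGraph G (suc r)
  open Extraction A A-sym d

  N V : ℕ
  N = n ^ suc r
  V = ∑ d

  rich poor : Fin N → Bool
  rich x = does (D ≤? codegree x)
  poor x = not (rich x)

  rich⇒ : ∀ x → rich x ≡ true → D ≤ codegree x
  rich⇒ x = does⇒ (D ≤? codegree x)

  poor-small : ∀ x → ⟦ poor x ⟧ * d x ≤ D ^ suc r
  poor-small x with true-or-false (rich x)
  ... | inj₁ eq = ≤-trans (≤-reflexive (cong (λ b → ⟦ not b ⟧ * d x) eq)) z≤n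
  ... | inj₂ eq = ≤-trans (≤-reflexive (trans (cong (λ b → ⟦ not b ⟧ * d x) eq) (*-identityˡ (d x))))
    (^-monoˡ-≤ (suc r) (<⇒≤ (≰⇒> (does⇒¬ (D ≤? codegree x) eq))))

  vol-poor : vol poor ≤ N * D ^ suc r
  vol-poor = ≤-trans (∑-mono poor-small) (≤-reflexive (∑-const N (D ^ suc r)))

  -- Pointwise, `D ^ r * codegree x` is at most `d x` or at most `D ^ suc r`. After summation the
  -- second alternative costs one of the five units in `many`. The remaining four show that the poor
  -- tuples hold at most a quarter of the volume.
  V-large : 4 * (N * D ^ suc r) ≤ V
  V-large = +-cancelʳ-≤ (N * D ^ suc r) _ _ (begin
    4 * (N * D ^ suc r) + N * D ^ suc r
      ≡⟨ lem N D (D ^ r) ⟩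
    D ^ r * (5 * (D * N))
      ≤⟨ *-monoʳ-≤ (D ^ r) many ⟩
    D ^ r * ∑ codegree
      ≡⟨ ∑-*ˡ (D ^ r) codegree ⟨
    ∑ (λ x → D ^ r * codegree x)
      ≤⟨ ∑-mono pw ⟩
    ∑ (λ x → d x + D ^ suc r)
      ≡⟨ trans (∑-+ d (λ _ → D ^ suc r)) (cong (V +_) (∑-const N (D ^ suc r))) ⟩
    V + N * D ^ suc r ∎)
    where
    open ≤-Reasoning
    lem : ∀ N D p → 4 * (N * (D * p)) + N * (D * p) ≡ p * (5 * (D * N))
    lem = solve-∀
    pw : ∀ x → D ^ r * codegree x ≤ d x + D ^ suc r
    pw x with ≤-total D (codegree x)
    ... | inj₁ le = ≤-trans (≤-trans (*-monoˡ-≤ (codegree x) (^-monoˡ-≤ r le)) (≤-reflexive (*-comm _ (codegree x)))) (m≤m+n _ _)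
    ... | inj₂ le = ≤-trans (≤-trans (*-monoʳ-≤ (D ^ r) le) (≤-reflexive (*-comm _ D))) (m≤n+m _ _)

  V-split : V ≡ vol rich + vol poor
  V-split = trans (∑-cong λ x → trans (sym (+-identityʳ (d x))) (trans (cong (_* d x) (sym (⟦⟧-split (rich x)))) (*-distribʳ-+ (d x) ⟦ rich x ⟧ ⟦ poor x ⟧)))
    (∑-+ (λ x → ⟦ rich x ⟧ * d x) (λ x → ⟦ poor x ⟧ * d x))

  -- An edge outside the rich set has a poor end, and the edges at poor tuples number `vol poor` in
  -- each of the two orientations.
  V≤e : V ≤ e rich rich + (vol poor + vol poor)
  V≤e = begin
    V
      ≡⟨ ∑-cong rowsum ⟨
    ∑ (λ x → ∑ (A x))
      ≤⟨ ∑-mono (λ x → ∑-mono λ y → entry (rich x) (rich y) (A x y)) ⟩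
    ∑ (λ x → ∑ λ y → ⟦ rich x ⟧ * (⟦ rich y ⟧ * A x y) + (⟦ poor x ⟧ * A x y + ⟦ poor y ⟧ * A x y))
      ≡⟨ trans (∑-cong λ x → ∑-+ (λ y → ⟦ rich x ⟧ * (⟦ rich y ⟧ * A x y)) (λ y → ⟦ poor x ⟧ * A x y + ⟦ poor y ⟧ * A x y))
           (∑-+ (λ x → ∑ λ y → ⟦ rich x ⟧ * (⟦ rich y ⟧ * A x y)) (λ x → ∑ λ y → ⟦ poor x ⟧ * A x y + ⟦ poor y ⟧ * A x y)) ⟩
    e rich rich + ∑ (λ x → ∑ λ y → ⟦ poor x ⟧ * A x y + ⟦ poor y ⟧ * A x y)
      ≡⟨ cong (e rich rich +_) (trans (∑-cong λ x → ∑-+ (λ y → ⟦ poor x ⟧ * A x y) (λ y → ⟦ poor y ⟧ * A x y))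
           (∑-+ (λ x → ∑ λ y → ⟦ poor x ⟧ * A x y) (λ x → ∑ λ y → ⟦ poor y ⟧ * A x y))) ⟩
    e rich rich + (∑ (λ x → ∑ λ y → ⟦ poor x ⟧ * A x y) + ∑ (λ x → ∑ λ y → ⟦ poor y ⟧ * A x y))
      ≡⟨ cong (e rich rich +_) (cong₂ _+_ out (trans (∑-swap (λ x y → ⟦ poor y ⟧ * A x y))
           (trans (∑-cong λ y → ∑-cong λ x → cong (⟦ poor y ⟧ *_) (A-sym x y)) out))) ⟩
    e rich rich + (vol poor + vol poor) ∎
    where
    open ≤-Reasoning
    out : ∑ (λ x → ∑ λ y → ⟦ poor x ⟧ * A x y) ≡ vol poor
    out = ∑-cong λ x → trans (∑-*ˡ ⟦ poor x ⟧ (A x)) (cong (⟦ poor x ⟧ *_) (rowsum x))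
    entry : ∀ a b c → c ≤ ⟦ a ⟧ * (⟦ b ⟧ * c) + (⟦ not a ⟧ * c + ⟦ not b ⟧ * c)
    entry true  true  c = ≤-trans (≤-reflexive (sym (trans (+-identityʳ _) (+-identityʳ c)))) (m≤m+n _ _)
    entry true  false c = ≤-reflexive (sym (+-identityʳ c))
    entry false b     c = ≤-trans (≤-reflexive (sym (+-identityʳ c))) (m≤m+n (1 * c) (⟦ not b ⟧ * c))

  4vol-poor≤V : 4 * vol poor ≤ V
  4vol-poor≤V = ≤-trans (*-monoʳ-≤ 4 vol-poor) V-large

  vol-rich≤V : vol rich ≤ V
  vol-rich≤V = ≤-trans (m≤m+n (vol rich) (vol poor)) (≤-reflexive (sym V-split))

  -- Level h stands for e / vol at least 1/2, which holds because removing both orientations of the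
  -- edges at poor tuples costs at most V / 2. At level 0 a share of 1/4 is still guaranteed.
  rich-dense : Dense h h rich
  rich-dense = begin
    vol rich * (h + h)           ≤⟨ *-monoˡ-≤ (h + h) (≤-trans vol-rich≤V V≤2e) ⟩
    2 * e rich rich * (h + h)    ≡⟨ lem₂ (e rich rich) h ⟩
    e rich rich * (4 * h)        ∎
    where
    open ≤-Reasoning
    lem₁ : ∀ e p → 2 * (e + (p + p)) ≡ 2 * e + 4 * p
    lem₁ = solve-∀
    lem₂ : ∀ e h → 2 * e * (h + h) ≡ e * (4 * h)
    lem₂ = solve-∀
    V≤2e : V ≤ 2 * e rich rich
    V≤2e = +-cancelʳ-≤ V _ _ (begin
      V + V                                     ≡⟨ cong (V +_) (+-identityʳ V) ⟨
      2 * V                                     ≤⟨ *-monoʳ-≤ 2 V≤e ⟩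
      2 * (e rich rich + (vol poor + vol poor)) ≡⟨ lem₁ (e rich rich) (vol poor) ⟩
      2 * e rich rich + 4 * vol poor            ≤⟨ +-monoʳ-≤ _ 4vol-poor≤V ⟩
      2 * e rich rich + V                       ∎)

  1≤vol-rich : 1 ≤ vol rich
  1≤vol-rich = positive (vol rich) (vol poor) V-split 4vol-poor≤V 1≤V
    where
    1≤V : 1 ≤ V
    1≤V = ≤-trans (*-mono-≤ {1} {4} (s≤s z≤n) (*-mono-≤ (m^n>0 n {{>-nonZero 1≤n}} (suc r)) (m^n>0 D {{>-nonZero 1≤D}} (suc r)))) V-large
    positive : ∀ a b {V} → V ≡ a + b → 4 * b ≤ V → 1 ≤ V → 1 ≤ a
    positive (suc a) b _ _ _ = s≤s z≤n
    positive zero (suc b) refl le _ = ⊥-elim (<-irrefl refl (≤-trans (s≤s (m≤m+n (suc b) _)) (≤-trans (≤-reflexive (lem b)) le)))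
      where
      lem : ∀ b → 1 + ((1 + b) + (2 + 3 * b)) ≡ 4 * (1 + b)
      lem = solve-∀
    positive zero zero refl _ ()

  vol-rich< : vol rich < 2 ^ h
  vol-rich< = ≤-<-trans (≤-trans vol-rich≤V (≤-trans (∑-mono λ x → ^-monoˡ-≤ (suc r) (codegree≤n x)) (≤-reflexive (∑-const N N)))) small

  core : ∃[ v ] (v ⊑ rich × 1 ≤ vol v × Dense h 0 v × Expander h v)
  core = extract h (card rich) h rich ≤-refl vol-rich< 1≤vol-rich rich-dense

-- Greedy choice of objects with disjoint footprints

Disjoint : {X : Set} → List X → List X → Set
Disjoint xs ys = ∀ {v} → v ∈ xs → v ∉ ys

-- The footprints chosen so far are added to the forbidden list, whose length stays within C by
-- `room`. The branch tuples and the paths are both selected this way.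
greedy : {X : Set} (t : ℕ) (Obj : Fin t → Set) (foot : ∀ {k} → Obj k → List X) (ℓ C : ℕ) →
  (∀ {k} (o : Obj k) → length (foot o) ≤ ℓ) →
  (∀ k X → length X ≤ C → Σ (Obj k) λ o → Disjoint (foot o) X) →
  ∀ X₀ → length X₀ + t * ℓ ≤ C →
  Σ (∀ k → Obj k) λ f → (∀ k → Disjoint (foot (f k)) X₀) × (∀ j k → j ≢ k → Disjoint (foot (f j)) (foot (f k)))
greedy zero Obj foot ℓ C small avail X₀ room = (λ ()) , (λ ()) , λ ()
greedy {X} (suc t) Obj foot ℓ C small avail X₀ room
  with avail zero X₀ (≤-trans (m≤m+n (length X₀) _) room)
... | o , o∩X₀ with greedy t (Obj ∘ suc) foot ℓ C small (avail ∘ suc) (foot o ++ X₀) room′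
  where
  lem : ∀ a b c → a + b + c ≡ b + (a + c)
  lem = solve-∀
  room′ : length (foot o ++ X₀) + t * ℓ ≤ C
  room′ = ≤-trans (≤-reflexive (cong (_+ t * ℓ) (length-++ (foot o))))
    (≤-trans (+-monoˡ-≤ (t * ℓ) (+-monoˡ-≤ (length X₀) (small o))) (≤-trans (≤-reflexive (lem ℓ (length X₀) (t * ℓ))) room))
...   | f , avoid , pairwise = f′ , avoid′ , pairwise′
  where
  f′ : ∀ k → Obj k
  f′ zero    = o
  f′ (suc k) = f k
  avoid′ : ∀ k → Disjoint (foot (f′ k)) X₀
  avoid′ zero    = o∩X₀
  avoid′ (suc k) v∈ v∈X₀ = avoid k v∈ (∈-++⁺ʳ (foot o) v∈X₀)
  pairwise′ : ∀ j k → j ≢ k → Disjoint (foot (f′ j)) (foot (f′ k))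
  pairwise′ zero    zero    j≢k = ⊥-elim (j≢k refl)
  pairwise′ zero    (suc k) _ v∈ v∈′ = avoid k v∈′ (∈-++⁺ˡ v∈)
  pairwise′ (suc j) zero    _ v∈ v∈′ = avoid j v∈ (∈-++⁺ˡ v∈′)
  pairwise′ (suc j) (suc k) j≢k = pairwise j k (j≢k ∘ cong suc)

-- Forbidden tuples and conflicts between tuples

⟦pos⟧≤ : ∀ k → ⟦ pos k ⟧ ≤ k
⟦pos⟧≤ zero    = z≤n
⟦pos⟧≤ (suc k) = s≤s z≤n

pos-false : ∀ {k} → pos k ≡ false → k ≡ 0
pos-false {zero} _ = refl

mult-∉ : ∀ {n} {X : List (Fin n)} {v} → v ∉ X → mult X v ≡ 0
mult-∉ {X = []}    v∉ = refl
mult-∉ {X = x ∷ X} v∉ = cong₂ _+_ (δ-≢ λ x≡v → v∉ (here (sym x≡v))) (mult-∉ (v∉ ∘ there))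

mult-tabulate : ∀ {n r} (t : Fin r → Fin n) v → mult (tabulate t) v ≡ ∑ λ j → δ (t j) v
mult-tabulate {r = zero}  t v = sym (∑-zero _)
mult-tabulate {r = suc r} t v = trans (cong (δ (t zero) v +_) (mult-tabulate (t ∘ suc) v)) (sym (∑-suc λ j → δ (t j) v))

module Conflicts {n : ℕ} (G : Graph n) (r : ℕ) where

  open TupleGraph G r

  verts : Fin (n ^ r) → List (Fin n)
  verts x = tabulate (tup x)

  ∈-verts : ∀ x i → tup x i ∈ verts x
  ∈-verts x i = ∈-tabulate⁺ {f = tup x} i

  forb : List (Fin n) → Fin (n ^ r) → Bool
  forb X y = pos (hits X y + repeats (tup y))

  shared : Fin (n ^ r) → Fin (n ^ r) → ℕ
  shared x y = hits (verts x) y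

  shared-sym : ∀ x y → shared x y ≡ shared y x
  shared-sym x y = trans (∑-cong λ i → mult-tabulate (tup x) (tup y i))
    (trans (∑-swap (λ i j → δ (tup x j) (tup y i)))
    (∑-cong λ j → trans (∑-cong λ i → δ-sym (tup x j) (tup y i)) (sym (mult-tabulate (tup y) (tup x j)))))

  -- A tuple does not conflict with itself: the walk may stay put or return, and loops are erased later.
  conf : Fin (n ^ r) → Fin (n ^ r) → Bool
  conf x y = not (does (x Finₚ.≟ y)) ∧ pos (shared x y)

  does-≟-sym : ∀ (x y : Fin (n ^ r)) → does (x Finₚ.≟ y) ≡ does (y Finₚ.≟ x)
  does-≟-sym x y with x Finₚ.≟ y
  ... | yes refl = sym (dec-true (x Finₚ.≟ x) refl)
  ... | no x≢y with y Finₚ.≟ x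
  ...   | yes y≡x = ⊥-elim (x≢y (sym y≡x))
  ...   | no _ = refl

  conf-sym : ∀ x y → conf x y ≡ conf y x
  conf-sym x y = cong₂ (λ a k → not a ∧ pos k) (does-≟-sym x y) (shared-sym x y)

  conf-diag : ∀ x → conf x x ≡ false
  conf-diag x = cong (λ a → not a ∧ pos (shared x x)) (dec-true (x Finₚ.≟ x) refl)

  ∈⇒hits : ∀ X y {i} → tup y i ∈ X → 1 ≤ hits X y
  ∈⇒hits X y {i} v∈ = ≤-trans (mult-∈ v∈) (term≤∑ (λ i → mult X (tup y i)) i)

  conf-false : ∀ {x y} → conf x y ≡ false → x ≢ y → Disjoint (verts x) (verts y)
  conf-false {x} {y} eq x≢y {v} v∈x v∈y with x Finₚ.≟ y
  ... | yes x≡y = x≢y x≡y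
  ... | no _ with ∈-tabulate⁻ v∈y
  ...   | i , refl with ≤-trans (∈⇒hits (verts x) y {i} v∈x) (≤-reflexive (pos-false eq))
  ...     | ()

  conf-disjoint : ∀ {x y} → Disjoint (verts x) (verts y) → conf x y ≡ false
  conf-disjoint {x} {y} disj = trans (cong (λ k → not (does (x Finₚ.≟ y)) ∧ pos k)
      (∑-≡0 λ i → mult-∉ λ v∈ → disj v∈ (∈-verts y i)))
    (∧-zeroʳ (not (does (x Finₚ.≟ y))))

  forb-false : ∀ {X y} → forb X y ≡ false → Disjoint (verts y) X × repeats (tup y) ≡ 0
  forb-false {X} {y} eq = disj , m+n≡0⇒n≡0 (hits X y) (pos-false eq)
    where
    disj : Disjoint (verts y) X
    disj v∈ v∈X with ∈-tabulate⁻ v∈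
    ... | i , refl with ≤-trans (∈⇒hits X y {i} v∈X) (≤-reflexive (m+n≡0⇒m≡0 _ (pos-false eq)))
    ...   | ()

  forb-disjoint : ∀ {X y} → Disjoint (verts y) X → repeats (tup y) ≡ 0 → forb X y ≡ false
  forb-disjoint {X} {y} disj rep = cong pos (cong₂ _+_ (∑-≡0 λ i → mult-∉ (disj (∈-verts y i))) rep)

  tup-injective : ∀ {y} → repeats (tup y) ≡ 0 → ∀ i j → tup y i ≡ tup y j → i ≡ j
  tup-injective {y} rep i j eq with i Finₚ.≟ j
  ... | yes i≡j = i≡j
  ... | no i≢j with ≤-trans (repeats-≥1 (tup y) i≢j eq) (≤-reflexive rep)
  ...   | ()

  module _ {D ℓ b : ℕ} (b-large : r * ℓ + r * r ≤ b) where

    forb-rare : ∀ X → length X ≤ ℓ → ∀ x → D ≤ codegree x → D * ∑ (λ z → A x z * ⟦ forb X z ⟧) ≤ b * d x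
    forb-rare X X≤ x D≤ = begin
      D * ∑ (λ z → A x z * ⟦ forb X z ⟧)
        ≤⟨ *-monoʳ-≤ D (∑-monoʳ (A x) (λ z → ⟦pos⟧≤ _)) ⟩
      D * ∑ (λ z → A x z * (hits X z + repeats (tup z)))
        ≡⟨ cong (D *_) (trans (∑-cong λ z → *-distribˡ-+ (A x z) (hits X z) (repeats (tup z)))
             (∑-+ (λ z → A x z * hits X z) (λ z → A x z * repeats (tup z)))) ⟩
      D * (∑ (λ z → A x z * hits X z) + ∑ (λ z → A x z * repeats (tup z)))
        ≡⟨ *-distribˡ-+ D (∑ (λ z → A x z * hits X z)) (∑ (λ z → A x z * repeats (tup z))) ⟩
      D * ∑ (λ z → A x z * hits X z) + D * ∑ (λ z → A x z * repeats (tup z))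
        ≤⟨ +-mono-≤ (≤-trans (hits-rare X x D≤) (*-monoˡ-≤ (d x) (*-monoʳ-≤ r X≤))) (repeats-rare x D≤) ⟩
      r * ℓ * d x + r * r * d x
        ≡⟨ *-distribʳ-+ (d x) (r * ℓ) (r * r) ⟨
      (r * ℓ + r * r) * d x
        ≤⟨ *-monoˡ-≤ (d x) b-large ⟩
      b * d x ∎
      where open ≤-Reasoning

    conf-rare : ∀ u x → D ≤ codegree x → D * ∑ (λ z → A x z * ⟦ conf u z ⟧) ≤ b * d x
    conf-rare u x D≤ = begin
      D * ∑ (λ z → A x z * ⟦ conf u z ⟧)
        ≤⟨ *-monoʳ-≤ D (∑-monoʳ (A x) (λ z → ≤-trans (≤-reflexive (⟦∧⟧ (not (does (u Finₚ.≟ z))) _))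
             (≤-trans (*-mono-≤ (⟦⟧≤1 (not (does (u Finₚ.≟ z)))) (⟦pos⟧≤ _)) (≤-reflexive (*-identityˡ _))))) ⟩
      D * ∑ (λ z → A x z * hits (verts u) z)
        ≤⟨ hits-rare (verts u) x D≤ ⟩
      r * length (verts u) * d x
        ≡⟨ cong (λ k → r * k * d x) (length-tabulate (tup u)) ⟩
      r * r * d x
        ≤⟨ *-monoˡ-≤ (d x) (≤-trans (m≤n+m (r * r) (r * ℓ)) b-large) ⟩
      b * d x ∎
      where open ≤-Reasoning

  length-concat : ∀ {m} (S : Fin m → Fin (n ^ r)) → length (concat (tabulate (verts ∘ S))) ≡ m * r
  length-concat {zero}  S = refl
  length-concat {suc m} S = trans (length-++ (verts (S zero)))
    (cong₂ _+_ (length-tabulate (tup (S zero))) (length-concat (S ∘ suc)))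

  feet : List (Fin (n ^ r)) → List (Fin n)
  feet ps = concat (map verts ps)

  length-feet : ∀ ps → length (feet ps) ≡ length ps * r
  length-feet []       = refl
  length-feet (p ∷ ps) = trans (length-++ (verts p)) (cong₂ _+_ (length-tabulate (tup p)) (length-feet ps))

  ∈-feet⁺ : ∀ {ps p v} → p ∈ ps → v ∈ verts p → v ∈ feet ps
  ∈-feet⁺ p∈ v∈ = ∈-concat⁺′ v∈ (∈-map⁺ verts p∈)

  ∈-feet⁻ : ∀ ps {v} → v ∈ feet ps → ∃[ p ] (p ∈ ps × v ∈ verts p)
  ∈-feet⁻ (p ∷ ps) v∈ with ∈-++⁻ (verts p) v∈
  ... | inj₁ v∈p = p , here refl , v∈p
  ... | inj₂ v∈ps with ∈-feet⁻ ps v∈ps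
  ...   | q , q∈ , v∈q = q , there q∈ , v∈q

  branchVerts : ∀ {m} → (Fin m → Fin (n ^ r)) → List (Fin n)
  branchVerts S = concat (tabulate (verts ∘ S))

  ∈-branchVerts : ∀ {m} (S : Fin m → Fin (n ^ r)) k {v} → v ∈ verts (S k) → v ∈ branchVerts S
  ∈-branchVerts S k v∈ = ∈-concat⁺′ v∈ (∈-tabulate⁺ k)

  outside? : ∀ s t v → Dec (v ∉ verts s × v ∉ verts t)
  outside? s t v = ¬? (∈? Finₚ._≟_ v (verts s)) ×-dec ¬? (∈? Finₚ._≟_ v (verts t))

  -- A path has to avoid every branch tuple, yet its own two ends must not be forbidden. Their
  -- vertices are therefore removed from the forbidden list, and the interior of the path is kept
  -- away from them by `conf` instead.
  avoiding : Fin (n ^ r) → Fin (n ^ r) → List (Fin n) → List (Fin n)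
  avoiding s t = filter (outside? s t)

  ∈-avoiding : ∀ s t {X v} → v ∉ verts s → v ∉ verts t → v ∈ X → v ∈ avoiding s t X
  ∈-avoiding s t v∉s v∉t v∈ = ∈-filter⁺ (outside? s t) v∈ (v∉s , v∉t)

  avoiding-disjoint : ∀ s t X → Disjoint (verts s) (avoiding s t X) × Disjoint (verts t) (avoiding s t X)
  avoiding-disjoint s t X =
    (λ v∈s v∈ → proj₁ (proj₂ (∈-filter⁻ (outside? s t) {xs = X} v∈)) v∈s) ,
    (λ v∈t v∈ → proj₂ (proj₂ (∈-filter⁻ (outside? s t) {xs = X} v∈)) v∈t)

-- n ! serves as a common multiple of all codegrees; the value is 0 when c does not divide it.
cofactor : ℕ → ℕ → ℕ
cofactor n c with c ∣? n !
... | yes (divides q _) = q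
... | no _ = 0

cofactor-* : ∀ {n c} → 1 ≤ c → c ≤ n → cofactor n c * c ≡ n !
cofactor-* {n} {suc c} (s≤s _) c≤n with suc c ∣? n !
... | yes (divides q eq) = sym eq
... | no ∤ = ⊥-elim (∤ (∣-trans (m∣m*n (c !)) (m≤n⇒m!∣n! c≤n)))

-- Embedding the blow-up into the graph

module Embedding {n : ℕ} (G : Graph n) (r D h : ℕ) (1≤n : 1 ≤ n) (1≤D : 1 ≤ D) (1≤h : 1 ≤ h)
  (small : n ^ suc r * n ^ suc r < 2 ^ h)
  (many : 5 * (D * n ^ suc r) ≤ ∑ (TupleGraph.codegree G (suc r)))
  (m τ ℓ b : ℕ)
  (mixed : 4 * (8 * h * (8 * h)) * (2 + 2 * h) ≤ τ)
  (ℓ-large : m * m * (3 * τ * suc r) + m * suc r ≤ ℓ)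
  (b-large : suc r * ℓ + suc r * suc r ≤ b)
  (D-large : (3 * τ + 3 * τ * (3 * τ)) * (3 * (3 * τ * b)) < D)
  (D-large′ : 4 * b < D)
  where

  open DenseCore G r D h 1≤n 1≤D small many
  open TupleGraph G (suc r)
  open Extraction A A-sym d
  open Conflicts G (suc r)

  K : ℕ
  K = 3 * τ

  module WithCore (v : Fin N → Bool) (v⊑rich : v ⊑ rich) (1≤vol : 1 ≤ vol v)
                  (dense : Dense h 0 v) (expander : Expander h v) where

    D≤ : ∀ x → v x ≡ true → D ≤ codegree x
    D≤ x vx = rich⇒ x (v⊑rich x vx)

    vol≤4e : vol v ≤ 4 * e v v
    vol≤4e = *-cancelʳ-≤ (vol v) (4 * e v v) h {{>-nonZero 1≤h}}
      (≤-trans (≤-reflexive (cong (vol v *_) (sym (+-identityʳ h)))) (≤-trans dense (≤-reflexive (lem (e v v) h))))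
      where
      lem : ∀ e h → e * (4 * h) ≡ 4 * e * h
      lem = solve-∀

    -- Rareness is known for a random neighbour, not for a random tuple, so edges inside v are
    -- counted. Those with a forbidden second end number at most (b / D) vol v, and vol v ≤ 4 e(v,
    -- v) together with 4 b < D leaves an edge whose second end is free.
    free-tuple : ∀ X → length X ≤ ℓ → ∃[ y ] (v y ≡ true × forb X y ≡ false)
    free-tuple X X≤ = found
      where
      eᶠ : Fin N → Fin N → ℕ
      eᶠ x y = ⟦ v x ⟧ * (⟦ v y ⟧ * A x y) * ⟦ forb X y ⟧
      eᵛ : Fin N → Fin N → ℕ
      eᵛ x y = ⟦ v x ⟧ * (⟦ v y ⟧ * A x y)
      row : ∀ x → D * ∑ (eᶠ x) ≤ b * (⟦ v x ⟧ * d x)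
      row x with true-or-false (v x)
      ... | inj₂ eq = ≤-trans (≤-reflexive (trans (cong (D *_) (∑-≡0 λ y → cong (λ c → ⟦ c ⟧ * (⟦ v y ⟧ * A x y) * ⟦ forb X y ⟧) eq)) (*-zeroʳ D))) z≤n
      ... | inj₁ eq = ≤-trans (*-monoʳ-≤ D (∑-mono λ y → *-monoˡ-≤ ⟦ forb X y ⟧
              (≤-trans (*-mono-≤ (⟦⟧≤1 (v x)) (*-monoˡ-≤ (A x y) (⟦⟧≤1 (v y)))) (≤-reflexive (trans (*-identityˡ _) (*-identityˡ _))))))
            (≤-trans (forb-rare b-large X X≤ x (D≤ x eq))
              (≤-reflexive (cong (b *_) (sym (trans (cong (λ c → ⟦ c ⟧ * d x) eq) (*-identityˡ (d x)))))))
      few : ∑ (λ x → ∑ (eᶠ x)) < ∑ (λ x → ∑ (eᵛ x))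
      few = *-cancelˡ-< D _ _ (begin-strict
        D * ∑ (λ x → ∑ (eᶠ x))            ≡⟨ ∑-*ˡ D (λ x → ∑ (eᶠ x)) ⟨
        ∑ (λ x → D * ∑ (eᶠ x))            ≤⟨ ∑-mono row ⟩
        ∑ (λ x → b * (⟦ v x ⟧ * d x))     ≡⟨ ∑-*ˡ b (λ x → ⟦ v x ⟧ * d x) ⟩
        b * vol v                         ≤⟨ *-monoʳ-≤ b vol≤4e ⟩
        b * (4 * e v v)                   ≡⟨ trans (sym (*-assoc b 4 (e v v))) (cong (_* e v v) (*-comm b 4)) ⟩
        4 * b * e v v                     <⟨ *-monoˡ-< (e v v) {{>-nonZero 1≤e}} D-large′ ⟩
        D * e v v                         ∎)
        where
        open ≤-Reasoning
        positive : ∀ k → 1 ≤ 4 * k → 1 ≤ k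
        positive (suc k) _ = s≤s z≤n
        1≤e : 1 ≤ e v v
        1≤e = positive (e v v) (≤-trans 1≤vol vol≤4e)
      entry : ∀ a c f k → ⟦ a ⟧ * (⟦ c ⟧ * k) * ⟦ f ⟧ < ⟦ a ⟧ * (⟦ c ⟧ * k) → c ≡ true × f ≡ false
      entry a true false k _ = refl , refl
      entry a true true k lt = ⊥-elim (<-irrefl (*-identityʳ _) lt)
      entry a false f k lt = ⊥-elim (n≮0 (<-≤-trans lt (≤-reflexive (*-zeroʳ ⟦ a ⟧))))
      found : ∃[ y ] (v y ≡ true × forb X y ≡ false)
      found with ∑-witness-< (λ x → ∑ (eᶠ x)) (λ x → ∑ (eᵛ x)) few
      ... | x , lt with ∑-witness-< (eᶠ x) (eᵛ x) lt
      ...   | y , lt′ = y , entry (v x) (v y) (forb X y) (A x y) lt′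

    record Branch : Set where
      field
        at     : Fin N
        inCore : v at ≡ true
        proper : repeats (tup at) ≡ 0
    open Branch

    free-branch : ∀ X → length X ≤ ℓ → Σ Branch λ β → Disjoint (verts (at β)) X
    free-branch X X≤ = make (free-tuple X X≤)
      where
      make : ∃[ y ] (v y ≡ true × forb X y ≡ false) → Σ Branch λ β → Disjoint (verts (at β)) X
      make (y , vy , fy) = record { at = y ; inCore = vy ; proper = proj₂ (forb-false {X} {y} fy) } , proj₁ (forb-false {X} {y} fy)

    branches : Σ (Fin m → Branch) λ β → ∀ j k → j ≢ k → Disjoint (verts (at (β j))) (verts (at (β k)))
    branches = proj₁ found , proj₂ (proj₂ found)
      where
      foot : Branch → List (Fin n)
      foot β = verts (at β)
      found : Σ (Fin m → Branch) λ β → (∀ k → Disjoint (foot (β k)) []) × (∀ j k → j ≢ k → Disjoint (foot (β j)) (foot (β k)))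
      found = greedy m (λ _ → Branch) (λ {k} → foot) (suc r) ℓ (λ β → ≤-reflexive (length-tabulate (tup (at β))))
        (λ _ → free-branch) [] (≤-trans (m≤n+m (m * suc r) (m * m * (K * suc r))) ℓ-large)

    M : ℕ
    M = 2 * (n !) ^ suc r

    a : Fin N → ℕ
    a x = cofactor n (codegree x) ^ suc r

    1≤codegree : ∀ x → v x ≡ true → 1 ≤ codegree x
    1≤codegree x vx = ≤-trans 1≤D (D≤ x vx)

    a-inverse : ∀ x → v x ≡ true → 2 * (a x * d x) ≡ M
    a-inverse x vx = cong (2 *_) (trans (sym (^-distribʳ-* (suc r) (cofactor n (codegree x)) (codegree x)))
      (cong (_^ suc r) (cofactor-* (1≤codegree x vx) (codegree≤n x))))

    1≤M : 1 ≤ M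
    1≤M = *-mono-≤ {1} {2} (s≤s z≤n) (m^n>0 (n !) {{n!≢0}} (suc r))
      where
      n!≢0 : NonZero (n !)
      n!≢0 = n !≢0

    vol< : vol v < 2 ^ h
    vol< = ≤-<-trans (∑-mono λ x → ≤-trans (*-monoˡ-≤ (d x) (⟦⟧≤1 (v x))) (≤-trans (≤-reflexive (*-identityˡ (d x)))
        (^-monoˡ-≤ (suc r) (codegree≤n x)))) (≤-<-trans (≤-reflexive (∑-const N N)) small)

    Edge : Fin N → Fin N → Set
    Edge x y = 1 ≤ A x y

    module Erasure (t : Fin N) = LoopErasure Finₚ._≟_ Edge t

    record GoodPath (β : Fin m → Branch) (i j : Fin m) (ps : List (Fin N)) : Set where
      field
        chain    : Erasure.Chain (at (β j)) (at (β i)) ps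
        distinct : Erasure.Distinct (at (β j)) ps
        proper   : ∀ {y} → y ∈ ps → repeats (tup y) ≡ 0
        disjoint : ∀ {y z} → y ∈ ps → z ∈ ps → y ≢ z → Disjoint (verts y) (verts z)
        outside  : ∀ {y} → y ∈ ps → ∀ k → Disjoint (verts y) (verts (at (β k)))

    module WithBranches (β : Fin m → Branch)
      (β-disjoint : ∀ j k → j ≢ k → Disjoint (verts (at (β j))) (verts (at (β k)))) where

      S : Fin m → Fin N
      S k = at (β k)

      good-path : ∀ i j → i ≢ j → ∀ X → length X ≤ m * m * (K * suc r) →
        ∃[ ps ] (length ps ≤ K × GoodPath β i j ps × Disjoint (feet ps) X)
      good-path i j i≢j X X≤ = result
        where
        Y Z : List (Fin n)
        Y = X ++ branchVerts S
        Z = avoiding (S i) (S j) Y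
        Z≤ : length Z ≤ ℓ
        Z≤ = ≤-trans (length-filter (outside? (S i) (S j)) Y) (≤-trans (≤-reflexive (trans (length-++ X)
          (cong (length X +_) (length-concat S)))) (≤-trans (+-monoˡ-≤ (m * suc r) X≤) ℓ-large))
        S-distinct : S i ≢ S j
        S-distinct eq = β-disjoint i j i≢j (∈-verts (S i) zero) (subst (λ s → tup (S i) zero ∈ verts s) eq (∈-verts (S i) zero))
        open ExpanderPaths A A-sym d (λ x → ≤-reflexive (rowsum x)) v h 1≤h vol< expander a M 1≤M a-inverse
          using (CleanPath; clean-path)
        path = clean-path τ mixed D b D-large (λ x vx → m^n>0 (codegree x) {{>-nonZero (1≤codegree x vx)}} (suc r))
          (forb Z) conf conf-sym conf-diag
          (λ x vx → forb-rare b-large Z Z≤ x (D≤ x vx))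
          (λ u x vx → conf-rare b-large u x (D≤ x vx))
          (S i) (S j) (inCore (β i)) (inCore (β j))
          (forb-disjoint {Z} {S i} (proj₁ (avoiding-disjoint (S i) (S j) Y)) (proper (β i)))
          (forb-disjoint {Z} {S j} (proj₂ (avoiding-disjoint (S i) (S j) Y)) (proper (β j)))
          (conf-disjoint {S i} {S j} (β-disjoint i j i≢j))
          S-distinct
        module p = CleanPath path
        avoids : ∀ {y} → y ∈ p.ps → Disjoint (verts y) Y
        avoids {y} y∈ {u} u∈y u∈Y = proj₁ (forb-false {Z} {y} (p.allowed y∈)) u∈y
          (∈-avoiding (S i) (S j)
            (conf-false {y} {S i} (p.disjoint (there (there y∈)) (here refl)) (λ eq → p.S∉ps (subst (_∈ p.ps) eq y∈)) u∈y)
            (conf-false {y} {S j} (p.disjoint (there (there y∈)) (there (here refl))) (λ eq → p.T∉ps (subst (_∈ p.ps) eq y∈)) u∈y)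
            u∈Y)
        feet-avoid : Disjoint (feet p.ps) X
        feet-avoid {u} u∈ u∈X = clash (∈-feet⁻ p.ps u∈)
          where
          clash : ∃[ y ] (y ∈ p.ps × u ∈ verts y) → ⊥
          clash (y , y∈ , u∈y) = avoids y∈ u∈y (∈-++⁺ˡ u∈X)
        result : ∃[ ps ] (length ps ≤ K × GoodPath β i j ps × Disjoint (feet ps) X)
        result = p.ps , p.short , record
          { chain = p.chain
          ; distinct = p.distinct
          ; proper = λ {y} y∈ → proj₂ (forb-false {Z} {y} (p.allowed y∈))
          ; disjoint = λ {y} {z} y∈ z∈ y≢z → conf-false {y} {z} (p.disjoint (there (there y∈)) (there (there z∈))) y≢z
          ; outside = λ y∈ k u∈y u∈S → avoids y∈ u∈y (∈-++⁺ʳ X (∈-branchVerts S k u∈S))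
          } , feet-avoid

      -- One object for each of the m² ordered pairs, so that `combine` numbers them; pairs without
      -- i < j receive the empty list.
      PathObj : Fin m → Fin m → Set
      PathObj i j = Σ (List (Fin N)) λ ps → length ps ≤ K × (toℕ i < toℕ j → GoodPath β i j ps)

      path-obj : ∀ i j X → length X ≤ m * m * (K * suc r) → Σ (PathObj i j) λ o → Disjoint (feet (proj₁ o)) X
      path-obj i j X X≤ = choose (toℕ i <? toℕ j)
        where
        pack : toℕ i < toℕ j → ∃[ ps ] (length ps ≤ K × GoodPath β i j ps × Disjoint (feet ps) X) →
          Σ (PathObj i j) λ o → Disjoint (feet (proj₁ o)) X
        pack _ (ps , short , good , disj) = (ps , short , λ _ → good) , disj
        choose : Dec (toℕ i < toℕ j) → Σ (PathObj i j) λ o → Disjoint (feet (proj₁ o)) X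
        choose (yes i<j) = pack i<j (good-path i j (λ eq → <-irrefl (cong toℕ eq) i<j) X X≤)
        choose (no i≮j) = ([] , z≤n , λ i<j → ⊥-elim (i≮j i<j)) , λ ()

      record PathSystem : Set where
        field
          ps       : Fin m → Fin m → List (Fin N)
          short    : ∀ i j → length (ps i j) ≤ K
          good     : ∀ i j → toℕ i < toℕ j → GoodPath β i j (ps i j)
          pairwise : ∀ i j i′ j′ → ¬ (i ≡ i′ × j ≡ j′) → Disjoint (feet (ps i j)) (feet (ps i′ j′))

      path-system : PathSystem
      path-system = from-family found
        where
        Obj : Fin (m * m) → Set
        Obj k = PathObj (proj₁ (remQuot {m} m k)) (proj₂ (remQuot {m} m k))
        foot : ∀ {k} → Obj k → List (Fin n)
        foot o = feet (proj₁ o)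
        foot-short : ∀ {k} (o : Obj k) → length (foot {k} o) ≤ K * suc r
        foot-short (ps , short , _) = ≤-trans (≤-reflexive (length-feet ps)) (*-monoˡ-≤ (suc r) short)
        Family : Set
        Family = Σ (∀ k → Obj k) λ f → (∀ k → Disjoint (foot {k} (f k)) []) ×
          (∀ j k → j ≢ k → Disjoint (foot {j} (f j)) (foot {k} (f k)))
        found : Family
        found = greedy (m * m) Obj (λ {k} → foot {k}) (K * suc r) (m * m * (K * suc r)) (λ {k} → foot-short {k})
          (λ k → path-obj (proj₁ (remQuot {m} m k)) (proj₂ (remQuot {m} m k))) [] ≤-refl
        from-family : Family → PathSystem
        from-family (f , _ , disj) = record
          { ps = ps
          ; short = λ i j → proj₁ (proj₂ (f (combine i j)))
          ; good = λ i j → subst (λ p → toℕ (proj₁ p) < toℕ (proj₂ p) → GoodPath β (proj₁ p) (proj₂ p) (ps i j))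
              (Finₚ.remQuot-combine i j) (proj₂ (proj₂ (f (combine i j))))
          ; pairwise = λ i j i′ j′ distinct → disj (combine i j) (combine i′ j′) (distinct ∘ Finₚ.combine-injective i j i′ j′)
          }
          where
          ps : Fin m → Fin m → List (Fin N)
          ps i j = proj₁ (f (combine i j))

      module WithPaths (system : PathSystem) where

        open PathSystem system

        ℓs : Fin m → Fin m → ℕ
        ℓs i j = length (ps i j)

        place : SubV m ℓs → Fin N
        place (branch i)      = S i
        place (inner i j _ k) = lookup (ps i j) k

        place-proper : ∀ x → repeats (tup (place x)) ≡ 0
        place-proper (branch i)      = proper (β i)
        place-proper (inner i j p k) = GoodPath.proper (good i j p) (∈-lookup k)

        Same : SubV m ℓs → SubV m ℓs → Set
        Same x y = x ≡ y ⊎ Disjoint (verts (place x)) (verts (place y))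

        same-branch : ∀ i j → Same (branch i) (branch j)
        same-branch i j = decide (i Finₚ.≟ j)
          where
          decide : Dec (i ≡ j) → Same (branch i) (branch j)
          decide (yes refl) = inj₁ refl
          decide (no i≢j) = inj₂ (β-disjoint i j i≢j)

        same-inner : ∀ i j p k i′ j′ p′ k′ → Same (inner i j p k) (inner i′ j′ p′ k′)
        same-inner i j p k i′ j′ p′ k′ = decide (i Finₚ.≟ i′) (j Finₚ.≟ j′)
          where
          different : ¬ (i ≡ i′ × j ≡ j′) → Same (inner i j p k) (inner i′ j′ p′ k′)
          different distinct = inj₂ λ u∈ u∈′ → pairwise i j i′ j′ distinct
            (∈-feet⁺ {ps i j} (∈-lookup k) u∈) (∈-feet⁺ {ps i′ j′} (∈-lookup k′) u∈′)
          on-path : ∀ k k′ p′ → Dec (k ≡ k′) → Same (inner i j p k) (inner i j p′ k′)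
          -- An inner vertex carries its proof of i < j, so equality of vertices needs the
          -- uniqueness of such proofs.
          on-path k k′ p′ (yes refl) = inj₁ (cong (λ p → inner i j p k) (<-irrelevant p p′))
          on-path k k′ p′ (no k≢k′) = inj₂ (GoodPath.disjoint (good i j p) (∈-lookup k) (∈-lookup k′)
            (k≢k′ ∘ Erasure.lookup-injective (S j) (GoodPath.distinct (good i j p)) k k′))
          decide : Dec (i ≡ i′) → Dec (j ≡ j′) → Same (inner i j p k) (inner i′ j′ p′ k′)
          decide (yes refl) (yes refl) = on-path k k′ p′ (k Finₚ.≟ k′)
          decide (no i≢) _ = different (i≢ ∘ proj₁)
          decide (yes _) (no j≢) = different (j≢ ∘ proj₂)

        same : ∀ x y → Same x y
        same (branch i) (branch j) = same-branch i j
        same (branch i) (inner j k p l) = inj₂ λ u∈ u∈′ → GoodPath.outside (good j k p) (∈-lookup l) i u∈′ u∈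
        same (inner j k p l) (branch i) = inj₂ λ u∈ u∈′ → GoodPath.outside (good j k p) (∈-lookup l) i u∈ u∈′
        same (inner i j p k) (inner i′ j′ p′ k′) = same-inner i j p k i′ j′ p′ k′

        edge : ∀ {x y} → SubE m ℓs x y → Edge (place x) (place y)
        edge (direct i j i<j eq)     = Erasure.chain-direct (S j) (GoodPath.chain (good i j i<j)) eq
        edge (start i j i<j k eq)    = Erasure.chain-first (S j) (GoodPath.chain (good i j i<j)) k eq
        edge (mid i j i<j k k′ eq)   = Erasure.chain-next (S j) (GoodPath.chain (good i j i<j)) k k′ eq
        edge (end i j i<j k eq)      = Erasure.chain-last (S j) (GoodPath.chain (good i j i<j)) k eq

        φ : SubV m ℓs × Fin (suc r) → Fin n
        φ (x , i) = tup (place x) i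

        φ-injective : ∀ x y → φ x ≡ φ y → x ≡ y
        φ-injective (x , i) (y , j) eq = decide (same x y)
          where
          decide : Same x y → (x , i) ≡ (y , j)
          decide (inj₁ refl) = cong (x ,_) (tup-injective {place x} (place-proper x) i j eq)
          decide (inj₂ disj) = ⊥-elim (disj (∈-verts (place x) i) (subst (_∈ verts (place y)) (sym eq) (∈-verts (place y) j)))

        φ-edge : ∀ x y → Pattern.E (blowUp (suc r) (subdivK m ℓs)) x y → Bool.T (adj G (φ x) (φ y))
        φ-edge (x , i) (y , j) (inj₁ e) = A-complete {place x} {place y} (edge e) i j
        φ-edge (x , i) (y , j) (inj₂ e) = subst Bool.T (Graph.sym G (φ (y , j)) (φ (x , i))) (A-complete {place y} {place x} (edge e) j i)

        contains : Contains G (blowUp (suc r) (subdivK m ℓs))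
        contains = φ , φ-injective , φ-edge

  Result : Set
  Result = Σ (Fin m → Fin m → ℕ) λ ℓs → (∀ i j → ℓs i j ≤ K) × Contains G (blowUp (suc r) (subdivK m ℓs))

  result : Result
  result = from-core core
    where
    from-core : ∃[ v ] (v ⊑ rich × 1 ≤ vol v × Dense h 0 v × Expander h v) → Result
    from-core (v , v⊑ , 1≤vol , dense , expander) = from-branches branches
      where
      open WithCore v v⊑ 1≤vol dense expander
      from-branches : Σ (Fin m → Branch) (λ β → ∀ j k → j ≢ k → Disjoint (verts (Branch.at (β j))) (verts (Branch.at (β k)))) → Result
      from-branches (β , disj) = from-paths (WithBranches.path-system β disj)
        where
        from-paths : WithBranches.PathSystem β disj → Result
        from-paths system = ℓs , PathSystem.short system , contains
          where
          open WithBranches β disj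
          open WithPaths system

-- Integer logarithms and the choice of parameters

-- The strict inequality is placed below because `manyEdges⇒` has to refute n ≤ 2 ^ L.
log₂-bracket : ∀ n → 2 ≤ n → ∃[ L ] (2 ^ L < n × n ≤ 2 ^ suc L)
log₂-bracket (suc zero) (s≤s ())
log₂-bracket (suc (suc zero)) _ = 0 , s≤s (s≤s z≤n) , s≤s (s≤s z≤n)
log₂-bracket (suc (suc (suc k))) _ with log₂-bracket (suc (suc k)) (s≤s (s≤s z≤n))
... | L , lo , hi with suc (suc (suc k)) ≤? 2 ^ suc L
...   | yes p = L , m≤n⇒m≤1+n lo , p
...   | no ¬p = suc L , ≰⇒> ¬p , ≤-trans (s≤s hi) (≤-trans (+-monoˡ-≤ (2 ^ suc L) (m^n>0 2 (suc L)))
                  (≤-reflexive (cong (2 ^ suc L +_) (sym (+-identityʳ (2 ^ suc L))))))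

atMostLog6 : ∀ {n t} L → 2 ^ L ≤ n → t ≤ L ^ 6 → AtMostLog6 n t
atMostLog6 {n} {t} L 2^L≤n t≤ p q 1≤q p⁶< = begin
  2 ^ p         ≤⟨ ^-monoʳ-≤ 2 p≤Lq ⟩
  2 ^ (L * q)   ≡⟨ ^-*-assoc 2 L q ⟨
  (2 ^ L) ^ q   ≤⟨ ^-monoˡ-≤ q 2^L≤n ⟩
  n ^ q         ∎
  where
  open ≤-Reasoning
  p≤Lq : p ≤ L * q
  p≤Lq with p ≤? L * q
  ... | yes le = le
  ... | no ¬le = ⊥-elim (<-irrefl refl (<-≤-trans p⁶< (≤-trans (*-monoˡ-≤ (q ^ 6) t≤)
          (≤-trans (≤-reflexive (sym (^-distribʳ-* 6 L q))) (^-monoˡ-≤ 6 (<⇒≤ (≰⇒> ¬le)))))))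

-- The rational p / q = L / 1 is tested: if the conclusion failed, `ManyEdges` would give n ≤ 2 ^ L.
manyEdges⇒ : ∀ {n e} r L → 2 ^ L < n → ManyEdges (suc r) n e → L ^ 60 * n ^ (2 * suc r ∸ 1) ≤ e ^ suc r
manyEdges⇒ {n} {e} r L 2^L<n many = ≮⇒≥ λ lt → <-irrefl refl (<-≤-trans 2^L<n
  (≤-trans (≤-reflexive (sym (*-identityʳ n))) (many L 1 ≤-refl (≤-<-trans (≤-reflexive (*-identityʳ (e ^ suc r))) lt))))

-- Here the exponent 2 - 1/r originates: the power mean inequality for the degrees costs `n ^ r`,
-- and an average codegree X of all `n ^ suc r` tuples supplies the remaining powers of n.
many-codegrees : ∀ {n} (G : Graph n) r X → 1 ≤ n → X * n ^ (2 * suc r ∸ 1) ≤ edgeCount G ^ suc r →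
  X * n ^ suc r ≤ ∑ (TupleGraph.codegree G (suc r))
many-codegrees {n} G r X 1≤n le = *-cancelˡ-≤ (n ^ r) {{>-nonZero (m^n>0 n {{>-nonZero 1≤n}} r)}} (begin
  n ^ r * (X * n ^ suc r)                          ≡⟨ lem (n ^ r) X (n ^ suc r) ⟩
  X * (n ^ r * n ^ suc r)                          ≡⟨ cong (X *_) (^-distribˡ-+-* n r (suc r)) ⟨
  X * n ^ (r + suc r)                              ≡⟨ cong (λ k → X * n ^ (r + suc k)) (+-identityʳ r) ⟨
  X * n ^ (2 * suc r ∸ 1)                          ≤⟨ le ⟩
  edgeCount G ^ suc r                              ≤⟨ Adjacency.degree-powers G r 1≤n ⟩
  n ^ r * ∑ (λ v → Adjacency.degree G v ^ suc r)   ≡⟨ cong (n ^ r *_) (TupleGraph.∑-codegree G (suc r)) ⟨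
  n ^ r * ∑ (TupleGraph.codegree G (suc r))        ∎)
  where
  open ≤-Reasoning
  lem : ∀ a x b → a * (x * b) ≡ x * (a * b)
  lem = solve-∀

-- The constant in K ≤ mixingBound c * L³ that results from h ≤ c L and 2 + 2 h ≤ 4 c L.
mixingBound : ℕ → ℕ
mixingBound c = 3 * (4 * (8 * c * (8 * c)) * (4 * c))

module Parameters (r m L : ℕ) (7≤L : 7 ≤ L)
  (c³≤L : mixingBound (4 * suc r + 1) ≤ L) (rm≤L : suc r * suc r * (m * m + m + 1) ≤ L) where

  R c h τ K ℓ b : ℕ
  R = suc r
  c = 4 * R + 1
  -- Volumes are at most n ^ R * n ^ R, a number of tuples times a largest degree, and n ≤ 2 ^ (L +
  -- 1); the added 1 makes the bound 2 ^ h strict.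
  h = 2 * (suc L * R) + 1
  τ = 4 * (8 * h * (8 * h)) * (2 + 2 * h)
  K = 3 * τ
  -- The vertices of m² paths with at most K tuples each, and of the m branch tuples. In `b` each of
  -- them may be hit by any of R entries, and R² accounts for repeated entries.
  ℓ = m * m * (K * R) + m * R
  b = R * ℓ + R * R

  1≤L : 1 ≤ L
  1≤L = ≤-trans (s≤s z≤n) 7≤L

  instance
    L≢0 : NonZero L
    L≢0 = >-nonZero 1≤L

  1≤h : 1 ≤ h
  1≤h = m≤n+m 1 (2 * (suc L * R))

  h≤cL : h ≤ c * L
  h≤cL = begin
    2 * (suc L * R) + 1            ≡⟨ lem₁ L R ⟩
    2 * (L * R) + 2 * R * 1 + 1    ≤⟨ +-mono-≤ (+-monoʳ-≤ (2 * (L * R)) (*-monoʳ-≤ (2 * R) 1≤L)) 1≤L ⟩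
    2 * (L * R) + 2 * R * L + L    ≡⟨ lem₂ L R ⟩
    (4 * R + 1) * L                ∎
    where
    open ≤-Reasoning
    lem₁ : ∀ L R → 2 * ((1 + L) * R) + 1 ≡ 2 * (L * R) + 2 * R * 1 + 1
    lem₁ = solve-∀
    lem₂ : ∀ L R → 2 * (L * R) + 2 * R * L + L ≡ (4 * R + 1) * L
    lem₂ = solve-∀

  2+2h≤4cL : 2 + 2 * h ≤ 4 * (c * L)
  2+2h≤4cL = begin
    2 + 2 * h              ≡⟨ *-distribˡ-+ 2 1 h ⟨
    2 * (1 + h)            ≤⟨ *-monoʳ-≤ 2 (+-mono-≤ (≤-trans 1≤h h≤cL) h≤cL) ⟩
    2 * (c * L + c * L)    ≡⟨ lem (c * L) ⟩
    4 * (c * L)            ∎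
    where
    open ≤-Reasoning
    lem : ∀ x → 2 * (x + x) ≡ 4 * x
    lem = solve-∀

  -- K is at most a constant times L³, and L exceeds that constant.
  K≤L⁴ : K ≤ L ^ 4
  K≤L⁴ = ≤-trans (*-monoʳ-≤ 3 (*-mono-≤ (*-monoʳ-≤ 4 (*-mono-≤ 8h≤ 8h≤)) 2+2h≤4cL))
    (≤-trans (≤-reflexive (lem 3 4 8 c L)) (*-monoˡ-≤ (L ^ 3) c³≤L))
    where
    8h≤ : 8 * h ≤ 8 * (c * L)
    8h≤ = *-monoʳ-≤ 8 h≤cL
    lem : ∀ a b d c L → a * (b * (d * (c * L) * (d * (c * L))) * (b * (c * L))) ≡ a * (b * (d * c * (d * c)) * (b * c)) * (L * (L * (L * 1)))
    lem = solve-∀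

  b≤L⁵ : b ≤ L ^ 5
  b≤L⁵ = begin
    R * (m * m * (K * R) + m * R) + R * R
      ≡⟨ lem₁ R m K ⟩
    R * R * (m * m * K + m * 1 + 1)
      ≤⟨ *-monoʳ-≤ (R * R) (+-mono-≤ (+-mono-≤ (*-monoʳ-≤ (m * m) K≤L⁴) (*-monoʳ-≤ m 1≤L⁴)) 1≤L⁴) ⟩
    R * R * (m * m * L ^ 4 + m * L ^ 4 + L ^ 4)
      ≡⟨ lem₂ R m (L ^ 4) ⟩
    R * R * (m * m + m + 1) * L ^ 4
      ≤⟨ *-monoˡ-≤ (L ^ 4) rm≤L ⟩
    L * L ^ 4 ∎
    where
    open ≤-Reasoning
    1≤L⁴ : 1 ≤ L ^ 4
    1≤L⁴ = m^n>0 L 4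
    lem₁ : ∀ R m K → R * (m * m * (K * R) + m * R) + R * R ≡ R * R * (m * m * K + m * 1 + 1)
    lem₁ = solve-∀
    lem₂ : ∀ R m p → R * R * (m * m * p + m * p + p) ≡ R * R * (m * m + m + 1) * p
    lem₂ = solve-∀

  -- With K ≤ L⁴ and b ≤ L⁵ the left side is at most 2 L⁸ * 3 L⁹ = 6 L¹⁷, and the constant is
  -- absorbed by 6 < L.
  D-large : (K + K * K) * (3 * (K * b)) < L ^ 59
  D-large = begin-strict
    (K + K * K) * (3 * (K * b))
      ≤⟨ *-mono-≤ (+-monoˡ-≤ (K * K) (m*m≥m K)) (*-monoʳ-≤ 3 (*-mono-≤ K≤L⁴ b≤L⁵)) ⟩
    (K * K + K * K) * (3 * (L ^ 4 * L ^ 5))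
      ≤⟨ *-monoˡ-≤ (3 * (L ^ 4 * L ^ 5)) (+-mono-≤ (*-mono-≤ K≤L⁴ K≤L⁴) (*-mono-≤ K≤L⁴ K≤L⁴)) ⟩
    (L ^ 4 * L ^ 4 + L ^ 4 * L ^ 4) * (3 * (L ^ 4 * L ^ 5))
      ≡⟨ lem (L ^ 4) (L ^ 5) ⟩
    6 * (L ^ 4 * L ^ 4 * (L ^ 4 * L ^ 5))
      ≡⟨ cong (6 *_) (trans (cong₂ _*_ (sym (^-distribˡ-+-* L 4 4)) (sym (^-distribˡ-+-* L 4 5))) (sym (^-distribˡ-+-* L 8 9))) ⟩
    6 * L ^ 17
      <⟨ *-monoˡ-< (L ^ 17) {{>-nonZero (m^n>0 L 17)}} 7≤L ⟩
    L ^ 18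
      ≤⟨ ^-monoʳ-≤ L (≤ᵇ⇒≤ 18 59 _) ⟩
    L ^ 59 ∎
    where
    open ≤-Reasoning
    lem : ∀ p q → (p * p + p * p) * (3 * (p * q)) ≡ 6 * (p * p * (p * q))
    lem = solve-∀

  D-large′ : 4 * b < L ^ 59
  D-large′ = begin-strict
    4 * b        ≤⟨ *-monoʳ-≤ 4 b≤L⁵ ⟩
    4 * L ^ 5    <⟨ *-monoˡ-< (L ^ 5) {{>-nonZero (m^n>0 L 5)}} (≤-trans (≤ᵇ⇒≤ 5 7 _) 7≤L) ⟩
    L ^ 6        ≤⟨ ^-monoʳ-≤ L (≤ᵇ⇒≤ 6 59 _) ⟩
    L ^ 59       ∎
    where open ≤-Reasoning

  K≤L⁶ : K ≤ L ^ 6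
  K≤L⁶ = ≤-trans K≤L⁴ (^-monoʳ-≤ L (≤ᵇ⇒≤ 4 6 _))

  tuples-small : ∀ {n} → n ≤ 2 ^ suc L → n ^ R * n ^ R < 2 ^ h
  tuples-small {n} n≤ = begin-strict
    n ^ R * n ^ R                          ≤⟨ *-mono-≤ n^R≤ n^R≤ ⟩
    2 ^ (suc L * R) * 2 ^ (suc L * R)      ≡⟨ ^-distribˡ-+-* 2 (suc L * R) (suc L * R) ⟨
    2 ^ (suc L * R + suc L * R)            ≡⟨ cong (2 ^_) (cong (suc L * R +_) (+-identityʳ (suc L * R))) ⟨
    2 ^ (2 * (suc L * R))                  <⟨ ^-monoʳ-< 2 ≤-refl (m<m+n (2 * (suc L * R)) (s≤s z≤n)) ⟩
    2 ^ h                                  ∎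
    where
    open ≤-Reasoning
    n^R≤ : n ^ R ≤ 2 ^ (suc L * R)
    n^R≤ = ≤-trans (^-monoˡ-≤ R n≤) (≤-reflexive (^-*-assoc 2 (suc L) R))

-- From a fixed scale L to all sufficiently large n

blow-up-of-subdivision : ∀ r m L → 7 ≤ L → mixingBound (4 * suc r + 1) ≤ L → suc r * suc r * (m * m + m + 1) ≤ L →
  ∀ n → 2 ^ L < n → n ≤ 2 ^ suc L → (G : Graph n) → ManyEdges (suc r) n (edgeCount G) →
  Σ (Fin m → Fin m → ℕ) λ ℓ → ((i j : Fin m) → AtMostLog6 n (ℓ i j)) × Contains G (blowUp (suc r) (subdivK m ℓ))
blow-up-of-subdivision r m L 7≤L c³≤L rm≤L n 2^L<n n≤ G many =
  finish (Embedding.result G r (L ^ 59) h 1≤n (m^n>0 L 59) 1≤h (tuples-small n≤) dense m τ ℓ b ≤-refl ≤-refl ≤-refl D-large D-large′)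
  where
  open Parameters r m L 7≤L c³≤L rm≤L
  1≤n : 1 ≤ n
  1≤n = ≤-trans (s≤s z≤n) 2^L<n
  dense : 5 * (L ^ 59 * n ^ suc r) ≤ ∑ (TupleGraph.codegree G (suc r))
  -- One of the sixty factors L pays for the constant 5; the other 59 form the codegree bound `D`.
  dense = ≤-trans (≤-reflexive (sym (*-assoc 5 (L ^ 59) (n ^ suc r))))
    (≤-trans (*-monoˡ-≤ (n ^ suc r) (*-monoˡ-≤ (L ^ 59) (≤-trans (≤ᵇ⇒≤ 5 7 _) 7≤L)))
      (many-codegrees G r (L ^ 60) 1≤n (manyEdges⇒ {n} {edgeCount G} r L 2^L<n many)))
  finish : (Σ (Fin m → Fin m → ℕ) λ ℓs → (∀ i j → ℓs i j ≤ K) × Contains G (blowUp (suc r) (subdivK m ℓs))) →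
    Σ (Fin m → Fin m → ℕ) λ ℓ → ((i j : Fin m) → AtMostLog6 n (ℓ i j)) × Contains G (blowUp (suc r) (subdivK m ℓ))
  finish (ℓs , short , contains) = ℓs , (λ i j → atMostLog6 L (<⇒≤ 2^L<n) (≤-trans (short i j) K≤L⁶)) , contains

log₂-large : ∀ L₀ {L n} → 2 ^ L₀ < n → n ≤ 2 ^ suc L → L₀ ≤ L
log₂-large L₀ {L} n> n≤ with L₀ ≤? L
... | yes p = p
... | no ¬p = ⊥-elim (<-irrefl refl (<-≤-trans n> (≤-trans n≤ (^-monoʳ-≤ 2 (≰⇒> ¬p)))))

eventually : ∀ r m L₀ → 7 ≤ L₀ → mixingBound (4 * suc r + 1) ≤ L₀ → suc r * suc r * (m * m + m + 1) ≤ L₀ →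
  Σ ℕ λ N → (n : ℕ) → N ≤ n → (G : Graph n) → ManyEdges (suc r) n (edgeCount G) →
  Σ (Fin m → Fin m → ℕ) λ ℓ → ((i j : Fin m) → AtMostLog6 n (ℓ i j)) × Contains G (blowUp (suc r) (subdivK m ℓ))
eventually r m L₀ 7≤ c³≤ rm≤ = suc (2 ^ L₀) , λ n n> → large n n> (log₂-bracket n (≤-trans (s≤s (m^n>0 2 L₀)) n>))
  where
  large : ∀ n → 2 ^ L₀ < n → ∃[ L ] (2 ^ L < n × n ≤ 2 ^ suc L) → (G : Graph n) → ManyEdges (suc r) n (edgeCount G) →
    Σ (Fin m → Fin m → ℕ) λ ℓ → ((i j : Fin m) → AtMostLog6 n (ℓ i j)) × Contains G (blowUp (suc r) (subdivK m ℓ))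
  large n n> (L , 2^L<n , n≤) =
    blow-up-of-subdivision r m L (≤-trans 7≤ L₀≤L) (≤-trans c³≤ L₀≤L) (≤-trans rm≤ L₀≤L) n 2^L<n n≤
    where
    L₀≤L : L₀ ≤ L
    L₀≤L = log₂-large L₀ n> n≤

theorem4 : (r m : ℕ) → 1 ≤ r → 1 ≤ m →
    Σ ℕ λ N → (n : ℕ) → N ≤ n → (G : Graph n) →
    ManyEdges r n (edgeCount G) →
    Σ (Fin m → Fin m → ℕ) λ ℓ →
    ((i j : Fin m) → AtMostLog6 n (ℓ i j)) ×
    Contains G (blowUp r (subdivK m ℓ))
theorem4 (suc r) m _ _ = eventually r m (7 + (x + y)) (m≤m+n 7 (x + y))
    (≤-trans (m≤m+n x y) (m≤n+m (x + y) 7)) (≤-trans (m≤n+m y x) (m≤n+m (x + y) 7))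
  where
  x y : ℕ
  x = mixingBound (4 * suc r + 1)
  y = suc r * suc r * (m * m + m + 1)
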